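{- Every path-friendship graph is determined by its Laplacian spectrum (DLS); that is, if $G$ is a path-friendship graph and $H$ is any graph whose Laplacian matrix has the same multiset of eigenvalues as that of $G$, then $H$ is isomorphic to $G$.
   Context: All graphs are finite and simple. The Laplacian matrix of a graph is $L(G)=D(G)-A(G)$, where $A(G)$ is the adjacency matrix and $D(G)$ the diagonal matrix of vertex degrees. The friendship graph $F_s$ consists of $s$ triangles sharing exactly one common vertex (its center). A starlike tree is obtained by identifying one endpoint of each of several paths into a single vertex (its root). A path-friendship graph is obtained by identifying the center of a friendship graph $F_s$ with the root of a starlike tree; equivalently, it consists of $s$ triangles and $k$ pendant paths (of arbitrary lengths $t_1,\dots,t_k\ge 1$) all sharing one common vertex. -}

module Defs where

open import Data.Bool using (Bool; true; false; if_then_else_; _∨_)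
open import Data.Nat as ℕ using (ℕ; zero; suc; _≤_)
open import Data.Integer as ℤ using (ℤ; +_; -_)
open import Data.Fin using (Fin; toℕ; punchIn)
open import Data.Fin.Properties using () renaming (_≟_ to _≟F_)
open import Data.List using (List; []; _∷_; map; foldr; tabulate; length; _++_)
open import Data.Nat.ListAction using (sum)
open import Data.Empty using (⊥-elim)
open import Relation.Nullary using (yes; no)
open import Data.Product using (Σ; ∃)
open import Data.List.Relation.Unary.All using (All)
open import Data.Product using (_×_; _,_)
open import Data.Product.Properties using (≡-dec)
open import Data.List.Membership.DecPropositional (≡-dec ℕ._≟_ ℕ._≟_) using (_∈?_)
open import Relation.Nullary.Decidable using (⌊_⌋)
open import Relation.Binary.PropositionalEquality using (_≡_)
open import Function.Bundles using (_⤖_; Bijection)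

record Graph (n : ℕ) : Set where
  field
    adj    : Fin n → Fin n → Bool
    sym    : ∀ i j → adj i j ≡ adj j i
    irrefl : ∀ i → adj i i ≡ false
open Graph public

_≅_ : ∀ {n m} → Graph n → Graph m → Set
_≅_ {n} {m} G H =
  Σ (Fin n ⤖ Fin m) λ f → ∀ i j → adj G i j ≡ adj H (Bijection.to f i) (Bijection.to f j)

-- Integer polynomials as coefficient lists (constant term first)

Poly : Set
Poly = List ℤ

addP : Poly → Poly → Poly
addP [] q = q
addP p [] = p
addP (a ∷ p) (b ∷ q) = (a ℤ.+ b) ∷ addP p q

scaleP : ℤ → Poly → Poly
scaleP c p = map (c ℤ.*_) p

mulP : Poly → Poly → Poly
mulP [] q = []
mulP (a ∷ p) q = addP (scaleP a q) (+ 0 ∷ mulP p q)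

negP : Poly → Poly
negP = scaleP (- (+ 1))

coeff : Poly → ℕ → ℤ
coeff [] _ = + 0
coeff (a ∷ p) zero = a
coeff (a ∷ p) (suc k) = coeff p k

signP : ℕ → Poly → Poly
signP zero p = p
signP (suc k) p = negP (signP k p)

det : (n : ℕ) → (Fin n → Fin n → Poly) → Poly
det zero M = (+ 1) ∷ []
det (suc n) M =
  foldr addP []
    (tabulate λ (j : Fin (suc n)) →
       signP (toℕ j) (mulP (M Fin.zero j) (det n (λ i k → M (Fin.suc i) (punchIn j k)))))
  where import Data.Fin as Fin

degree : ∀ {n} → Graph n → Fin n → ℕ
degree {n} G i = sum (tabulate λ j → if adj G i j then 1 else 0)

laplacian : ∀ {n} → Graph n → Fin n → Fin n → ℤ
laplacian G i j =
  if ⌊ i ≟F j ⌋ then + degree G i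
  else (if adj G i j then - (+ 1) else + 0)

charPolyL : ∀ {n} → Graph n → Poly
charPolyL {n} G =
  det n λ i j → addP (if ⌊ i ≟F j ⌋ then (+ 0 ∷ + 1 ∷ []) else [])
                     ((- laplacian G i j) ∷ [])

-- Laplacian cospectral: same characteristic polynomial of the Laplacian,
-- i.e. the same multiset of Laplacian eigenvalues (roots counted with multiplicity)
LCospectral : ∀ {n m} → Graph n → Graph m → Set
LCospectral G H = ∀ k → coeff (charPolyL G) k ≡ coeff (charPolyL H) k

fromEdges : (n : ℕ) → List (ℕ × ℕ) → Graph n
fromEdges n es = record { adj = a ; sym = s ; irrefl = r }
  where
  open import Relation.Binary.PropositionalEquality using (refl)
  open import Data.Bool.Properties using (∨-comm)
  a : Fin n → Fin n → Bool
  a i j = if ⌊ i ≟F j ⌋ then false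
          else (⌊ (toℕ i , toℕ j) ∈? es ⌋ ∨ ⌊ (toℕ j , toℕ i) ∈? es ⌋)
  s : ∀ i j → a i j ≡ a j i
  s i j with i ≟F j | j ≟F i
  ... | yes _ | yes _ = refl
  ... | no _ | no _ =
        ∨-comm ⌊ (toℕ i , toℕ j) ∈? es ⌋ ⌊ (toℕ j , toℕ i) ∈? es ⌋
  ... | yes refl | no ¬p = ⊥-elim (¬p refl)
  ... | no ¬p | yes refl = ⊥-elim (¬p refl)
  r : ∀ i → a i i ≡ false
  r i with i ≟F i
  ... | yes _ = refl
  ... | no ¬p = ⊥-elim (¬p refl)

-- Path-friendship graph: center 0; triangle r (r < s) on {0, 1+2r, 2+2r};
-- pendant paths of t₁,…,t_k edges attached at 0, using the remaining vertices.

triangleEdges : ℕ → List (ℕ × ℕ)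
triangleEdges zero = []
triangleEdges (suc r) =
  (0 , 1 ℕ.+ 2 ℕ.* r) ∷ (0 , 2 ℕ.+ 2 ℕ.* r) ∷ (1 ℕ.+ 2 ℕ.* r , 2 ℕ.+ 2 ℕ.* r)
  ∷ triangleEdges r

pathEdges : (prev o t : ℕ) → List (ℕ × ℕ)
pathEdges prev o zero = []
pathEdges prev o (suc t) = (prev , o) ∷ pathEdges o (suc o) t

pathsEdges : ℕ → List ℕ → List (ℕ × ℕ)
pathsEdges o [] = []
pathsEdges o (t ∷ ts) = pathEdges 0 o t ++ pathsEdges (o ℕ.+ t) ts

pfVertices : ℕ → List ℕ → ℕ
pfVertices s ts = 1 ℕ.+ 2 ℕ.* s ℕ.+ sum ts

pathFriendship : (s : ℕ) (ts : List ℕ) → Graph (pfVertices s ts)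
pathFriendship s ts =
  fromEdges (pfVertices s ts) (triangleEdges s ++ pathsEdges (1 ℕ.+ 2 ℕ.* s) ts)

IsPathFriendship : ∀ {n} → Graph n → Set
IsPathFriendship G =
  ∃ λ s → ∃ λ ts → 1 ≤ s × 1 ≤ length ts × All (1 ≤_) ts × (G ≅ pathFriendship s ts)

{-# OPTIONS --safe #-}
module Submission where

-- Evaluating det (aI + bL) homogenises the Laplacian characteristic polynomial.  At
-- (1, y) modulo y⁴ it yields Σd, Σd² and Σd³ − 6·#triangles, and at (y, 1) modulo y²
-- the number of spanning trees.  Let G have s triangles and centre degree Δ, and let
-- H be cospectral with G.  Then H is connected, Σ(d−1)(d−2) = (Δ−1)(Δ−2), and bounding
-- Σ(d−1)(d−2)(d−3) through the maximum degree leaves two cases: H has one vertex of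
-- degree Δ, all others of degree at most 2, and s triangles; or s ≤ 2 and H is
-- triangle-free.  The second is impossible, because a triangle-free connected graph of
-- cyclomatic number 1 (respectively 2) has at least 4 (respectively 10) spanning trees,
-- whereas G has 3ˢ.  In the first case H again consists of s triangles and some paths
-- at one vertex.  At a = (1 − y)², b = y a path of length t contributes polynomials in
-- y²ᵗ, so the shortest length t on which the two graphs differ would show in the
-- coefficient of y²ᵗ⁺².

open import Defs hiding (sym)
open import Data.Bool using (Bool; true; false; if_then_else_; _∧_; _∨_; not)
import Data.Bool.Properties as BoolP
open import Data.Empty using (⊥)
open import Data.Fin using (Fin; zero; suc; toℕ; fromℕ; inject₁; pinch; punchIn; punchOut)
open import Data.Fin.Permutation as Perm using (Permutation; permutation; _⟨$⟩ʳ_; _⟨$⟩ˡ_)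
open import Data.Fin.Properties using (_≟_; any?; suc-injective; toℕ-injective; toℕ<n; toℕ-fromℕ; toℕ-inject₁; inject₁-injective; punchInᵢ≢i; punchIn-injective; punchIn-punchOut; punchOut-punchIn; punchOut-cong)
open import Data.Integer using (ℤ; +_; -[1+_]; -_; _+_; _*_; _-_; _^_; _≤_; _<_; +≤+; +<+; -≤+; 0ℤ; 1ℤ; ∣_∣; nonNegative; ≢-nonZero)
import Data.Integer.Properties as ℤP
open import Data.Integer.Tactic.RingSolver using (solve-∀)
open import Data.List using (List; []; _∷_; _++_; foldr; length; map; replicate; tabulate)
open import Data.List.Membership.Propositional using (_∈_; _∉_)
open import Data.List.Membership.Propositional.Properties using (∈-++⁻; ∈-++⁺ˡ; ∈-++⁺ʳ; ∈-∃++)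
open import Data.List.Properties using (++-assoc; ++-identityʳ)
open import Data.List.Relation.Binary.Permutation.Propositional as ListPerm using (_↭_; ↭-refl; ↭-sym; ↭-trans; prep; swap)
open import Data.List.Relation.Binary.Permutation.Propositional.Properties using (All-resp-↭; map⁺; shift; ↭-length; ++⁺ʳ)
open import Data.List.Relation.Unary.All as All using (All; []; _∷_)
import Data.List.Relation.Unary.All.Properties as AllP
open import Data.List.Relation.Unary.AllPairs using (AllPairs; []; _∷_)
open import Data.List.Relation.Unary.Any using (here; there)
open import Data.Maybe as Maybe using (Maybe; just; nothing)
open import Data.Nat as ℕ using (ℕ; zero; suc; z≤n; s≤s)
open import Data.Nat.ListAction as ListAction using ()
import Data.Nat.Properties as ℕP
open import Data.Nat.Tactic.RingSolver using () renaming (solve-∀ to ℕ-solve-∀)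
open import Data.Product using (∃; _×_; _,_; proj₁; proj₂)
open import Data.Product.Properties using (≡-dec)
open import Data.Sum using (_⊎_; inj₁; inj₂)
open import Data.Unit using (⊤; tt)
open import Data.Vec.Functional using (insertAt)
open import Data.Vec.Functional.Properties using (insertAt-lookup; insertAt-punchIn; insertAt-removeAt)
open import Function using (_∘_; case_of_)
open import Function.Bundles using (Inverse; mk↔ₛ′)
open import Function.Properties.Bijection using (⤖⇒↔)
open import Function.Properties.Inverse using (↔⇒⤖)
open import Relation.Binary.Definitions using (tri<; tri≈; tri>)
open import Relation.Binary.PropositionalEquality using (_≡_; _≢_; refl; sym; trans; cong; cong₂; subst; subst₂; module ≡-Reasoning)
open import Relation.Nullary using (¬_; Dec; yes; no; does; contradiction)
open import Relation.Nullary.Decidable using (⌊_⌋; dec-true; dec-false; _×-dec_; ¬?)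
open import Algebra.Properties.Semiring.Sum ℤP.+-*-semiring using (sum; sum-cong-≗; sum-remove; sum-replicate-zero; ∑-comm; ∑-distrib-+; ∑-permute; *-distribˡ-sum)
open import Data.List.Membership.DecPropositional (≡-dec ℕ._≟_ ℕ._≟_) using (_∈?_)

-- The determinant is handled through `D`, whose data are row sums and negated off-diagonal entries.
-- For aI + bL with a, b ≥ 0 these are nonnegative and the recursion never subtracts, so positivity,
-- vanishing and contraction of spanning trees become plain inductions; signs occur only on the way
-- from the characteristic polynomial to `D`. Coefficients of polynomials in y are not extracted.
-- Identities are congruences of integers modulo powers of y, valid for every positive y, and
-- integers congruent modulo every positive number are equal. If all degrees of H were below Δ, then
-- d - 3 ≤ Δ - 4 in the cubic sum would force (Δ-1)(Δ-2) plus six times the number of triangles of H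
-- to be at most 6s; against Δ ≥ 2s + 1 this leaves very few cases. The choice a = (1 - y)², b = y
-- is made for the path recurrence, whose trace a + 2b = 1 + y² and determinant b² = y² then belong
-- to the rational eigenvalues 1 and y². With k paths, the coefficient that detects a differing
-- length is a multiple of 2s - 2 + k, which must not vanish.

∑ : ∀ {n} → (Fin n → ℤ) → ℤ
∑ = sum

∑-cong : ∀ {n} {f g : Fin n → ℤ} → (∀ i → f i ≡ g i) → ∑ f ≡ ∑ g
∑-cong = sum-cong-≗

∑-zero : ∀ {n} {f : Fin n → ℤ} → (∀ i → f i ≡ 0ℤ) → ∑ f ≡ 0ℤ
∑-zero {n} h = trans (∑-cong h) (sum-replicate-zero n)

∑-* : ∀ {n} x (f : Fin n → ℤ) → ∑ (λ i → x * f i) ≡ x * ∑ f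
∑-* x f = sym (*-distribˡ-sum x f)

∑-lin : ∀ {n} x y (f g : Fin n → ℤ) → ∑ (λ i → x * f i + y * g i) ≡ x * ∑ f + y * ∑ g
∑-lin x y f g = trans (∑-distrib-+ (λ i → x * f i) (λ i → y * g i)) (cong₂ _+_ (∑-* x f) (∑-* y g))

⟦_⟧ : Bool → ℤ
⟦ b ⟧ = if b then 1ℤ else 0ℤ

δ : ∀ {n} → Fin n → Fin n → ℤ
δ i j = ⟦ does (i ≟ j) ⟧

δ-refl : ∀ {n} (i : Fin n) → δ i i ≡ 1ℤ
δ-refl i = cong ⟦_⟧ (dec-true (i ≟ i) refl)

δ-≢ : ∀ {n} {i j : Fin n} → i ≢ j → δ i j ≡ 0ℤ
δ-≢ {i = i} {j} p = cong ⟦_⟧ (dec-false (i ≟ j) p)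

δ-sym : ∀ {n} (i j : Fin n) → δ i j ≡ δ j i
δ-sym i j with i ≟ j
... | yes refl = sym (δ-refl i)
... | no p     = sym (δ-≢ (p ∘ sym))

∑-δ : ∀ {n} (i : Fin n) (f : Fin n → ℤ) → ∑ (λ t → δ i t * f t) ≡ f i
∑-δ zero f = trans (cong₂ _+_ (ℤP.*-identityˡ (f zero)) (∑-zero {f = λ t → 0ℤ * f (suc t)} λ _ → refl)) (ℤP.+-identityʳ (f zero))
∑-δ (suc i) f = trans (ℤP.+-identityˡ _) (∑-δ i (f ∘ suc))

∑-δ′ : ∀ {n} (i : Fin n) (f : Fin n → ℤ) → ∑ (λ t → δ t i * f t) ≡ f i
∑-δ′ i f = trans (∑-cong λ t → cong (_* f t) (δ-sym t i)) (∑-δ i f)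

-- Determinants through row sums and off-diagonal weights

Weights : ℕ → Set
Weights n = Fin n → Fin n → ℤ

absorb : ∀ {n} → (Fin (suc n) → ℤ) → Weights (suc n) → Fin n → ℤ
absorb σ w i = σ (suc i) + w (suc i) zero

rest : ∀ {n} → Weights (suc n) → Weights n
rest w i j = w (suc i) (suc j)

-- Arcs into 0 are redirected to t. An arc from t to 0 thereby becomes a loop on the diagonal, an
-- entry that `D` never reads.
merge : ∀ {n} → Weights (suc n) → Fin n → Weights n
merge w t i j = w (suc i) (suc j) + δ j t * w (suc i) zero

-- D n σ w is the determinant of the matrix with off-diagonal entries −w i j and row
-- sums σ i; it counts spanning trees oriented towards an extra root to which i has
-- σ i arcs.  The recursion contracts vertex 0 into the root or into t.
D : ∀ n → (Fin n → ℤ) → Weights n → ℤ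
D zero    σ w = 1ℤ
D (suc n) σ w = σ zero * D n (absorb σ w) (rest w)
              + ∑ λ t → w zero (suc t) * D n (σ ∘ suc) (merge w t)

-- Loops do not affect `D`, so agreement is asked off the diagonal only; this is what allows the
-- loops created by `merge` to be ignored.
D-cong : ∀ n {σ σ′ : Fin n → ℤ} {w w′ : Weights n} → (∀ i → σ i ≡ σ′ i) →
         (∀ i j → i ≢ j → w i j ≡ w′ i j) → D n σ w ≡ D n σ′ w′
D-cong zero p q = refl
D-cong (suc n) p q = cong₂ _+_
  (cong₂ _*_ (p zero) (D-cong n (λ i → cong₂ _+_ (p (suc i)) (q (suc i) zero λ ()))
                                (λ i j i≢j → q (suc i) (suc j) (i≢j ∘ suc-injective))))
  (∑-cong λ t → cong₂ _*_ (q zero (suc t) λ ())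
    (D-cong n (p ∘ suc) λ i j i≢j →
      cong₂ _+_ (q (suc i) (suc j) (i≢j ∘ suc-injective)) (cong (δ j t *_) (q (suc i) zero λ ()))))

record RowComb {n} (p : Fin n) (x y : ℤ) (σ σ′ σ″ : Fin n → ℤ) (w w′ w″ : Weights n) : Set where
  constructor rowComb
  field
    σ-row : σ″ p ≡ x * σ p + y * σ′ p
    w-row : ∀ j → w″ p j ≡ x * w p j + y * w′ p j
    σ-left : ∀ i → i ≢ p → σ i ≡ σ″ i
    σ-right : ∀ i → i ≢ p → σ′ i ≡ σ″ i
    w-left : ∀ i j → i ≢ p → w i j ≡ w″ i j
    w-right : ∀ i j → i ≢ p → w′ i j ≡ w″ i j

private
  lin₂ : ∀ x y a b c d → (x * a + y * b) + (x * c + y * d) ≡ x * (a + c) + y * (b + d)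
  lin₂ = solve-∀
  lin₂δ : ∀ e x y a b c d → (x * a + y * b) + e * (x * c + y * d) ≡ x * (a + e * c) + y * (b + e * d)
  lin₂δ = solve-∀
  lin₃ : ∀ x y a b d → (x * a + y * b) * d ≡ x * (a * d) + y * (b * d)
  lin₃ = solve-∀
  lin₄ : ∀ x y c a b → c * (x * a + y * b) ≡ x * (c * a) + y * (c * b)
  lin₄ = solve-∀

-- The row of vertex 0 enters only as the outer coefficients of the recursion, and contracting 0
-- acts linearly on every other row, so a combination in row p survives until p itself is
-- eliminated.
D-row : ∀ n (p : Fin n) {x y σ σ′ σ″ w w′ w″} → RowComb p x y σ σ′ σ″ w w′ w″ →
        D n σ″ w″ ≡ x * D n σ w + y * D n σ′ w′
D-row (suc n) zero {x} {y} {σ} {σ′} {σ″} {w} {w′} {w″} r = begin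
  σ″ zero * A″ + ∑ (λ t → w″ zero (suc t) * M″ t)
    ≡⟨ cong₂ _+_ (trans (cong (_* A″) σ-row) (lin₃ x y _ _ A″))
                 (trans (∑-cong λ t → trans (cong (_* M″ t) (w-row (suc t))) (lin₃ x y _ _ (M″ t)))
                        (∑-lin x y (λ t → w zero (suc t) * M″ t) (λ t → w′ zero (suc t) * M″ t))) ⟩
  (x * (σ zero * A″) + y * (σ′ zero * A″))
    + (x * ∑ (λ t → w zero (suc t) * M″ t) + y * ∑ (λ t → w′ zero (suc t) * M″ t))
    ≡⟨ lin₂ x y _ _ _ _ ⟩
  x * (σ zero * A″ + ∑ (λ t → w zero (suc t) * M″ t)) + y * (σ′ zero * A″ + ∑ (λ t → w′ zero (suc t) * M″ t))
    ≡⟨ cong₂ _+_ (cong (x *_) (cong₂ _+_ (cong (σ zero *_) (A≡ σ-left w-left)) (∑-cong λ t → cong (w zero (suc t) *_) (M≡ σ-left w-left t))))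
                 (cong (y *_) (cong₂ _+_ (cong (σ′ zero *_) (A≡ σ-right w-right)) (∑-cong λ t → cong (w′ zero (suc t) *_) (M≡ σ-right w-right t)))) ⟩
  x * D (suc n) σ w + y * D (suc n) σ′ w′ ∎
  where
  open ≡-Reasoning
  open RowComb r
  A″ = D n (absorb σ″ w″) (rest w″)
  M″ = λ t → D n (σ″ ∘ suc) (merge w″ t)
  A≡ : ∀ {s v} → (∀ i → i ≢ zero → s i ≡ σ″ i) → (∀ i j → i ≢ zero → v i j ≡ w″ i j) →
       A″ ≡ D n (absorb s v) (rest v)
  A≡ p q = sym (D-cong n (λ i → cong₂ _+_ (p (suc i) λ ()) (q (suc i) zero λ ())) λ i j _ → q (suc i) (suc j) λ ())
  M≡ : ∀ {s v} → (∀ i → i ≢ zero → s i ≡ σ″ i) → (∀ i j → i ≢ zero → v i j ≡ w″ i j) →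
       ∀ t → M″ t ≡ D n (s ∘ suc) (merge v t)
  M≡ p q t = sym (D-cong n (λ i → p (suc i) λ ()) λ i j _ →
    cong₂ _+_ (q (suc i) (suc j) λ ()) (cong (δ j t *_) (q (suc i) zero λ ())))
D-row (suc n) (suc p) {x} {y} {σ} {σ′} {σ″} {w} {w′} {w″} r = begin
  σ″ zero * D n (absorb σ″ w″) (rest w″) + ∑ (λ t → w″ zero (suc t) * D n (σ″ ∘ suc) (merge w″ t))
    ≡⟨ cong₂ _+_ (trans (cong (σ″ zero *_) (D-row n p absorbed)) (lin₄ x y (σ″ zero) _ _))
                 (trans (∑-cong λ t → trans (cong (w″ zero (suc t) *_) (D-row n p (merged t))) (lin₄ x y (w″ zero (suc t)) _ _))
                        (∑-lin x y (λ t → w″ zero (suc t) * D n (σ ∘ suc) (merge w t)) (λ t → w″ zero (suc t) * D n (σ′ ∘ suc) (merge w′ t)))) ⟩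
  (x * (σ″ zero * D n (absorb σ w) (rest w)) + y * (σ″ zero * D n (absorb σ′ w′) (rest w′)))
    + (x * ∑ (λ t → w″ zero (suc t) * D n (σ ∘ suc) (merge w t)) + y * ∑ (λ t → w″ zero (suc t) * D n (σ′ ∘ suc) (merge w′ t)))
    ≡⟨ lin₂ x y _ _ _ _ ⟩
  x * (σ″ zero * D n (absorb σ w) (rest w) + ∑ (λ t → w″ zero (suc t) * D n (σ ∘ suc) (merge w t)))
    + y * (σ″ zero * D n (absorb σ′ w′) (rest w′) + ∑ (λ t → w″ zero (suc t) * D n (σ′ ∘ suc) (merge w′ t)))
    ≡⟨ sym (cong₂ _+_
         (cong (x *_) (cong₂ _+_ (cong (_* _) (σ-left zero λ ())) (∑-cong λ t → cong (_* _) (w-left zero (suc t) λ ()))))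
         (cong (y *_) (cong₂ _+_ (cong (_* _) (σ-right zero λ ())) (∑-cong λ t → cong (_* _) (w-right zero (suc t) λ ()))))) ⟩
  x * D (suc n) σ w + y * D (suc n) σ′ w′ ∎
  where
  open ≡-Reasoning
  open RowComb r
  absorbed : RowComb p x y (absorb σ w) (absorb σ′ w′) (absorb σ″ w″) (rest w) (rest w′) (rest w″)
  absorbed = rowComb
    (trans (cong₂ _+_ σ-row (w-row zero)) (lin₂ x y _ _ _ _))
    (λ j → w-row (suc j))
    (λ i i≢p → cong₂ _+_ (σ-left (suc i) (i≢p ∘ suc-injective)) (w-left (suc i) zero (i≢p ∘ suc-injective)))
    (λ i i≢p → cong₂ _+_ (σ-right (suc i) (i≢p ∘ suc-injective)) (w-right (suc i) zero (i≢p ∘ suc-injective)))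
    (λ i j i≢p → w-left (suc i) (suc j) (i≢p ∘ suc-injective))
    (λ i j i≢p → w-right (suc i) (suc j) (i≢p ∘ suc-injective))
  merged : ∀ t → RowComb p x y (σ ∘ suc) (σ′ ∘ suc) (σ″ ∘ suc) (merge w t) (merge w′ t) (merge w″ t)
  merged t = rowComb
    σ-row
    (λ j → trans (cong₂ _+_ (w-row (suc j)) (cong (δ j t *_) (w-row zero))) (lin₂δ (δ j t) x y _ _ _ _))
    (λ i i≢p → σ-left (suc i) (i≢p ∘ suc-injective))
    (λ i i≢p → σ-right (suc i) (i≢p ∘ suc-injective))
    (λ i j i≢p → cong₂ _+_ (w-left (suc i) (suc j) (i≢p ∘ suc-injective)) (cong (δ j t *_) (w-left (suc i) zero (i≢p ∘ suc-injective))))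
    (λ i j i≢p → cong₂ _+_ (w-right (suc i) (suc j) (i≢p ∘ suc-injective)) (cong (δ j t *_) (w-right (suc i) zero (i≢p ∘ suc-injective))))

-- Invariance of D under relabelling

module _ {n} (σ : Fin (2 ℕ.+ n) → ℤ) (w : Weights (2 ℕ.+ n)) where
  private
    v₀ v₁ : Fin (2 ℕ.+ n)
    v₀ = zero
    v₁ = suc zero
    up : Fin n → Fin (2 ℕ.+ n)
    up i = suc (suc i)

  bothRoot : ℤ
  bothRoot = D n (λ i → σ (up i) + w (up i) v₀ + w (up i) v₁) (λ i j → w (up i) (up j))

  rootTo : Fin n → ℤ
  rootTo u = D n (λ i → σ (up i) + w (up i) v₀) (λ i j → w (up i) (up j) + δ j u * w (up i) v₁)

  toRoot : Fin n → ℤ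
  toRoot t = D n (λ i → σ (up i) + w (up i) v₁) (λ i j → w (up i) (up j) + δ j t * w (up i) v₀)

  toTo : Fin n → Fin n → ℤ
  toTo t u = D n (λ i → σ (up i)) (λ i j → w (up i) (up j) + δ j t * w (up i) v₀ + δ j u * w (up i) v₁)

  -- Two rounds of the recursion, grouped by where vertices 0 and 1 end up: both at the root, one at
  -- the root, both at one vertex with one pointing to the other, or independently at t and u.
  -- Unlike the nested recursion, this form is visibly symmetric in 0 and 1.
  twoStep : ℤ
  twoStep = (σ v₀ * σ v₁ + σ v₀ * w v₁ v₀ + σ v₁ * w v₀ v₁) * bothRoot
    + (σ v₀ * ∑ (λ u → w v₁ (up u) * rootTo u) + σ v₁ * ∑ (λ t → w v₀ (up t) * toRoot t))
    + (w v₀ v₁ * ∑ (λ u → w v₁ (up u) * toTo u u) + w v₁ v₀ * ∑ (λ t → w v₀ (up t) * toTo t t))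
    + ∑ λ t → ∑ λ u → w v₀ (up t) * (w v₁ (up u) * toTo t u)

  private
    e₁ : ∀ a b c → a + (b + c) ≡ a + c + b
    e₁ = solve-∀
    e₃ : ∀ a → a + 0ℤ ≡ a
    e₃ = solve-∀
    e₄ : ∀ a c s₁ d → (a + d * c) * s₁ ≡ a * s₁ + c * (d * s₁)
    e₄ = solve-∀
    e₅ : ∀ s₀ s₁ x y r P Q R U V →
      s₀ * ((s₁ + y) * r + P) + (x * (s₁ * r + Q) + (s₁ * R + (U + y * V)))
      ≡ (s₀ * s₁ + s₀ * y + s₁ * x) * r + (s₀ * P + s₁ * R) + (x * Q + y * V) + U
    e₅ = solve-∀
    e₆ : ∀ x s r p q → x * (s * r + (p + q)) ≡ s * (x * r) + (x * p + x * q)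
    e₆ = solve-∀
    e₇ : ∀ x y z → x * (y * z) ≡ y * (x * z)
    e₇ = solve-∀
    e₈ : ∀ a b c e → (a + 0ℤ) + e * (b + 1ℤ * c) ≡ a + e * c + e * b
    e₈ = solve-∀

  D-twoStep : D (2 ℕ.+ n) σ w ≡ twoStep
  D-twoStep = trans (cong₂ _+_ first (cong₂ _+_ second third)) (e₅ (σ v₀) (σ v₁) (w v₀ v₁) (w v₁ v₀) bothRoot _ _ _ _ _)
    where
    first : σ v₀ * D (suc n) (absorb σ w) (rest w)
          ≡ σ v₀ * ((σ v₁ + w v₁ v₀) * bothRoot + ∑ (λ u → w v₁ (up u) * rootTo u))
    first = refl
    second : w v₀ v₁ * D (suc n) (σ ∘ suc) (merge w zero)
           ≡ w v₀ v₁ * (σ v₁ * bothRoot + ∑ (λ u → w v₁ (up u) * toTo u u))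
    second = cong (w v₀ v₁ *_) (cong₂ _+_
      (cong (σ v₁ *_) (D-cong n (λ i → trans (cong (λ z → σ (up i) + (w (up i) v₁ + z)) (ℤP.*-identityˡ (w (up i) v₀))) (e₁ (σ (up i)) (w (up i) v₁) (w (up i) v₀))) λ i j _ → e₃ (w (up i) (up j))))
      (∑-cong λ u → cong₂ _*_ (e₃ (w v₁ (up u))) (D-cong n (λ _ → refl) λ i j _ →
        e₈ (w (up i) (up j)) (w (up i) v₁) (w (up i) v₀) (δ j u))))
    third : ∑ (λ t → w v₀ (up t) * D (suc n) (σ ∘ suc) (merge w (suc t)))
          ≡ σ v₁ * ∑ (λ t → w v₀ (up t) * toRoot t)
            + (∑ (λ t → ∑ λ u → w v₀ (up t) * (w v₁ (up u) * toTo t u)) + w v₁ v₀ * ∑ (λ t → w v₀ (up t) * toTo t t))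
    third = trans (∑-cong step)
      (trans (∑-distrib-+ (λ t → σ v₁ * (w v₀ (up t) * toRoot t))
                          (λ t → w v₀ (up t) * ∑ (λ u → w v₁ (up u) * toTo t u) + w v₀ (up t) * (w v₁ v₀ * toTo t t)))
        (cong₂ _+_ (∑-* (σ v₁) (λ t → w v₀ (up t) * toRoot t))
        (trans (∑-distrib-+ (λ t → w v₀ (up t) * ∑ (λ u → w v₁ (up u) * toTo t u)) (λ t → w v₀ (up t) * (w v₁ v₀ * toTo t t))) (cong₂ _+_ (∑-cong λ t → sym (∑-* (w v₀ (up t)) (λ u → w v₁ (up u) * toTo t u)))
          (trans (∑-cong λ t → e₇ (w v₀ (up t)) (w v₁ v₀) (toTo t t)) (∑-* (w v₁ v₀) (λ t → w v₀ (up t) * toTo t t)))))))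
      where
      step : ∀ t → w v₀ (up t) * D (suc n) (σ ∘ suc) (merge w (suc t))
           ≡ σ v₁ * (w v₀ (up t) * toRoot t)
             + (w v₀ (up t) * ∑ (λ u → w v₁ (up u) * toTo t u) + w v₀ (up t) * (w v₁ v₀ * toTo t t))
      step t = trans (cong (w v₀ (up t) *_) (cong₂ _+_
          (cong (σ v₁ *_) (D-cong n (λ i → cong (_+_ (σ (up i))) (e₃ (w (up i) v₁))) λ i j _ → refl))
          (trans (∑-cong λ u → trans (cong ((w v₁ (up u) + δ u t * w v₁ v₀) *_)
                     (D-cong n (λ _ → refl) λ i j _ → cong (λ z → w (up i) (up j) + δ j t * w (up i) v₀ + δ j u * z) (e₃ (w (up i) v₁))))
                   (e₄ (w v₁ (up u)) (w v₁ v₀) (toTo t u) (δ u t)))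
            (trans (∑-distrib-+ (λ u → w v₁ (up u) * toTo t u) (λ u → w v₁ v₀ * (δ u t * toTo t u))) (cong (_+_ (∑ (λ u → w v₁ (up u) * toTo t u)))
              (trans (∑-* (w v₁ v₀) (λ u → δ u t * toTo t u)) (cong (w v₁ v₀ *_) (∑-δ′ t (toTo t)))))))))
        (e₆ (w v₀ (up t)) (σ v₁) (toRoot t) _ _)

swap₀₁ : ∀ {n} → Fin (2 ℕ.+ n) → Fin (2 ℕ.+ n)
swap₀₁ zero          = suc zero
swap₀₁ (suc zero)    = zero
swap₀₁ (suc (suc i)) = suc (suc i)

-- Exchanging the two vertices merely permutes the summands of `twoStep`, up to commuting sums and
-- products.
D-swap : ∀ n σ w → D (2 ℕ.+ n) σ w ≡ D (2 ℕ.+ n) (σ ∘ swap₀₁) (λ i j → w (swap₀₁ i) (swap₀₁ j))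
D-swap n σ w = trans (D-twoStep σ w) (trans step (sym (D-twoStep (σ ∘ swap₀₁) w′)))
  where
  w′ = λ i j → w (swap₀₁ i) (swap₀₁ j)
  r₁ : ∀ a b c → a + b + c ≡ a + c + b
  r₁ = solve-∀
  r₄ : ∀ x y z → x * (y * z) ≡ y * (x * z)
  r₄ = solve-∀
  r₅ : ∀ {a b c a′ b′ c′ d d′} → a ≡ a′ → b ≡ b′ → c ≡ c′ → d ≡ d′ → a + b + c + d ≡ a′ + b′ + c′ + d′
  r₅ refl refl refl refl = refl
  r₆ : ∀ a b x y → a * b + a * y + b * x ≡ b * a + b * x + a * y
  r₆ = solve-∀
  step : twoStep σ w ≡ twoStep (σ ∘ swap₀₁) w′
  step = r₅
    (cong₂ _*_ (r₆ (σ zero) (σ (suc zero)) _ _) (D-cong n (λ i → r₁ (σ (suc (suc i))) (w (suc (suc i)) zero) (w (suc (suc i)) (suc zero))) λ _ _ _ → refl))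
    (ℤP.+-comm (σ zero * ∑ (λ u → w (suc zero) (suc (suc u)) * rootTo σ w u)) _)
    (trans (ℤP.+-comm (w zero (suc zero) * ∑ (λ u → w (suc zero) (suc (suc u)) * toTo σ w u u)) _)
      (cong₂ _+_ (cong (w (suc zero) zero *_) (∑-cong λ t → cong (w zero (suc (suc t)) *_) (D-cong n (λ _ → refl) λ i j _ → r₁ (w (suc (suc i)) (suc (suc j))) (δ j t * w (suc (suc i)) zero) (δ j t * w (suc (suc i)) (suc zero)))))
                 (cong (w zero (suc zero) *_) (∑-cong λ u → cong (w (suc zero) (suc (suc u)) *_) (D-cong n (λ _ → refl) λ i j _ → r₁ (w (suc (suc i)) (suc (suc j))) (δ j u * w (suc (suc i)) zero) (δ j u * w (suc (suc i)) (suc zero)))))))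
    (trans (∑-comm λ t u → w zero (suc (suc t)) * (w (suc zero) (suc (suc u)) * toTo σ w t u))
      (∑-cong λ u → ∑-cong λ t → trans (r₄ (w zero (suc (suc t))) (w (suc zero) (suc (suc u))) (toTo σ w t u))
        (cong (λ z → w (suc zero) (suc (suc u)) * (w zero (suc (suc t)) * z)) (D-cong n (λ _ → refl) λ i j _ → r₁ (w (suc (suc i)) (suc (suc j))) (δ j t * w (suc (suc i)) zero) (δ j u * w (suc (suc i)) (suc zero))))))

δ-perm : ∀ {m n} (π : Permutation m n) i j → δ (π ⟨$⟩ʳ i) (π ⟨$⟩ʳ j) ≡ δ i j
δ-perm π i j with i ≟ j
... | yes refl = δ-refl (π ⟨$⟩ʳ i)
... | no i≢j   = δ-≢ λ e → i≢j (trans (sym (Perm.inverseˡ π)) (trans (cong (π ⟨$⟩ˡ_) e) (Perm.inverseˡ π)))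

cycle : ∀ {n} → Fin (suc n) → Fin (suc n) → Fin (suc n)
cycle v zero    = v
cycle v (suc i) = punchIn v i

PermInvariant : ℕ → ℕ → Set
PermInvariant m n = (π : Permutation m n) (σ : Fin n → ℤ) (w : Weights n) →
  D m (σ ∘ (π ⟨$⟩ʳ_)) (λ i j → w (π ⟨$⟩ʳ i) (π ⟨$⟩ʳ j)) ≡ D n σ w

D-lift : ∀ {m n} → PermInvariant m n → (π : Permutation m n) → ∀ σ w →
  D (suc m) (σ ∘ (Perm.lift₀ π ⟨$⟩ʳ_)) (λ i j → w (Perm.lift₀ π ⟨$⟩ʳ i) (Perm.lift₀ π ⟨$⟩ʳ j)) ≡ D (suc n) σ w
D-lift {m} {n} inv π σ w = cong₂ _+_ (cong (σ zero *_) (inv π (absorb σ w) (rest w)))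
  (trans (∑-cong λ t → cong (w zero (suc (π ⟨$⟩ʳ t)) *_)
           (trans (D-cong m (λ _ → refl) λ i j _ → cong (λ z → w (suc (π ⟨$⟩ʳ i)) (suc (π ⟨$⟩ʳ j)) + z * w (suc (π ⟨$⟩ʳ i)) zero) (sym (δ-perm π j t)))
                  (inv π (σ ∘ suc) (merge w (π ⟨$⟩ʳ t)))))
         (sym (∑-permute (λ t → w zero (suc t) * D n (σ ∘ suc) (merge w t)) π)))

-- The cycle sending 0 to suc v is the transposition of 0 and 1 followed by a permutation fixing 0,
-- so `D-swap` and `D-lift` suffice.
D-cycle : ∀ n → PermInvariant n n → (v : Fin (suc n)) → ∀ σ w →
  D (suc n) (σ ∘ cycle v) (λ i j → w (cycle v i) (cycle v j)) ≡ D (suc n) σ w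
D-cycle n inv zero σ w = D-cong (suc n) (λ i → cong σ (c i)) λ i j _ → cong₂ w (c i) (c j)
  where
  c : ∀ i → cycle zero i ≡ i
  c zero = refl
  c (suc i) = refl
D-cycle (suc n) inv (suc v) σ w = begin
  D (2 ℕ.+ n) (σ ∘ cycle (suc v)) (λ i j → w (cycle (suc v) i) (cycle (suc v) j))
    ≡⟨ D-cong (2 ℕ.+ n) (λ i → cong σ (c i)) (λ i j _ → cong₂ w (c i) (c j)) ⟩
  D (2 ℕ.+ n) (σ ∘ π ∘ swap₀₁) (λ i j → w (π (swap₀₁ i)) (π (swap₀₁ j)))
    ≡⟨ sym (D-swap n (σ ∘ π) λ i j → w (π i) (π j)) ⟩
  D (2 ℕ.+ n) (σ ∘ π) (λ i j → w (π i) (π j))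
    ≡⟨ D-lift inv (Perm.insert zero v Perm.id) σ w ⟩
  D (2 ℕ.+ n) σ w ∎
  where
  open ≡-Reasoning
  π = Perm.lift₀ (Perm.insert zero v Perm.id) ⟨$⟩ʳ_
  c : ∀ i → cycle (suc v) i ≡ π (swap₀₁ i)
  c zero = refl
  c (suc zero) = refl
  c (suc (suc i)) = refl

-- Any permutation is one that fixes 0 followed by the cycle that sends 0 to its image; the first
-- factor falls to the induction hypothesis.
D-perm : ∀ m n → PermInvariant m n
D-perm zero zero π σ w = refl
D-perm zero (suc n) π σ w = contradiction π (Perm.refute λ ())
D-perm (suc m) zero π σ w = contradiction π (Perm.refute λ ())
D-perm (suc m) (suc n) π σ w with Perm.↔⇒≡ π
... | refl = begin
  D (suc n) (σ ∘ (π ⟨$⟩ʳ_)) (λ i j → w (π ⟨$⟩ʳ i) (π ⟨$⟩ʳ j))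
    ≡⟨ D-cong (suc n) (λ i → cong σ (c i)) (λ i j _ → cong₂ w (c i) (c j)) ⟩
  D (suc n) (σ ∘ cycle v ∘ ρ) (λ i j → w (cycle v (ρ i)) (cycle v (ρ j)))
    ≡⟨ D-lift (D-perm n n) (Perm.remove zero π) (σ ∘ cycle v) (λ i j → w (cycle v i) (cycle v j)) ⟩
  D (suc n) (σ ∘ cycle v) (λ i j → w (cycle v i) (cycle v j))
    ≡⟨ D-cycle n (D-perm n n) v σ w ⟩
  D (suc n) σ w ∎
  where
  open ≡-Reasoning
  v = π ⟨$⟩ʳ zero
  ρ = Perm.lift₀ (Perm.remove zero π) ⟨$⟩ʳ_
  c : ∀ i → π ⟨$⟩ʳ i ≡ cycle v (ρ i)
  c zero = refl
  c (suc i) = Perm.punchIn-permute π zero i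

-- Congruences of integers with explicit quotients

infix 4 _≈_[_]

record _≈_[_] (a b m : ℤ) : Set where
  constructor modulo
  field
    quotient : ℤ
    equation : a ≡ b + m * quotient

≈-reflexive : ∀ {a b m} → a ≡ b → a ≈ b [ m ]
≈-reflexive {a} {b} {m} refl = modulo 0ℤ (e a m)
  where
  e : ∀ a m → a ≡ a + m * 0ℤ
  e = solve-∀

≈-sym : ∀ {a b m} → a ≈ b [ m ] → b ≈ a [ m ]
≈-sym {b = b} {m} (modulo q refl) = modulo (- q) (e b m q)
  where
  e : ∀ b m q → b ≡ b + m * q + m * - q
  e = solve-∀

≈-trans : ∀ {a b c m} → a ≈ b [ m ] → b ≈ c [ m ] → a ≈ c [ m ]
≈-trans {c = c} {m} (modulo q refl) (modulo r refl) = modulo (r + q) (e c m q r)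
  where
  e : ∀ c m q r → c + m * r + m * q ≡ c + m * (r + q)
  e = solve-∀

≈-+ : ∀ {a b c d m} → a ≈ b [ m ] → c ≈ d [ m ] → a + c ≈ b + d [ m ]
≈-+ {b = b} {d = d} {m} (modulo q refl) (modulo r refl) = modulo (q + r) (e b d m q r)
  where
  e : ∀ b d m q r → (b + m * q) + (d + m * r) ≡ b + d + m * (q + r)
  e = solve-∀

≈-* : ∀ {a b c d m} → a ≈ b [ m ] → c ≈ d [ m ] → a * c ≈ b * d [ m ]
≈-* {b = b} {d = d} {m} (modulo q refl) (modulo r refl) = modulo (b * r + q * d + m * q * r) (e b d m q r)
  where
  e : ∀ b d m q r → (b + m * q) * (d + m * r) ≡ b * d + m * (b * r + q * d + m * q * r)
  e = solve-∀

≈-neg : ∀ {a b m} → a ≈ b [ m ] → - a ≈ - b [ m ]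
≈-neg {b = b} {m} (modulo q refl) = modulo (- q) (e b m q)
  where
  e : ∀ b m q → - (b + m * q) ≡ - b + m * - q
  e = solve-∀

-- The modulus grows with the factor, so a summand that carries c needs to be known only to a lower
-- order. The truncated expansions below rest on this.
≈-scale : ∀ c {a b m} → a ≈ b [ m ] → c * a ≈ c * b [ c * m ]
≈-scale c {b = b} {m} (modulo q refl) = modulo q (e c b m q)
  where
  e : ∀ c b m q → c * (b + m * q) ≡ c * b + c * m * q
  e = solve-∀

≈-∑ : ∀ {n} {f g : Fin n → ℤ} {m} → (∀ i → f i ≈ g i [ m ]) → ∑ f ≈ ∑ g [ m ]
≈-∑ {zero}  h = ≈-reflexive refl
≈-∑ {suc n} h = ≈-+ (h zero) (≈-∑ (h ∘ suc))

-- Sign, positivity and vanishing of the determinant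

0≤+ : ∀ {a b} → 0ℤ ≤ a → 0ℤ ≤ b → 0ℤ ≤ a + b
0≤+ = ℤP.+-mono-≤

0≤* : ∀ {a b} → 0ℤ ≤ a → 0ℤ ≤ b → 0ℤ ≤ a * b
0≤* {+ a} {+ b} _ _ = subst (0ℤ ≤_) (ℤP.pos-* a b) (+≤+ z≤n)

1≤* : ∀ {a b} → 1ℤ ≤ a → 1ℤ ≤ b → 1ℤ ≤ a * b
1≤* {+ suc a} {+ suc b} _ _ = +≤+ (s≤s z≤n)
1≤* {+ zero} (+≤+ ())
1≤* {+ suc a} {+ zero} _ (+≤+ ())

0≤1 : 0ℤ ≤ 1ℤ
0≤1 = +≤+ z≤n

0≤⟦⟧ : ∀ b → 0ℤ ≤ ⟦ b ⟧
0≤⟦⟧ true  = +≤+ z≤n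
0≤⟦⟧ false = +≤+ z≤n

0≤∑ : ∀ {n} {f : Fin n → ℤ} → (∀ i → 0ℤ ≤ f i) → 0ℤ ≤ ∑ f
0≤∑ {zero}  h = ℤP.≤-refl
0≤∑ {suc n} h = 0≤+ (h zero) (0≤∑ (h ∘ suc))

≤-+ʳ : ∀ {a b} → 0ℤ ≤ b → a ≤ a + b
≤-+ʳ {a} {b} h = subst (_≤ a + b) (ℤP.+-identityʳ a) (ℤP.+-monoʳ-≤ a h)

≤-+ˡ : ∀ {a b} → 0ℤ ≤ b → a ≤ b + a
≤-+ˡ {a} {b} h = subst (_≤ b + a) (ℤP.+-identityˡ a) (ℤP.+-monoˡ-≤ a h)

term≤∑ : ∀ {n} {f : Fin n → ℤ} → (∀ i → 0ℤ ≤ f i) → ∀ i → f i ≤ ∑ f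
term≤∑ h zero    = ≤-+ʳ (0≤∑ (h ∘ suc))
term≤∑ {f = f} h (suc i) = ℤP.≤-trans (term≤∑ (h ∘ suc) i) (≤-+ˡ (h zero))

D-nonneg : ∀ n {σ w} → (∀ i → 0ℤ ≤ σ i) → (∀ i j → 0ℤ ≤ w i j) → 0ℤ ≤ D n σ w
D-nonneg zero    p q = 0≤1
D-nonneg (suc n) p q = 0≤+
  (0≤* (p zero) (D-nonneg n (λ i → 0≤+ (p (suc i)) (q (suc i) zero)) λ i j → q (suc i) (suc j)))
  (0≤∑ λ t → 0≤* (q zero (suc t)) (D-nonneg n (p ∘ suc) λ i j →
    0≤+ (q (suc i) (suc j)) (0≤* (0≤⟦⟧ (does (j ≟ t))) (q (suc i) zero))))

-- A certificate for a spanning tree: arcs to lower rank cannot cycle, so following them every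
-- vertex reaches one with a root arc.
Ranked : ∀ {n} → (Fin n → ℤ) → Weights n → (Fin n → ℕ) → Set
Ranked σ w h = ∀ i → 1ℤ ≤ σ i ⊎ ∃ λ j → h j ℕ.< h i × 1ℤ ≤ w i j

-- Contract vertex 0 along the arc promised by its rank. The other summands are nonnegative, and the
-- ranking restricts to the contracted graph.
D-positive : ∀ n {σ w h} → (∀ i → 0ℤ ≤ σ i) → (∀ i j → 0ℤ ≤ w i j) → Ranked σ w h → 1ℤ ≤ D n σ w
D-positive zero p q r = ℤP.≤-refl
D-positive (suc n) {σ} {w} {h} p q r with r zero
... | inj₁ 1≤σ = ℤP.≤-trans
  (1≤* 1≤σ (D-positive n {h = h ∘ suc} (λ i → 0≤+ (p (suc i)) (q (suc i) zero)) (λ i j → q (suc i) (suc j)) absorbed))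
  (≤-+ʳ (0≤∑ λ t → 0≤* (q zero (suc t)) (D-nonneg n (p ∘ suc) λ i j →
    0≤+ (q (suc i) (suc j)) (0≤* (0≤⟦⟧ (does (j ≟ t))) (q (suc i) zero)))))
  where
  absorbed : Ranked (absorb σ w) (rest w) (h ∘ suc)
  absorbed i with r (suc i)
  ... | inj₁ u                 = inj₁ (ℤP.≤-trans u (≤-+ʳ (q (suc i) zero)))
  ... | inj₂ (zero , _ , u)    = inj₁ (ℤP.≤-trans u (≤-+ˡ (p (suc i))))
  ... | inj₂ (suc j , lt , u)  = inj₂ (j , lt , u)
... | inj₂ (zero , lt , _) = contradiction lt (ℕP.<-irrefl refl)
... | inj₂ (suc t , lt , 1≤w) = ℤP.≤-trans
  (1≤* 1≤w (D-positive n {h = h ∘ suc} (p ∘ suc) (merge≥0 t) merged))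
  (ℤP.≤-trans (term≤∑ (λ u → 0≤* (q zero (suc u)) (D-nonneg n (p ∘ suc) (merge≥0 u))) t)
    (≤-+ˡ (0≤* (p zero) (D-nonneg n (λ i → 0≤+ (p (suc i)) (q (suc i) zero)) λ i j → q (suc i) (suc j)))))
  where
  merge≥0 : ∀ u i j → 0ℤ ≤ merge w u i j
  merge≥0 u i j = 0≤+ (q (suc i) (suc j)) (0≤* (0≤⟦⟧ (does (j ≟ u))) (q (suc i) zero))
  merged : Ranked (σ ∘ suc) (merge w t) (h ∘ suc)
  merged i with r (suc i)
  ... | inj₁ u                 = inj₁ u
  -- The arc to 0 now ends at t, whose rank is below that of 0 and hence below that of i.
  ... | inj₂ (zero , lt′ , u)  = inj₂ (t , ℕP.<-trans lt lt′ ,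
    ℤP.≤-trans (subst (λ z → 1ℤ ≤ z * w (suc i) zero) (sym (δ-refl t)) (subst (1ℤ ≤_) (sym (ℤP.*-identityˡ (w (suc i) zero))) u))
               (≤-+ˡ (q (suc i) (suc t))))
  ... | inj₂ (suc j , lt′ , u) = inj₂ (j , lt′ , ℤP.≤-trans u (≤-+ʳ (0≤* (0≤⟦⟧ (does (j ≟ t))) (q (suc i) zero))))

-- No vertex of S can reach the root. If 0 lies in S, it can be contracted only into another vertex
-- of S; otherwise i₀ stays behind and the contraction opens no exit from S.
D-closed : ∀ n {σ w} (S : Fin n → Bool) {i₀} → S i₀ ≡ true → (∀ i → S i ≡ true → σ i ≡ 0ℤ) →
           (∀ i j → S i ≡ true → S j ≡ false → w i j ≡ 0ℤ) → D n σ w ≡ 0ℤ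
D-closed (suc n) {σ} {w} S {i₀} in₀ p q with S zero in eq
... | true = cong₂ _+_ (cong (_* D n (absorb σ w) (rest w)) (p zero eq)) (∑-zero term)
  where
  term : ∀ t → w zero (suc t) * D n (σ ∘ suc) (merge w t) ≡ 0ℤ
  term t with S (suc t) in eq′
  ... | false = cong (_* D n (σ ∘ suc) (merge w t)) (q zero (suc t) eq eq′)
  ... | true  = trans (cong (w zero (suc t) *_) (D-closed n (S ∘ suc) {t} eq′ (λ i → p (suc i)) λ i j i∈ j∉ →
      cong₂ _+_ (q (suc i) (suc j) i∈ j∉)
        (cong (_* w (suc i) zero) (δ-≢ {i = j} {t} λ { refl → case trans (sym j∉) eq′ of λ () }))))
    (ℤP.*-zeroʳ (w zero (suc t)))
... | false = cong₂ _+_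
  (trans (cong (σ zero *_) (D-closed n (S ∘ suc) {proj₁ below} (proj₂ below)
     (λ i i∈ → cong₂ _+_ (p (suc i) i∈) (q (suc i) zero i∈ eq)) λ i j → q (suc i) (suc j))) (ℤP.*-zeroʳ (σ zero)))
  (∑-zero λ t → trans (cong (w zero (suc t) *_) (D-closed n (S ∘ suc) {proj₁ below} (proj₂ below) (λ i → p (suc i)) λ i j i∈ j∉ →
     cong₂ _+_ (q (suc i) (suc j) i∈ j∉) (trans (cong (δ j t *_) (q (suc i) zero i∈ eq)) (ℤP.*-zeroʳ (δ j t)))))
     (ℤP.*-zeroʳ (w zero (suc t))))
  where
  find : ∀ i → S i ≡ true → ∃ λ i → S (suc i) ≡ true
  find zero    h = case trans (sym eq) h of λ ()
  find (suc i) h = i , h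
  below = find i₀ in₀

D-rootless : ∀ n (w : Weights (suc n)) → D (suc n) (λ _ → 0ℤ) w ≡ 0ℤ
D-rootless n w = D-closed (suc n) {w = w} (λ _ → true) {zero} refl (λ _ _ → refl) λ _ _ _ ()

D-mod : ∀ n {m σ σ′} (w : Weights n) → (∀ i → σ i ≈ σ′ i [ m ]) → D n σ w ≈ D n σ′ w [ m ]
D-mod zero    w h = ≈-reflexive refl
D-mod (suc n) w h = ≈-+ (≈-* (h zero) (D-mod n (rest w) λ i → ≈-+ (h (suc i)) (≈-reflexive {w (suc i) zero} refl)))
  (≈-∑ λ t → ≈-* (≈-reflexive {w zero (suc t)} refl) (D-mod n (merge w t) (h ∘ suc)))

-- Each root arc costs a factor y, so modulo y² only configurations with a single root arc remain:
-- spanning trees, rooted where that arc starts.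
D-constant : ∀ n y (w : Weights (suc n)) →
  D (suc n) (λ _ → y) w ≈ y * ∑ (λ r → D (suc n) (δ r) w) [ y * y ]
D-constant zero y w = ≈-reflexive (e y)
  where
  e : ∀ y → y * 1ℤ + 0ℤ ≡ y * (1ℤ + 0ℤ)
  e = solve-∀
D-constant (suc n) y w = ≈-trans
  (≈-+ {m = y * y} (≈-scale y (D-mod (suc n) (rest w) small))
       (≈-∑ λ t → ≈-* (≈-reflexive {w zero (suc t)} refl) (D-constant n y (merge w t))))
  (≈-reflexive (trans (cong (_+_ (y * R)) (trans (∑-cong λ t → e₁ (w zero (suc t)) y (∑ (λ r → T r t))) (∑-* y (λ t → w zero (suc t) * ∑ (λ r → T r t)))))
    (trans (sym (ℤP.*-distribˡ-+ y R _)) (cong (y *_) (cong₂ _+_ first others)))))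
  where
  R = D (suc n) (λ i → w (suc i) zero) (rest w)
  T : Fin (suc n) → Fin (suc n) → ℤ
  T r t = D (suc n) (δ r) (merge w t)
  e₁ : ∀ a y b → a * (y * b) ≡ y * (a * b)
  e₁ = solve-∀
  e₂ : ∀ y a → y + a ≡ a + y * 1ℤ
  e₂ = solve-∀
  small : ∀ i → absorb (λ _ → y) w i ≈ w (suc i) zero [ y ]
  small i = modulo 1ℤ (e₂ y (w (suc i) zero))
  first : R ≡ D (2 ℕ.+ n) (δ zero) w
  first = sym (trans (cong₂ _+_
    (trans (ℤP.*-identityˡ (D (suc n) (absorb (δ zero) w) (rest w))) (D-cong (suc n) {w = rest w} {w′ = rest w} (λ i → ℤP.+-identityˡ (w (suc i) zero)) λ _ _ _ → refl))
    (∑-zero λ t → trans (cong (w zero (suc t) *_) (D-rootless n (merge w t))) (ℤP.*-zeroʳ (w zero (suc t)))))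
    (ℤP.+-identityʳ R))
  others : ∑ (λ t → w zero (suc t) * ∑ (λ r → T r t)) ≡ ∑ (λ r → D (2 ℕ.+ n) (δ (suc r)) w)
  others = trans (∑-cong λ t → sym (∑-* (w zero (suc t)) (λ r → T r t)))
    (trans (∑-comm (λ t r → w zero (suc t) * T r t))
           (∑-cong λ r → sym (ℤP.+-identityˡ (∑ (λ t → w zero (suc t) * T r t)))))

sgn : ℕ → ℤ
sgn zero    = 1ℤ
sgn (suc k) = - sgn k

detℤ : ∀ n → Weights n → ℤ
detℤ zero    M = 1ℤ
detℤ (suc n) M = ∑ λ j → sgn (toℕ j) * (M zero j * detℤ n (λ i k → M (suc i) (punchIn j k)))

detℤ-cong : ∀ n {M N : Weights n} → (∀ i j → M i j ≡ N i j) → detℤ n M ≡ detℤ n N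
detℤ-cong zero    h = refl
detℤ-cong (suc n) h = ∑-cong λ j → cong (sgn (toℕ j) *_)
  (cong₂ _*_ (h zero j) (detℤ-cong n λ i k → h (suc i) (punchIn j k)))

-- From the characteristic polynomial to D

insertCol : ∀ {n} → (Fin (suc n) → Fin n → ℤ) → Fin (suc n) → (Fin (suc n) → ℤ) → Weights (suc n)
insertCol Y t c i = insertAt (Y i) t (c i)

-- Striking out another column moves the inserted one from t to `pinch k t`; `sgn-punch` accounts
-- for the sign of this shift.
insertAt-minor : ∀ {n} (Y : Fin (suc n) → ℤ) t k c q →
  insertAt Y t c (punchIn (punchIn t k) q) ≡ insertAt (Y ∘ punchIn k) (pinch k t) c q
insertAt-minor Y zero k c zero = refl
insertAt-minor Y zero k c (suc q) = refl
insertAt-minor Y (suc t) zero c q = refl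
insertAt-minor {suc n} Y (suc t) (suc k) c zero = refl
insertAt-minor {suc n} Y (suc t) (suc k) c (suc q) = insertAt-minor (Y ∘ suc) t k c q

sgn-punch : ∀ {n} (t : Fin (suc n)) (k : Fin n) →
  sgn (toℕ (punchIn t k)) * sgn (toℕ (pinch k t)) ≡ sgn (toℕ t) * - sgn (toℕ k)
sgn-punch zero    zero    = refl
sgn-punch zero    (suc k) = e (sgn (toℕ k))
  where
  e : ∀ x → - (- x) * 1ℤ ≡ 1ℤ * - (- x)
  e = solve-∀
sgn-punch (suc t) zero    = e (sgn (toℕ t))
  where
  e : ∀ x → 1ℤ * x ≡ - x * - 1ℤ
  e = solve-∀
sgn-punch {suc n} (suc t) (suc k) =
  trans (e₁ (sgn (toℕ (punchIn t k))) (sgn (toℕ (pinch k t)))) (trans (sgn-punch t k) (e₂ (sgn (toℕ t)) (sgn (toℕ k))))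
  where
  e₁ : ∀ x y → - x * - y ≡ x * y
  e₁ = solve-∀
  e₂ : ∀ x y → x * - y ≡ - x * - - y
  e₂ = solve-∀

-- Moving a column to the front costs one sign for each column passed. It is proved together with
-- the expansion along the first row, because the minors of that expansion carry their inserted
-- column in a shifted place.
det-insert : ∀ n Y t c → detℤ (suc n) (insertCol Y t c) ≡ sgn (toℕ t) * detℤ (suc n) (insertCol Y zero c)
det-insert-expand : ∀ n Y t c → detℤ (2 ℕ.+ n) (insertCol Y t c) ≡
  sgn (toℕ t) * (c zero * detℤ (suc n) (Y ∘ suc) +
    ∑ λ k → - sgn (toℕ k) * (Y zero k * detℤ (suc n) (insertCol (λ i → Y (suc i) ∘ punchIn k) zero (c ∘ suc))))

det-insert zero    Y zero c = sym (ℤP.*-identityˡ (detℤ 1 (insertCol Y zero c)))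
det-insert (suc n) Y t c = trans (det-insert-expand n Y t c)
  (cong (sgn (toℕ t) *_) (sym (trans (det-insert-expand n Y zero c) (ℤP.*-identityˡ (c zero * detℤ (suc n) (Y ∘ suc) +
    ∑ λ k → - sgn (toℕ k) * (Y zero k * detℤ (suc n) (insertCol (λ i → Y (suc i) ∘ punchIn k) zero (c ∘ suc))))))))

det-insert-expand n Y t c = begin
  detℤ (2 ℕ.+ n) M
    ≡⟨ sum-remove {i = t} (λ j → sgn (toℕ j) * (M zero j * minor j)) ⟩
  sgn (toℕ t) * (M zero t * minor t) + ∑ (λ k → sgn (toℕ (punchIn t k)) * (M zero (punchIn t k) * minor (punchIn t k)))
    ≡⟨ cong₂ _+_ (cong (sgn (toℕ t) *_) (cong₂ _*_ (insertAt-lookup (Y zero) t (c zero))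
                   (detℤ-cong (suc n) λ i k → insertAt-punchIn (Y (suc i)) t (c (suc i)) k)))
                 (∑-cong term) ⟩
  sgn (toℕ t) * (c zero * detℤ (suc n) (Y ∘ suc)) + ∑ (λ k → sgn (toℕ t) * (- sgn (toℕ k) * (Y zero k * N k)))
    ≡⟨ cong (_+_ (sgn (toℕ t) * (c zero * detℤ (suc n) (Y ∘ suc)))) (∑-* (sgn (toℕ t)) (λ k → - sgn (toℕ k) * (Y zero k * N k))) ⟩
  sgn (toℕ t) * (c zero * detℤ (suc n) (Y ∘ suc)) + sgn (toℕ t) * ∑ (λ k → - sgn (toℕ k) * (Y zero k * N k))
    ≡⟨ sym (ℤP.*-distribˡ-+ (sgn (toℕ t)) _ _) ⟩
  sgn (toℕ t) * (c zero * detℤ (suc n) (Y ∘ suc) + ∑ (λ k → - sgn (toℕ k) * (Y zero k * N k))) ∎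
  where
  open ≡-Reasoning
  M = insertCol Y t c
  minor : Fin (2 ℕ.+ n) → ℤ
  minor j = detℤ (suc n) (λ i k → M (suc i) (punchIn j k))
  N : Fin (suc n) → ℤ
  N k = detℤ (suc n) (insertCol (λ i → Y (suc i) ∘ punchIn k) zero (c ∘ suc))
  e₁ : ∀ s y p m → s * (y * (p * m)) ≡ s * p * (y * m)
  e₁ = solve-∀
  e₂ : ∀ s k x → s * - k * x ≡ s * (- k * x)
  e₂ = solve-∀
  term : ∀ k → sgn (toℕ (punchIn t k)) * (M zero (punchIn t k) * minor (punchIn t k)) ≡ sgn (toℕ t) * (- sgn (toℕ k) * (Y zero k * N k))
  term k = trans (cong (sgn (toℕ (punchIn t k)) *_) (cong₂ _*_ (insertAt-punchIn (Y zero) t (c zero) k)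
      (trans (detℤ-cong (suc n) λ i q → insertAt-minor (Y (suc i)) t k (c (suc i)) q)
             (det-insert n (λ i → Y (suc i) ∘ punchIn k) (pinch k t) (c ∘ suc)))))
    (trans (e₁ (sgn (toℕ (punchIn t k))) (Y zero k) (sgn (toℕ (pinch k t))) (N k))
    (trans (cong (_* (Y zero k * N k)) (sgn-punch t k)) (e₂ (sgn (toℕ t)) (sgn (toℕ k)) (Y zero k * N k))))

det-insert₀-+ : ∀ n Y c d → detℤ (suc n) (insertCol Y zero (λ i → c i + d i)) ≡
  detℤ (suc n) (insertCol Y zero c) + detℤ (suc n) (insertCol Y zero d)
det-insert₀-+ zero Y c d = e (c zero) (d zero)
  where
  e : ∀ x y → 1ℤ * ((x + y) * 1ℤ) + 0ℤ ≡ (1ℤ * (x * 1ℤ) + 0ℤ) + (1ℤ * (y * 1ℤ) + 0ℤ)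
  e = solve-∀
det-insert₀-+ (suc n) Y c d = trans (det-insert-expand n Y zero (λ i → c i + d i))
  (trans (cong (λ z → 1ℤ * ((c zero + d zero) * detℤ (suc n) (Y ∘ suc) + z)) (trans (∑-cong λ k →
      trans (cong (λ z → - sgn (toℕ k) * (Y zero k * z)) (det-insert₀-+ n (λ i → Y (suc i) ∘ punchIn k) (c ∘ suc) (d ∘ suc)))
            (e₁ (sgn (toℕ k)) (Y zero k) (N c k) (N d k)))
      (∑-distrib-+ (λ k → - sgn (toℕ k) * (Y zero k * N c k)) (λ k → - sgn (toℕ k) * (Y zero k * N d k)))))
  (trans (e₂ (c zero) (d zero) (detℤ (suc n) (Y ∘ suc)) _ _)
         (sym (cong₂ _+_ (det-insert-expand n Y zero c) (det-insert-expand n Y zero d)))))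
  where
  N : (Fin (2 ℕ.+ n) → ℤ) → Fin (suc n) → ℤ
  N c k = detℤ (suc n) (insertCol (λ i → Y (suc i) ∘ punchIn k) zero (c ∘ suc))
  e₁ : ∀ s y a b → - s * (y * (a + b)) ≡ - s * (y * a) + - s * (y * b)
  e₁ = solve-∀
  e₂ : ∀ a b m P Q → 1ℤ * ((a + b) * m + (P + Q)) ≡ 1ℤ * (a * m + P) + 1ℤ * (b * m + Q)
  e₂ = solve-∀

det-insert-+ : ∀ n Y t c d → detℤ (suc n) (insertCol Y t (λ i → c i + d i)) ≡
  detℤ (suc n) (insertCol Y t c) + detℤ (suc n) (insertCol Y t d)
det-insert-+ n Y t c d = trans (det-insert n Y t (λ i → c i + d i))
  (trans (cong (sgn (toℕ t) *_) (det-insert₀-+ n Y c d))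
  (trans (ℤP.*-distribˡ-+ (sgn (toℕ t)) _ _) (sym (cong₂ _+_ (det-insert n Y t c) (det-insert n Y t d)))))

δ-punchIn : ∀ {n} (t : Fin (suc n)) k → δ (punchIn t k) t ≡ 0ℤ
δ-punchIn zero    k       = refl
δ-punchIn (suc t) zero    = refl
δ-punchIn (suc t) (suc k) = δ-punchIn t k

DetIsD : ℕ → Set
DetIsD n = (M : Weights n) → detℤ n M ≡ D n (λ i → ∑ (M i)) (λ i j → - M i j)

-- Merging 0 into t adds the first column to column t of `M′`, and linearity in that column gives d
-- plus the minor that belongs to the entry `row t`. The copies of d, weighted by - `row t`, cancel
-- the off-diagonal part of the row sum in front.
detℤ≡D-step : ∀ n → DetIsD (suc n) → DetIsD (2 ℕ.+ n)
detℤ≡D-step n ih M = sym (begin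
  (M zero zero + ∑ row) * D (suc n) (absorb (λ i → ∑ (M i)) (λ i j → - M i j)) (rest (λ i j → - M i j))
    + ∑ (λ t → - row t * D (suc n) (λ i → ∑ (M (suc i))) (merge (λ i j → - M i j) t))
    ≡⟨ cong₂ _+_ (cong ((M zero zero + ∑ row) *_) absorbed) (∑-cong λ t → cong (- row t *_) (merged t)) ⟩
  (M zero zero + ∑ row) * d + ∑ (λ t → - row t * (d + s t * m t))
    ≡⟨ cong (_+_ ((M zero zero + ∑ row) * d)) (trans (∑-cong λ t → e₁ (row t) d (s t) (m t)) (∑-lin (- d) 1ℤ row (λ t → - s t * (row t * m t)))) ⟩
  (M zero zero + ∑ row) * d + (- d * ∑ row + 1ℤ * ∑ (λ t → - s t * (row t * m t)))
    ≡⟨ e₂ (M zero zero) (∑ row) d _ ⟩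
  detℤ (2 ℕ.+ n) M ∎)
  where
  open ≡-Reasoning
  row : Fin (suc n) → ℤ
  row t = M zero (suc t)
  M′ : Weights (suc n)
  M′ i j = M (suc i) (suc j)
  d = detℤ (suc n) M′
  s m : Fin (suc n) → ℤ
  s t = sgn (toℕ t)
  m t = detℤ (suc n) (λ i k → M (suc i) (punchIn (suc t) k))
  e₁ : ∀ r d s m → - r * (d + s * m) ≡ - d * r + 1ℤ * (- s * (r * m))
  e₁ = solve-∀
  e₂ : ∀ x r d z → (x + r) * d + (- d * r + 1ℤ * z) ≡ 1ℤ * (x * d) + z
  e₂ = solve-∀
  e₃ : ∀ x s → (x + s) + - x ≡ s
  e₃ = solve-∀
  e₄ : ∀ x y δ → - (x + δ * y) ≡ - x + δ * - y
  e₄ = solve-∀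
  absorbed : D (suc n) (absorb (λ i → ∑ (M i)) (λ i j → - M i j)) (rest (λ i j → - M i j)) ≡ d
  absorbed = trans (D-cong (suc n) {w = λ i j → - M′ i j} {w′ = λ i j → - M′ i j} (λ i → e₃ (M (suc i) zero) (∑ (M′ i))) λ _ _ _ → refl) (sym (ih M′))
  X : Fin (suc n) → Weights (suc n)
  X t i j = M′ i j + δ j t * M (suc i) zero
  Y : Fin (suc n) → Fin (suc n) → Fin n → ℤ
  Y t i k = M′ i (punchIn t k)
  asInsert : ∀ t i j → X t i j ≡ insertCol (Y t) t (λ i → M′ i t + M (suc i) zero) i j
  asInsert t i j = trans (sym (insertAt-removeAt (X t i) t j)) (insertAt-cong t
    (λ k → trans (cong (λ z → M′ i (punchIn t k) + z * M (suc i) zero) (δ-punchIn t k)) (ℤP.+-identityʳ (M′ i (punchIn t k))))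
    (cong (_+_ (M′ i t)) (trans (cong (_* M (suc i) zero) (δ-refl t)) (ℤP.*-identityˡ (M (suc i) zero)))) j)
    where
    insertAt-cong : ∀ {n} {xs ys : Fin n → ℤ} t {x y} → (∀ k → xs k ≡ ys k) → x ≡ y → ∀ j → insertAt xs t x j ≡ insertAt ys t y j
    insertAt-cong {n} zero h e zero = e
    insertAt-cong {n} zero h e (suc j) = h j
    insertAt-cong {suc n} (suc t) h e zero = h zero
    insertAt-cong {suc n} (suc t) h e (suc j) = insertAt-cong t (h ∘ suc) e j
  firstCol : ∀ t i k → insertCol (Y t) zero (λ i → M (suc i) zero) i k ≡ M (suc i) (punchIn (suc t) k)
  firstCol t i zero = refl
  firstCol t i (suc k) = refl
  detX : ∀ t → detℤ (suc n) (X t) ≡ d + s t * m t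
  detX t = trans (detℤ-cong (suc n) (asInsert t)) (trans (det-insert-+ n (Y t) t (λ i → M′ i t) (λ i → M (suc i) zero))
    (cong₂ _+_ (detℤ-cong (suc n) λ i j → insertAt-removeAt (M′ i) t j)
               (trans (det-insert n (Y t) t (λ i → M (suc i) zero)) (cong (s t *_) (detℤ-cong (suc n) (firstCol t))))))
  rowX : ∀ t i → ∑ (M (suc i)) ≡ ∑ (X t i)
  rowX t i = trans (ℤP.+-comm (M (suc i) zero) (∑ (M′ i))) (sym (trans (∑-distrib-+ (M′ i) (λ j → δ j t * M (suc i) zero))
    (cong (_+_ (∑ (M′ i))) (∑-δ′ t (λ _ → M (suc i) zero)))))
  merged : ∀ t → D (suc n) (λ i → ∑ (M (suc i))) (merge (λ i j → - M i j) t) ≡ d + s t * m t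
  merged t = trans (D-cong (suc n) {w = merge (λ i j → - M i j) t} {w′ = λ i j → - X t i j} (rowX t) λ i j _ → sym (e₄ (M′ i j) (M (suc i) zero) (δ j t)))
    (trans (sym (ih (X t))) (detX t))

detℤ≡D : ∀ n → DetIsD n
detℤ≡D zero M = refl
detℤ≡D (suc zero) M = e (M zero zero)
  where
  e : ∀ x → 1ℤ * (x * 1ℤ) + 0ℤ ≡ (x + 0ℤ) * 1ℤ + 0ℤ
  e = solve-∀
detℤ≡D (suc (suc n)) = detℤ≡D-step n (detℤ≡D (suc n))

module _ (a b : ℤ) where

  -- Σ fₖ aᵏ bᵈ⁻ᵏ
  evalH : ℕ → (ℕ → ℤ) → ℤ
  evalH zero    f = f 0
  evalH (suc d) f = f 0 * b ^ suc d + a * evalH d (f ∘ suc)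

  evalH-cong : ∀ d {f g} → (∀ k → f k ≡ g k) → evalH d f ≡ evalH d g
  evalH-cong zero    h = h 0
  evalH-cong (suc d) h = cong₂ _+_ (cong (_* b ^ suc d) (h 0)) (cong (a *_) (evalH-cong d (h ∘ suc)))

  evalH-lin : ∀ d x y f g → evalH d (λ k → x * f k + y * g k) ≡ x * evalH d f + y * evalH d g
  evalH-lin zero    x y f g = refl
  evalH-lin (suc d) x y f g = trans (cong (λ z → (x * f 0 + y * g 0) * b ^ suc d + a * z) (evalH-lin d x y (f ∘ suc) (g ∘ suc)))
    (e x y (f 0) (g 0) (b ^ suc d) a (evalH d (f ∘ suc)) (evalH d (g ∘ suc)))
    where
    e : ∀ x y f g p a F G → (x * f + y * g) * p + a * (x * F + y * G) ≡ x * (f * p + a * F) + y * (g * p + a * G)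
    e = solve-∀

  evalH-∑ : ∀ d {n} (f : Fin n → ℕ → ℤ) → evalH d (λ k → ∑ λ j → f j k) ≡ ∑ λ j → evalH d (f j)
  evalH-∑ d {zero} f = trans (evalH-lin d 0ℤ 0ℤ (λ _ → 0ℤ) (λ _ → 0ℤ)) refl
  evalH-∑ d {suc n} f = trans (evalH-cong d λ k → e (f zero k) (∑ (λ j → f (suc j) k)))
    (trans (evalH-lin d 1ℤ 1ℤ (f zero) (λ k → ∑ (λ j → f (suc j) k)))
    (trans (sym (e (evalH d (f zero)) (evalH d (λ k → ∑ (λ j → f (suc j) k))))) (cong (_+_ (evalH d (f zero))) (evalH-∑ d (f ∘ suc)))))
    where
    e : ∀ x y → x + y ≡ 1ℤ * x + 1ℤ * y
    e = solve-∀

  -- The degree is part of the data of a homogenisation: a polynomial read with a degree one too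
  -- high acquires a factor b.
  evalH-raise : ∀ d f → (∀ k → d ℕ.< k → f k ≡ 0ℤ) → evalH (suc d) f ≡ b * evalH d f
  evalH-raise zero f h = trans (cong (λ z → f 0 * (b * 1ℤ) + a * z) (h 1 (s≤s z≤n))) (e (f 0) b a)
    where
    e : ∀ x b a → x * (b * 1ℤ) + a * 0ℤ ≡ b * x
    e = solve-∀
  evalH-raise (suc d) f h = trans (cong (λ z → f 0 * (b * (b ^ suc d)) + a * z) (evalH-raise d (f ∘ suc) (λ k lt → h (suc k) (s≤s lt))))
    (e (f 0) b (b ^ suc d) a (evalH d (f ∘ suc)))
    where
    e : ∀ x b p a z → x * (b * p) + a * (b * z) ≡ b * (x * p + a * z)
    e = solve-∀

  evalH-linear-* : ∀ d {f g} u v → f 0 ≡ u * g 0 → (∀ k → f (suc k) ≡ u * g (suc k) + v * g k) →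
                  (∀ k → d ℕ.< k → g k ≡ 0ℤ) → evalH (suc d) f ≡ (u * b + v * a) * evalH d g
  evalH-linear-* d {f} {g} u v f₀ fₛ h = trans (cong₂ (λ x y → x * b ^ suc d + a * y) f₀
      (trans (evalH-cong d fₛ) (evalH-lin d u v (g ∘ suc) g)))
    (trans (e₁ u v (g 0) (b ^ suc d) a (evalH d (g ∘ suc)) (evalH d g))
    (trans (cong (λ z → u * z + v * a * evalH d g) (evalH-raise d g h)) (e₂ u v a b (evalH d g))))
    where
    e₁ : ∀ u v x p a y z → u * x * p + a * (u * y + v * z) ≡ u * (x * p + a * y) + v * a * z
    e₁ = solve-∀
    e₂ : ∀ u v a b z → u * (b * z) + v * a * z ≡ (u * b + v * a) * z
    e₂ = solve-∀

evalH-top : ∀ d f → evalH 1ℤ 0ℤ d f ≡ f d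
evalH-top zero    f = refl
evalH-top (suc d) f = trans (cong₂ _+_ (ℤP.*-zeroʳ (f 0)) (trans (ℤP.*-identityˡ (evalH 1ℤ 0ℤ d (f ∘ suc))) (evalH-top d (f ∘ suc)))) (ℤP.+-identityˡ (f (suc d)))

coeff-addP : ∀ p q k → coeff (addP p q) k ≡ coeff p k + coeff q k
coeff-addP [] q k = sym (ℤP.+-identityˡ (coeff q k))
coeff-addP (a ∷ p) [] k = sym (ℤP.+-identityʳ (coeff (a ∷ p) k))
coeff-addP (a ∷ p) (b ∷ q) zero = refl
coeff-addP (a ∷ p) (b ∷ q) (suc k) = coeff-addP p q k

coeff-scaleP : ∀ c p k → coeff (scaleP c p) k ≡ c * coeff p k
coeff-scaleP c [] k = sym (ℤP.*-zeroʳ c)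
coeff-scaleP c (a ∷ p) zero = refl
coeff-scaleP c (a ∷ p) (suc k) = coeff-scaleP c p k

coeff-signP : ∀ s p k → coeff (signP s p) k ≡ sgn s * coeff p k
coeff-signP zero p k = sym (ℤP.*-identityˡ (coeff p k))
coeff-signP (suc s) p k = trans (coeff-scaleP (- 1ℤ) (signP s p) k) (trans (cong (- 1ℤ *_) (coeff-signP s p k)) (e (sgn s) (coeff p k)))
  where
  e : ∀ s x → - 1ℤ * (s * x) ≡ - s * x
  e = solve-∀

coeff-foldr : ∀ n (f : Fin n → Poly) k → coeff (foldr addP [] (tabulate f)) k ≡ ∑ λ j → coeff (f j) k
coeff-foldr zero f k = refl
coeff-foldr (suc n) f k = trans (coeff-addP (f zero) _ k) (cong (_+_ (coeff (f zero) k)) (coeff-foldr n (f ∘ suc) k))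

-- That p is u + vX is phrased through the coefficients of its products, because lists with trailing
-- zeros represent the same polynomial.
record Linear (p : Poly) (u v : ℤ) : Set where
  constructor linear
  field
    const-* : ∀ q → coeff (mulP p q) 0 ≡ u * coeff q 0
    step-*  : ∀ q k → coeff (mulP p q) (suc k) ≡ u * coeff q (suc k) + v * coeff q k

linear₁ : ∀ u → Linear (u ∷ []) u 0ℤ
linear₁ u = linear (λ q → trans (coeff-addP (scaleP u q) (0ℤ ∷ []) 0) (trans (ℤP.+-identityʳ (coeff (scaleP u q) 0)) (coeff-scaleP u q 0)))
  λ q k → trans (coeff-addP (scaleP u q) (0ℤ ∷ []) (suc k)) (cong (_+ 0ℤ) (coeff-scaleP u q (suc k)))

linear₂ : ∀ u v → Linear (u ∷ v ∷ []) u v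
linear₂ u v = linear (λ q → trans (coeff-addP (scaleP u q) (0ℤ ∷ mulP (v ∷ []) q) 0) (trans (ℤP.+-identityʳ (coeff (scaleP u q) 0)) (coeff-scaleP u q 0)))
  λ q k → trans (coeff-addP (scaleP u q) (0ℤ ∷ mulP (v ∷ []) q) (suc k)) (cong₂ _+_ (coeff-scaleP u q (suc k)) (at q k))
  where
  at : ∀ q k → coeff (mulP (v ∷ []) q) k ≡ v * coeff q k
  at q zero    = Linear.const-* (linear₁ v) q
  at q (suc k) = trans (Linear.step-* (linear₁ v) q k) (ℤP.+-identityʳ (v * coeff q (suc k)))

minorP : ∀ {n} → (Fin (suc n) → Fin (suc n) → Poly) → Fin (suc n) → Fin n → Fin n → Poly
minorP M j i k = M (suc i) (punchIn j k)

coeff-det : ∀ n (M : Fin (suc n) → Fin (suc n) → Poly) k →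
  coeff (det (suc n) M) k ≡ ∑ λ j → sgn (toℕ j) * coeff (mulP (M zero j) (det n (minorP M j))) k
coeff-det n M k = trans (coeff-foldr (suc n) (λ j → signP (toℕ j) (mulP (M zero j) (det n (minorP M j)))) k)
  (∑-cong λ j → coeff-signP (toℕ j) (mulP (M zero j) (det n (minorP M j))) k)

det-degree : ∀ n {M : Fin n → Fin n → Poly} {u v : Weights n} → (∀ i j → Linear (M i j) (u i j) (v i j)) →
             ∀ k → n ℕ.< k → coeff (det n M) k ≡ 0ℤ
det-degree zero lin (suc k) lt = refl
det-degree (suc n) {M} {u} {v} lin (suc k) (s≤s lt) = trans (coeff-det n M (suc k)) (∑-zero λ j →
  trans (cong (sgn (toℕ j) *_) (trans (Linear.step-* (lin zero j) (det n (minorP M j)) k)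
    (trans (cong₂ (λ x y → u zero j * x + v zero j * y) (below j (suc k) (ℕP.m≤n⇒m≤1+n lt)) (below j k lt))
           (e (u zero j) (v zero j)))))
    (ℤP.*-zeroʳ (sgn (toℕ j))))
  where
  below : ∀ j k → n ℕ.< k → coeff (det n (minorP M j)) k ≡ 0ℤ
  below j = det-degree n λ i k → lin (suc i) (punchIn j k)
  e : ∀ u v → u * 0ℤ + v * 0ℤ ≡ 0ℤ
  e = solve-∀

-- Every entry has degree at most 1, so a minor has degree at most its size, and homogenisation
-- commutes with the cofactor expansion.
evalH-det : ∀ a b n {M : Fin n → Fin n → Poly} {u v : Weights n} → (∀ i j → Linear (M i j) (u i j) (v i j)) →
            evalH a b n (coeff (det n M)) ≡ detℤ n λ i j → u i j * b + v i j * a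
evalH-det a b zero lin = refl
evalH-det a b (suc n) {M} {u} {v} lin = trans (evalH-cong a b (suc n) (coeff-det n M))
  (trans (evalH-∑ a b (suc n) (λ j k → sgn (toℕ j) * coeff (mulP (M zero j) (det n (minorP M j))) k)) (∑-cong λ j →
    trans (evalH-cong a b (suc n) (λ k → e (sgn (toℕ j)) (coeff (mulP (M zero j) (det n (minorP M j))) k)))
    (trans (evalH-lin a b (suc n) (sgn (toℕ j)) 0ℤ (coeff (mulP (M zero j) (det n (minorP M j)))) (λ _ → 0ℤ))
    (trans (sym (e (sgn (toℕ j)) (evalH a b (suc n) (coeff (mulP (M zero j) (det n (minorP M j))))))) (cong (sgn (toℕ j) *_)
      (trans (evalH-linear-* a b n {coeff (mulP (M zero j) (det n (minorP M j)))} {coeff (det n (minorP M j))} (u zero j) (v zero j)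
               (Linear.const-* (lin zero j) (det n (minorP M j))) (Linear.step-* (lin zero j) (det n (minorP M j)))
               (det-degree n λ i k → lin (suc i) (punchIn j k)))
             (cong ((u zero j * b + v zero j * a) *_) (evalH-det a b n λ i k → lin (suc i) (punchIn j k)))))))))
  where
  e : ∀ s x → s * x ≡ s * x + 0ℤ
  e = solve-∀

arc : ∀ {n} → Graph n → Fin n → Fin n → ℤ
arc G i j = ⟦ adj G i j ⟧

deg : ∀ {n} → Graph n → Fin n → ℤ
deg G i = ∑ (arc G i)

degree≡deg : ∀ {n} (G : Graph n) i → + degree G i ≡ deg G i
degree≡deg G i = go (adj G i)
  where
  go : ∀ {n} (f : Fin n → Bool) → + ListAction.sum (tabulate λ j → if f j then 1 else 0) ≡ ∑ λ j → ⟦ f j ⟧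
  go {zero} f = refl
  go {suc n} f with f zero
  ... | true  = cong (_+_ 1ℤ) (go (f ∘ suc))
  ... | false = trans (sym (ℤP.+-identityˡ _)) (cong (_+_ 0ℤ) (go (f ∘ suc)))

arc-irrefl : ∀ {n} (G : Graph n) i → arc G i i ≡ 0ℤ
arc-irrefl G i = cong ⟦_⟧ (irrefl G i)

laplacian-entry : ∀ {n} (G : Graph n) i j → laplacian G i j ≡ δ i j * deg G i - arc G i j
laplacian-entry G i j with i ≟ j
... | yes refl = trans (degree≡deg G i) (trans (e (deg G i)) (cong (λ z → 1ℤ * deg G i - z) (sym (arc-irrefl G i))))
  where
  e : ∀ x → x ≡ 1ℤ * x - 0ℤ
  e = solve-∀
... | no _ with adj G i j
...   | true  = refl
...   | false = refl

-- det (aI + bL(G))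
lapD : ∀ {n} → Graph n → ℤ → ℤ → ℤ
lapD {n} G a b = D n (λ _ → a) (λ i j → b * arc G i j)

charPoly-linear : ∀ {n} (G : Graph n) i j →
  Linear (addP (if ⌊ i ≟ j ⌋ then (+ 0 ∷ + 1 ∷ []) else []) ((- laplacian G i j) ∷ [])) (- laplacian G i j) (δ i j)
charPoly-linear G i j with i ≟ j
... | yes refl = subst (λ u → Linear (u ∷ 1ℤ ∷ []) (- (+ degree G i)) 1ℤ) (sym (ℤP.+-identityˡ (- (+ degree G i)))) (linear₂ (- (+ degree G i)) 1ℤ)
... | no _     = linear₁ _

-- The sign of b turns det (xI - L) into det (aI + bL). The rows of L sum to zero, so `D` sees the
-- constant root weight a.
evalH-charPoly : ∀ {n} (G : Graph n) a b → evalH a (- b) n (coeff (charPolyL G)) ≡ lapD G a b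
evalH-charPoly {n} G a b = trans (evalH-det a (- b) n (charPoly-linear G))
  (trans (detℤ≡D n M) (D-cong n {w = λ i j → - M i j} {w′ = λ i j → b * arc G i j} rowSum offDiag))
  where
  M : Weights n
  M i j = - laplacian G i j * - b + δ i j * a
  M≡ : ∀ i j → M i j ≡ δ i j * (b * deg G i + a) + - b * arc G i j
  M≡ i j = trans (cong (λ l → - l * - b + δ i j * a) (laplacian-entry G i j)) (e (δ i j) (deg G i) (arc G i j) b a)
    where
    e : ∀ d g x b a → - (d * g - x) * - b + d * a ≡ d * (b * g + a) + - b * x
    e = solve-∀
  rowSum : ∀ i → ∑ (M i) ≡ a
  rowSum i = trans (∑-cong (M≡ i)) (trans (∑-distrib-+ (λ j → δ i j * (b * deg G i + a)) (λ j → - b * arc G i j))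
    (trans (cong₂ _+_ (∑-δ i (λ _ → b * deg G i + a)) (∑-* (- b) (arc G i))) (e b (deg G i) a)))
    where
    e : ∀ b g a → b * g + a + - b * g ≡ a
    e = solve-∀
  offDiag : ∀ i j → i ≢ j → - M i j ≡ b * arc G i j
  offDiag i j i≢j = trans (cong -_ (M≡ i j)) (trans (cong (λ d → - (d * (b * deg G i + a) + - b * arc G i j)) (δ-≢ i≢j)) (e (b * deg G i + a) b (arc G i j)))
    where
    e : ∀ x b y → - (0ℤ * x + - b * y) ≡ b * y
    e = solve-∀

D-identity : ∀ n {w : Weights n} → (∀ i j → w i j ≡ 0ℤ) → D n (λ _ → 1ℤ) w ≡ 1ℤ
D-identity zero h = refl
D-identity (suc n) {w} h = cong₂ _+_
  (trans (ℤP.*-identityˡ (D n (absorb (λ _ → 1ℤ) w) (rest w))) (trans (D-cong n {w = rest w} {w′ = rest w} (λ i → cong (_+_ 1ℤ) (h (suc i) zero)) λ _ _ _ → refl) (D-identity n λ i j → h (suc i) (suc j))))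
  (∑-zero λ t → cong (_* D n (λ _ → 1ℤ) (merge w t)) (h zero (suc t)))

charPoly-monic : ∀ {n} (G : Graph n) → coeff (charPolyL G) n ≡ 1ℤ
charPoly-monic {n} G = trans (sym (evalH-top n (coeff (charPolyL G)))) (trans (evalH-charPoly G 1ℤ 0ℤ) (D-identity n λ _ _ → refl))

charPoly-degree : ∀ {n} (G : Graph n) k → n ℕ.< k → coeff (charPolyL G) k ≡ 0ℤ
charPoly-degree {n} G = det-degree n (charPoly-linear G)

-- `LCospectral` compares coefficients only; the number of vertices is recovered as the degree of a
-- monic polynomial.
cospectral-size : ∀ {n m} (G : Graph n) (H : Graph m) → LCospectral G H → n ≡ m
cospectral-size {n} {m} G H h with ℕP.<-cmp n m
... | tri≈ _ e _ = e
... | tri< lt _ _ = case trans (sym (charPoly-monic H)) (trans (sym (h m)) (charPoly-degree G m lt)) of λ ()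
... | tri> _ _ gt = case trans (sym (charPoly-monic G)) (trans (h n) (charPoly-degree H n gt)) of λ ()

cospectral-lapD : ∀ {n} (G H : Graph n) → LCospectral G H → ∀ a b → lapD G a b ≡ lapD H a b
cospectral-lapD {n} G H h a b = trans (sym (evalH-charPoly G a b)) (trans (evalH-cong a (- b) n h) (evalH-charPoly H a b))

-- Power sums of the Laplacian spectrum

tr₁ tr₂ tr₃ : ∀ {n} → Weights n → ℤ
tr₁ B = ∑ λ i → B i i
tr₂ B = ∑ λ i → ∑ λ j → B i j * B j i
tr₃ B = ∑ λ i → ∑ λ j → ∑ λ k → B i j * (B j k * B k i)

module _ {n} (B : Weights (suc n)) where

  corner border rowTail : ℤ
  corner = B zero zero
  rowTail = ∑ λ t → B zero (suc t)
  border = ∑ λ t → B zero (suc t) * B (suc t) zero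

  colImage : Fin n → ℤ
  colImage i = ∑ λ k → B (suc i) (suc k) * B (suc k) zero

  border₂ : ℤ
  border₂ = ∑ λ t → B zero (suc t) * colImage t

  -- The contraction step seen as a matrix operation; unlike in `merge`, the diagonal entry matters
  -- here, since traces read it.
  addCol : Fin n → Weights n
  addCol t i j = B (suc i) (suc j) + δ j t * B (suc i) zero

  tr₂-suc : tr₂ B ≡ tr₂ (rest B) + corner * corner + (1ℤ + 1ℤ) * border
  tr₂-suc = trans (cong₂ _+_ (refl {x = corner * corner + border})
      (trans (∑-distrib-+ (λ i → B (suc i) zero * B zero (suc i)) (λ i → ∑ λ j → rest B i j * rest B j i))
        (cong (_+ tr₂ (rest B)) (∑-cong λ i → ℤP.*-comm (B (suc i) zero) (B zero (suc i))))))
    (e corner border (tr₂ (rest B)))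
    where
    e : ∀ c b t → c * c + b + (b + t) ≡ t + c * c + (1ℤ + 1ℤ) * b
    e = solve-∀

  tr₃-suc : tr₃ B ≡ tr₃ (rest B) + corner * corner * corner + (+ 3) * corner * border + (+ 3) * border₂
  tr₃-suc = trans (cong₂ _+_ (cong₂ _+_ topTop topRest) (trans (∑-distrib-+
      (λ i → B (suc i) zero * (corner * B zero (suc i)) + ∑ (λ k → B (suc i) zero * (B zero (suc k) * rest B k i)))
      (λ i → ∑ λ j → rest B i j * (B (suc j) zero * B zero (suc i)) + ∑ (λ k → rest B i j * (rest B j k * rest B k i)))) (cong₂ _+_ restTop restRest)))
    (e corner border border₂ (tr₃ (rest B)))
    where
    e : ∀ c b w t → (c * c * c + c * b) + (c * b + w) + ((c * b + w) + (w + t))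
                    ≡ t + c * c * c + (+ 3) * c * b + (+ 3) * w
    e = solve-∀
    e₁ : ∀ x y z → x * (y * z) ≡ y * (x * z)
    e₁ = solve-∀
    e₂ : ∀ x y z → x * (y * z) ≡ y * (z * x)
    e₂ = solve-∀
    e₃ : ∀ x y z → x * (y * z) ≡ z * (x * y)
    e₃ = solve-∀
    topTop : corner * (corner * corner) + ∑ (λ k → corner * (B zero (suc k) * B (suc k) zero)) ≡ corner * corner * corner + corner * border
    topTop = cong₂ _+_ (sym (ℤP.*-assoc corner corner corner)) (∑-* corner (λ k → B zero (suc k) * B (suc k) zero))
    topRest : ∑ (λ j → B zero (suc j) * (B (suc j) zero * corner) + ∑ (λ k → B zero (suc j) * (rest B j k * B (suc k) zero))) ≡ corner * border + border₂
    topRest = trans (∑-distrib-+ (λ j → B zero (suc j) * (B (suc j) zero * corner)) (λ j → ∑ (λ k → B zero (suc j) * (rest B j k * B (suc k) zero)))) (cong₂ _+_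
      (trans (∑-cong λ j → e₃ (B zero (suc j)) (B (suc j) zero) corner) (∑-* corner (λ k → B zero (suc k) * B (suc k) zero)))
      (∑-cong λ j → ∑-* (B zero (suc j)) (λ k → rest B j k * B (suc k) zero)))
    restTop : ∑ (λ i → B (suc i) zero * (corner * B zero (suc i)) + ∑ (λ k → B (suc i) zero * (B zero (suc k) * rest B k i))) ≡ corner * border + border₂
    restTop = trans (∑-distrib-+ (λ i → B (suc i) zero * (corner * B zero (suc i))) (λ i → ∑ (λ k → B (suc i) zero * (B zero (suc k) * rest B k i)))) (cong₂ _+_
      (trans (∑-cong λ i → e₂ (B (suc i) zero) corner (B zero (suc i))) (∑-* corner (λ k → B zero (suc k) * B (suc k) zero)))
      (trans (∑-comm λ i k → B (suc i) zero * (B zero (suc k) * rest B k i))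
        (∑-cong λ k → trans (∑-cong λ i → e₂ (B (suc i) zero) (B zero (suc k)) (rest B k i)) (∑-* (B zero (suc k)) (λ i → rest B k i * B (suc i) zero)))))
    restRest : ∑ (λ i → ∑ λ j → rest B i j * (B (suc j) zero * B zero (suc i)) + ∑ (λ k → rest B i j * (rest B j k * rest B k i))) ≡ border₂ + tr₃ (rest B)
    restRest = trans (∑-cong λ i → ∑-distrib-+ (λ j → rest B i j * (B (suc j) zero * B zero (suc i))) (λ j → ∑ (λ k → rest B i j * (rest B j k * rest B k i))))
      (trans (∑-distrib-+ (λ i → ∑ λ j → rest B i j * (B (suc j) zero * B zero (suc i))) (λ i → ∑ λ j → ∑ (λ k → rest B i j * (rest B j k * rest B k i))))
        (cong (_+ tr₃ (rest B)) (∑-cong λ i → trans (∑-cong λ j → e₃ (rest B i j) (B (suc j) zero) (B zero (suc i))) (∑-* (B zero (suc i)) (λ j → rest B i j * B (suc j) zero)))))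

  tr₁-addCol : ∀ t → tr₁ (addCol t) ≡ tr₁ (rest B) + B (suc t) zero
  tr₁-addCol t = trans (∑-distrib-+ (λ i → rest B i i) (λ i → δ i t * B (suc i) zero)) (cong (_+_ (tr₁ (rest B))) (∑-δ′ t (λ i → B (suc i) zero)))

  tr₂-addCol : ∀ t → tr₂ (addCol t) ≡ tr₂ (rest B) + (1ℤ + 1ℤ) * colImage t + B (suc t) zero * B (suc t) zero
  tr₂-addCol t = begin
    ∑ (λ i → ∑ λ j → addCol t i j * addCol t j i)
      ≡⟨ ∑-cong (λ i → trans (∑-cong λ j → e₁ (rest B i j) (rest B j i) (δ j t) (δ i t) (c i) (c j))
           (trans (∑-distrib-+ (λ j → rest B i j * rest B j i + δ j t * (c i * rest B j i)) (λ j → δ i t * (c j * rest B i j) + δ j t * (δ i t * (c i * c j))))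
             (cong₂ _+_ (trans (∑-distrib-+ (λ j → rest B i j * rest B j i) (λ j → δ j t * (c i * rest B j i))) (cong (_+_ (∑ (λ j → rest B i j * rest B j i))) (∑-δ′ t (λ j → c i * rest B j i))))
               (trans (∑-distrib-+ (λ j → δ i t * (c j * rest B i j)) (λ j → δ j t * (δ i t * (c i * c j)))) (cong₂ _+_ (trans (∑-* (δ i t) (λ j → c j * rest B i j)) (cong (δ i t *_) (∑-cong λ j → ℤP.*-comm (c j) (rest B i j)))) (∑-δ′ t (λ j → δ i t * (c i * c j)))))))) ⟩
    ∑ (λ i → (∑ (λ j → rest B i j * rest B j i) + c i * rest B t i) + (δ i t * colImage i + δ i t * (c i * c t)))
      ≡⟨ trans (∑-distrib-+ (λ i → ∑ (λ j → rest B i j * rest B j i) + c i * rest B t i) (λ i → δ i t * colImage i + δ i t * (c i * c t)))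
          (cong₂ _+_ (trans (∑-distrib-+ (λ i → ∑ (λ j → rest B i j * rest B j i)) (λ i → c i * rest B t i)) (cong (_+_ (tr₂ (rest B))) (∑-cong λ i → ℤP.*-comm (c i) (rest B t i))))
                     (trans (∑-distrib-+ (λ i → δ i t * colImage i) (λ i → δ i t * (c i * c t))) (cong₂ _+_ (∑-δ′ t colImage) (∑-δ′ t (λ i → c i * c t))))) ⟩
    tr₂ (rest B) + colImage t + (colImage t + c t * c t)
      ≡⟨ e₂ (tr₂ (rest B)) (colImage t) (c t) ⟩
    tr₂ (rest B) + (1ℤ + 1ℤ) * colImage t + c t * c t ∎
    where
    open ≡-Reasoning
    c : Fin n → ℤ
    c i = B (suc i) zero
    e₁ : ∀ x y dj di ci cj → (x + dj * ci) * (y + di * cj) ≡ (x * y + dj * (ci * y)) + (di * (cj * x) + dj * (di * (ci * cj)))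
    e₁ = solve-∀
    e₂ : ∀ t w c → t + w + (w + c * c) ≡ t + (1ℤ + 1ℤ) * w + c * c
    e₂ = solve-∀

-- This is det (I + yB), rewritten for `D` by row sums and negated off-diagonal entries.
detI : ∀ n → ℤ → Weights n → ℤ
detI n y B = D n (λ i → 1ℤ + y * ∑ (B i)) (λ i j → - (y * B i j))

detI-suc : ∀ n y (B : Weights (suc n)) → detI (suc n) y B ≡
  (1ℤ + y * (corner B + rowTail B)) * detI n y (rest B) + - y * ∑ (λ t → B zero (suc t) * detI n y (addCol B t))
detI-suc n y B = cong₂ _+_
  (cong ((1ℤ + y * (corner B + rowTail B)) *_) (D-cong n {w = λ i j → - (y * rest B i j)} {w′ = λ i j → - (y * rest B i j)} (λ i → e₁ y (B (suc i) zero) (∑ (rest B i))) λ _ _ _ → refl))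
  (trans (∑-cong λ t → trans (e₃ y (B zero (suc t)) _) (cong (λ z → - y * (B zero (suc t) * z))
      (D-cong n {w = merge (λ i j → - (y * B i j)) t} {w′ = λ i j → - (y * addCol B t i j)} (λ i → cong (λ z → 1ℤ + y * z) (rowSum t i)) λ i j _ → e₂ y (rest B i j) (B (suc i) zero) (δ j t))))
    (∑-* (- y) (λ t → B zero (suc t) * detI n y (addCol B t))))
  where
  e₁ : ∀ y c r → (1ℤ + y * (c + r)) + - (y * c) ≡ 1ℤ + y * r
  e₁ = solve-∀
  e₂ : ∀ y x c d → - (y * x) + d * - (y * c) ≡ - (y * (x + d * c))
  e₂ = solve-∀
  e₃ : ∀ y x z → - (y * x) * z ≡ - y * (x * z)
  e₃ = solve-∀
  rowSum : ∀ t i → B (suc i) zero + ∑ (rest B i) ≡ ∑ (addCol B t i)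
  rowSum t i = trans (ℤP.+-comm (B (suc i) zero) (∑ (rest B i))) (sym (trans (∑-distrib-+ (rest B i) (λ j → δ j t * B (suc i) zero))
    (cong (_+_ (∑ (rest B i))) (∑-δ′ t (λ _ → B (suc i) zero)))))

module _ (y : ℤ) where
  -- Newton's identities: the coefficients of det (I + yB) are elementary symmetric functions of the
  -- eigenvalues, here written in power sums. The multiples 1, 2 and 6 clear the denominators.
  P₁ P₂ P₃ : ∀ {n} → Weights n → ℤ
  P₁ B = 1ℤ + y * tr₁ B
  P₂ B = + 2 + y * (+ 2 * tr₁ B) + y * y * (tr₁ B * tr₁ B - tr₂ B)
  P₃ B = + 6 + y * (+ 6 * tr₁ B) + y * y * (+ 3 * (tr₁ B * tr₁ B - tr₂ B))
       + y * y * y * (tr₁ B * tr₁ B * tr₁ B - + 3 * tr₁ B * tr₂ B + + 2 * tr₃ B)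

  detI₀ : ∀ n (B : Weights n) → detI n y B ≈ 1ℤ [ y ]
  detI₀ zero B = ≈-reflexive refl
  detI₀ (suc n) B with detI₀ n (rest B)
  ... | modulo q eq = modulo (r * detI n y (rest B) + q + - ∑ (λ t → B zero (suc t) * detI n y (addCol B t)))
    (trans (detI-suc n y B) (trans (e₁ y r (detI n y (rest B)) s) (trans (cong (_+ y * (r * detI n y (rest B) + - s)) eq) (e₂ y q (r * detI n y (rest B)) s))))
    where
    r = corner B + rowTail B
    s = ∑ λ t → B zero (suc t) * detI n y (addCol B t)
    e₁ : ∀ y r d s → (1ℤ + y * r) * d + - y * s ≡ d + y * (r * d + - s)
    e₁ = solve-∀
    e₂ : ∀ y q a s → 1ℤ + y * q + y * (a + - s) ≡ 1ℤ + y * (a + q + - s)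
    e₂ = solve-∀

  detI₁ : ∀ n (B : Weights n) → detI n y B ≈ P₁ B [ y * y ]
  detI₁ zero B = ≈-reflexive (e y)
    where
    e : ∀ y → 1ℤ ≡ 1ℤ + y * 0ℤ
    e = solve-∀
  detI₁ (suc n) B = ≈-trans (≈-reflexive (detI-suc n y B)) (≈-trans
    (≈-+ (≈-* (≈-reflexive {1ℤ + y * r} refl) (detI₁ n (rest B)))
         (≈-trans (≈-reflexive (e₀ y (∑ λ t → B zero (suc t) * detI n y (addCol B t)))) (≈-scale y (≈-neg (≈-∑ λ t → ≈-* (≈-reflexive {B zero (suc t)} refl) (detI₀ n (addCol B t)))))))
    (≈-trans (≈-reflexive (cong (λ z → (1ℤ + y * r) * P₁ (rest B) + y * - z) (∑-cong λ t → ℤP.*-identityʳ (B zero (suc t)))))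
             (modulo ((corner B + rowTail B) * tr₁ (rest B)) (e₁ y (corner B) (rowTail B) (tr₁ (rest B))))))
    where
    r = corner B + rowTail B
    e₀ : ∀ y s → - y * s ≡ y * - s
    e₀ = solve-∀
    e₁ : ∀ y b r p → (1ℤ + y * (b + r)) * (1ℤ + y * p) + y * - r ≡ (1ℤ + y * (b + p)) + y * y * ((b + r) * p)
    e₁ = solve-∀

  detI₂ : ∀ n (B : Weights n) → + 2 * detI n y B ≈ P₂ B [ y * (y * y) ]
  detI₂ zero B = ≈-reflexive (e y)
    where
    e : ∀ y → + 2 ≡ + 2 + y * (+ 2 * 0ℤ) + y * y * (0ℤ * 0ℤ - 0ℤ)
    e = solve-∀
  detI₂ (suc n) B = ≈-trans (≈-reflexive (trans (cong (+ 2 *_) (detI-suc n y B)) (e₀ y r (detI n y (rest B)) (∑ λ t → B zero (suc t) * detI n y (addCol B t))))) (≈-trans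
    (≈-+ (≈-* (≈-reflexive {1ℤ + y * r} refl) (detI₂ n (rest B)))
         (≈-scale y (≈-* (≈-reflexive { - + 2} refl) (≈-∑ λ t → ≈-* (≈-reflexive {B zero (suc t)} refl) (detI₁ n (addCol B t))))))
    (≈-trans (≈-reflexive (cong (λ z → (1ℤ + y * r) * P₂ (rest B) + y * (- + 2 * z)) sums))
      (≈-trans (modulo (r * (p₁ * p₁ - p₂)) (e₁ y (corner B) (rowTail B) p₁ p₂ (border B)))
        (≈-reflexive (cong (λ z → + 2 + y * (+ 2 * tr₁ B) + y * y * (tr₁ B * tr₁ B - z)) (sym (tr₂-suc B)))))))
    where
    r = corner B + rowTail B
    p₁ = tr₁ (rest B)
    p₂ = tr₂ (rest B)
    e₀ : ∀ y r d s → + 2 * ((1ℤ + y * r) * d + - y * s) ≡ (1ℤ + y * r) * (+ 2 * d) + y * (- + 2 * s)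
    e₀ = solve-∀
    e₁ : ∀ y b r p₁ p₂ q → (1ℤ + y * (b + r)) * (+ 2 + y * (+ 2 * p₁) + y * y * (p₁ * p₁ - p₂)) + y * (- + 2 * ((1ℤ + y * p₁) * r + y * q))
       ≡ (+ 2 + y * (+ 2 * (b + p₁)) + y * y * ((b + p₁) * (b + p₁) - (p₂ + b * b + (1ℤ + 1ℤ) * q))) + y * (y * y) * ((b + r) * (p₁ * p₁ - p₂))
    e₁ = solve-∀
    e₂ : ∀ x y p c → x * (1ℤ + y * (p + c)) ≡ (1ℤ + y * p) * x + y * (x * c)
    e₂ = solve-∀
    sums : ∑ (λ t → B zero (suc t) * P₁ (addCol B t)) ≡ (1ℤ + y * p₁) * rowTail B + y * border B
    sums = trans (∑-cong λ t → trans (cong (λ z → B zero (suc t) * (1ℤ + y * z)) (tr₁-addCol B t)) (e₂ (B zero (suc t)) y p₁ (B (suc t) zero)))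
      (∑-lin (1ℤ + y * p₁) y (λ t → B zero (suc t)) (λ t → B zero (suc t) * B (suc t) zero))

  -- The sum over merges carries a factor y, so the order-two expansion of `addCol` is enough for
  -- it; `tr₁-addCol` and `tr₂-addCol` supply its traces, and `tr₃-suc` reassembles the third power
  -- sum.
  detI₃ : ∀ n (B : Weights n) → + 6 * detI n y B ≈ P₃ B [ y * (y * (y * y)) ]
  detI₃ zero B = ≈-reflexive (e y)
    where
    e : ∀ y → + 6 ≡ + 6 + y * (+ 6 * 0ℤ) + y * y * (+ 3 * (0ℤ * 0ℤ - 0ℤ)) + y * y * y * (0ℤ * 0ℤ * 0ℤ - + 3 * 0ℤ * 0ℤ + + 2 * 0ℤ)
    e = solve-∀
  detI₃ (suc n) B = ≈-trans (≈-reflexive (trans (cong (+ 6 *_) (detI-suc n y B)) (trans (e₀ y r (detI n y (rest B)) (∑ λ t → B zero (suc t) * detI n y (addCol B t)))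
      (cong (λ z → (1ℤ + y * r) * (+ 6 * detI n y (rest B)) + y * (- + 3 * z)) (trans (sym (∑-* (+ 2) (λ t → B zero (suc t) * detI n y (addCol B t)))) (∑-cong λ t → e₃ (B zero (suc t)) (detI n y (addCol B t)))))))) (≈-trans
    (≈-+ (≈-* (≈-reflexive {1ℤ + y * r} refl) (detI₃ n (rest B)))
         (≈-scale y (≈-* (≈-reflexive { - + 3} refl) (≈-∑ λ t → ≈-* (≈-reflexive {B zero (suc t)} refl) (detI₂ n (addCol B t))))))
    (≈-trans (≈-reflexive (cong (λ z → (1ℤ + y * r) * P₃ (rest B) + y * (- + 3 * z)) sums))
      (≈-trans (modulo (r * (p₁ * p₁ * p₁ - + 3 * p₁ * p₂ + + 2 * p₃)) (e₁ y (corner B) (rowTail B) p₁ p₂ p₃ (border B) (border₂ B)))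
        (≈-reflexive (cong₂ (λ z v → + 6 + y * (+ 6 * tr₁ B) + y * y * (+ 3 * (tr₁ B * tr₁ B - z)) + y * y * y * (tr₁ B * tr₁ B * tr₁ B - + 3 * tr₁ B * z + + 2 * v)) (sym (tr₂-suc B)) (sym (tr₃-suc B)))))))
    where
    r = corner B + rowTail B
    p₁ = tr₁ (rest B)
    p₂ = tr₂ (rest B)
    p₃ = tr₃ (rest B)
    e₀ : ∀ y r d s → + 6 * ((1ℤ + y * r) * d + - y * s) ≡ (1ℤ + y * r) * (+ 6 * d) + y * (- + 3 * (+ 2 * s))
    e₀ = solve-∀
    e₁ : ∀ y b r p₁ p₂ p₃ q w → (1ℤ + y * (b + r)) * (+ 6 + y * (+ 6 * p₁) + y * y * (+ 3 * (p₁ * p₁ - p₂)) + y * y * y * (p₁ * p₁ * p₁ - + 3 * p₁ * p₂ + + 2 * p₃))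
         + y * (- + 3 * ((+ 2 + y * (+ 2 * p₁) + y * y * (p₁ * p₁ - p₂)) * r + ((y * + 2 + y * y * (+ 2 * p₁)) * q + y * y * (- + 2) * w)))
       ≡ (+ 6 + y * (+ 6 * (b + p₁)) + y * y * (+ 3 * ((b + p₁) * (b + p₁) - (p₂ + b * b + (1ℤ + 1ℤ) * q)))
           + y * y * y * ((b + p₁) * (b + p₁) * (b + p₁) - + 3 * (b + p₁) * (p₂ + b * b + (1ℤ + 1ℤ) * q) + + 2 * (p₃ + b * b * b + + 3 * b * q + + 3 * w)))
         + y * (y * (y * y)) * ((b + r) * (p₁ * p₁ * p₁ - + 3 * p₁ * p₂ + + 2 * p₃))
    e₁ = solve-∀
    e₂ : ∀ x y p₁ p₂ c w → x * (+ 2 + y * (+ 2 * (p₁ + c)) + y * y * ((p₁ + c) * (p₁ + c) - (p₂ + (1ℤ + 1ℤ) * w + c * c)))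
       ≡ (+ 2 + y * (+ 2 * p₁) + y * y * (p₁ * p₁ - p₂)) * x + ((y * + 2 + y * y * (+ 2 * p₁)) * (x * c) + y * y * (- + 2) * (x * w))
    e₂ = solve-∀
    e₃ : ∀ x d → + 2 * (x * d) ≡ x * (+ 2 * d)
    e₃ = solve-∀
    sums : ∑ (λ t → B zero (suc t) * P₂ (addCol B t))
         ≡ (+ 2 + y * (+ 2 * p₁) + y * y * (p₁ * p₁ - p₂)) * rowTail B + ((y * + 2 + y * y * (+ 2 * p₁)) * border B + y * y * (- + 2) * border₂ B)
    sums = trans (∑-cong λ t → trans (cong₂ (λ z v → B zero (suc t) * (+ 2 + y * (+ 2 * z) + y * y * (z * z - v))) (tr₁-addCol B t) (tr₂-addCol B t))
                                     (e₂ (B zero (suc t)) y p₁ p₂ (B (suc t) zero) (colImage B t)))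
      (trans (∑-distrib-+ (λ t → k₁ * B zero (suc t)) (λ t → k₂ * (B zero (suc t) * B (suc t) zero) + k₃ * (B zero (suc t) * colImage B t)))
        (cong₂ _+_ (∑-* k₁ (λ t → B zero (suc t))) (∑-lin k₂ k₃ (λ t → B zero (suc t) * B (suc t) zero) (λ t → B zero (suc t) * colImage B t))))
      where
      k₁ = + 2 + y * (+ 2 * p₁) + y * y * (p₁ * p₁ - p₂)
      k₂ = y * + 2 + y * y * (+ 2 * p₁)
      k₃ = y * y * (- + 2)

-- Take the modulus 1 + |a - b|: the difference is a multiple of it, yet smaller in absolute value.
-- Applied with y as modulus, this replaces the comparison of polynomial coefficients.
≈-all : ∀ {a b} → (∀ k → a ≈ b [ + suc k ]) → a ≡ b
≈-all {a} {b} h with h ∣ a - b ∣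
... | modulo q eq = ℤP.i-j≡0⇒i≡j a b (diff q (trans (cong (_- b) eq) (e b (+ suc ∣ a - b ∣ * q))))
  where
  e : ∀ b x → b + x - b ≡ x
  e = solve-∀
  diff : ∀ q → a - b ≡ + suc ∣ a - b ∣ * q → a - b ≡ 0ℤ
  diff q eq = go ∣ q ∣ refl
    where
    go : ∀ k → ∣ q ∣ ≡ k → a - b ≡ 0ℤ
    go zero    e₀ = trans eq (trans (cong (+ suc ∣ a - b ∣ *_) (ℤP.∣i∣≡0⇒i≡0 e₀)) (ℤP.*-zeroʳ (+ suc ∣ a - b ∣)))
    go (suc k) e₀ = contradiction (trans (cong ∣_∣ eq) (trans (ℤP.abs-* (+ suc ∣ a - b ∣) q) (cong (suc ∣ a - b ∣ ℕ.*_) e₀)))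
      (ℕP.<⇒≢ (ℕP.m≤m*n (suc ∣ a - b ∣) (suc k)))

≈-cancel : ∀ c {a b m} → 1ℤ ≤ c → c * a ≈ c * b [ c * m ] → a ≈ b [ m ]
≈-cancel c@(+ suc _) {a} {b} {m} _ (modulo q eq) = modulo q (ℤP.*-cancelˡ-≡ c a (b + m * q) (trans eq (e c b m q)))
  where
  e : ∀ c b m q → c * b + c * m * q ≡ c * (b + m * q)
  e = solve-∀
≈-cancel (+ zero) (+≤+ ())

+-cancelʳ : ∀ c a b → a + c ≡ b + c → a ≡ b
+-cancelʳ c a b h = trans (e a c) (trans (cong (_- c) h) (sym (e b c)))
  where
  e : ∀ a c → a ≡ a + c - c
  e = solve-∀

lap : ∀ {n} → Graph n → Weights n
lap G i j = δ i j * deg G i - arc G i j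

lapD≡detI : ∀ {n} (G : Graph n) y → lapD G 1ℤ y ≡ detI n y (lap G)
lapD≡detI {n} G y = D-cong n {w = λ i j → y * arc G i j} {w′ = λ i j → - (y * lap G i j)}
  (λ i → sym (trans (cong (λ z → 1ℤ + y * z) (rowSum i)) (e₁ y)))
  (λ i j i≢j → sym (trans (cong (λ d → - (y * (d * deg G i - arc G i j))) (δ-≢ i≢j)) (e₂ y (deg G i) (arc G i j))))
  where
  e₁ : ∀ y → 1ℤ + y * 0ℤ ≡ 1ℤ
  e₁ = solve-∀
  e₂ : ∀ y d x → - (y * (0ℤ * d - x)) ≡ y * x
  e₂ = solve-∀
  e₃ : ∀ d → d + - 1ℤ * d ≡ 0ℤ
  e₃ = solve-∀
  e₄ : ∀ d x → d - x ≡ d + - 1ℤ * x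
  e₄ = solve-∀
  rowSum : ∀ i → ∑ (lap G i) ≡ 0ℤ
  rowSum i = trans (∑-cong λ j → e₄ (δ i j * deg G i) (arc G i j)) (trans (∑-distrib-+ (λ j → δ i j * deg G i) (λ j → - 1ℤ * arc G i j))
    (trans (cong₂ _+_ (∑-δ i (λ _ → deg G i)) (∑-* (- 1ℤ) (arc G i))) (e₃ (deg G i))))

module _ {n} (G : Graph n) where
  degSum degSum₂ degSum₃ closed₃ : ℤ
  degSum  = ∑ λ i → deg G i
  degSum₂ = ∑ λ i → deg G i * deg G i
  degSum₃ = ∑ λ i → deg G i * deg G i * deg G i
  closed₃ = ∑ λ i → ∑ λ j → ∑ λ k → arc G i j * (arc G j k * arc G k i)

  private
    d : Fin n → ℤ
    d = deg G
    a : Weights n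
    a = arc G

  arc-sym : ∀ i j → arc G i j ≡ arc G j i
  arc-sym i j = cong ⟦_⟧ (Graph.sym G i j)

  arc-idem : ∀ i j → arc G i j * arc G j i ≡ arc G i j
  arc-idem i j = trans (cong (arc G i j *_) (arc-sym j i)) (idem (adj G i j))
    where
    idem : ∀ b → ⟦ b ⟧ * ⟦ b ⟧ ≡ ⟦ b ⟧
    idem true = refl
    idem false = refl

  walk₂ : Weights n
  walk₂ i k = ∑ λ j → a i j * a j k

  lap² : ∀ i k → ∑ (λ j → lap G i j * lap G j k) ≡ δ i k * (d i * d i) + - 1ℤ * (a i k * (d i + d k)) + walk₂ i k
  lap² i k = trans (∑-cong λ j → e₁ (δ i j) (d i) (a i j) (δ j k) (d j) (a j k))
    (trans (∑-distrib-+ (λ j → δ i j * (d i * (δ j k * d j - a j k))) (λ j → δ j k * (- a i j * d j) + a i j * a j k))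
    (trans (cong₂ _+_ (∑-δ i (λ j → d i * (δ j k * d j - a j k)))
      (trans (∑-distrib-+ (λ j → δ j k * (- a i j * d j)) (λ j → a i j * a j k)) (cong (_+ walk₂ i k) (∑-δ′ k (λ j → - a i j * d j)))))
    (e₂ (δ i k) (d i) (a i k) (d k) (walk₂ i k))))
    where
    e₁ : ∀ x d a y d′ a′ → (x * d - a) * (y * d′ - a′) ≡ x * (d * (y * d′ - a′)) + (y * (- a * d′) + a * a′)
    e₁ = solve-∀
    e₂ : ∀ x d a d′ w → d * (x * d - a) + (- a * d′ + w) ≡ x * (d * d) + - 1ℤ * (a * (d + d′)) + w
    e₂ = solve-∀

  tr₁-lap : tr₁ (lap G) ≡ degSum
  tr₁-lap = ∑-cong λ i → trans (cong₂ (λ x y → x * d i - y) (δ-refl i) (arc-irrefl G i)) (e (d i))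
    where
    e : ∀ x → 1ℤ * x - 0ℤ ≡ x
    e = solve-∀

  tr₂-lap : tr₂ (lap G) ≡ degSum₂ + degSum
  tr₂-lap = trans (∑-cong λ i → trans (lap² i i) (trans (cong₂ (λ x y → x * (d i * d i) + - 1ℤ * (y * (d i + d i)) + walk₂ i i) (δ-refl i) (arc-irrefl G i))
      (trans (cong (_+_ (1ℤ * (d i * d i) + - 1ℤ * (0ℤ * (d i + d i)))) (∑-cong λ j → arc-idem i j)) (e (d i) (d i)))))
    (∑-distrib-+ (λ i → d i * d i) d)
    where
    e : ∀ x y → 1ℤ * (x * x) + - 1ℤ * (0ℤ * (x + x)) + y ≡ x * x + y
    e = solve-∀

  -- Expand the cube of degree matrix minus adjacency matrix under the trace. Terms with one
  -- adjacency factor vanish, those with two give Σd² three times, and the last counts closed walks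
  -- of length 3, six per triangle.
  tr₃-lap : tr₃ (lap G) ≡ degSum₃ + + 3 * degSum₂ - closed₃
  tr₃-lap = trans (∑-cong λ i → trans (∑-cong λ j → ∑-* (lap G i j) (λ k → lap G j k * lap G k i)) (trans (∑-cong λ j → cong (lap G i j *_) (lap² j i)) (row i)))
    (trans (∑-distrib-+ (λ i → d i * d i * d i + + 2 * (d i * d i)) (λ i → 1ℤ * ∑ (λ j → a i j * d j) + - 1ℤ * ∑ (λ j → a i j * walk₂ j i)))
    (trans (cong₂ _+_ (trans (∑-distrib-+ (λ i → d i * d i * d i) (λ i → + 2 * (d i * d i))) (cong (_+_ degSum₃) (∑-* (+ 2) (λ i → d i * d i))))
             (trans (∑-lin 1ℤ (- 1ℤ) (λ i → ∑ (λ j → a i j * d j)) (λ i → ∑ (λ j → a i j * walk₂ j i))) (cong₂ (λ x y → 1ℤ * x + - 1ℤ * y) nbr walks)))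
      (e degSum₃ degSum₂ closed₃)))
    where
    e : ∀ x y z → x + + 2 * y + (1ℤ * y + - 1ℤ * z) ≡ x + + 3 * y - z
    e = solve-∀
    nbr : ∑ (λ i → ∑ λ j → a i j * d j) ≡ degSum₂
    nbr = trans (∑-comm λ i j → a i j * d j) (∑-cong λ j → trans (∑-cong λ i → trans (cong (_* d j) (arc-sym i j)) (ℤP.*-comm (a j i) (d j))) (∑-* (d j) (a j)))
    walks : ∑ (λ i → ∑ λ j → a i j * walk₂ j i) ≡ closed₃
    walks = ∑-cong λ i → ∑-cong λ j → sym (∑-* (a i j) (λ k → a j k * a k i))
    e₁ : ∀ x d a y d′ b w → (x * d - a) * (y * (d′ * d′) + - 1ℤ * (b * (d′ + d)) + w)
       ≡ x * (d * (y * (d′ * d′) + - 1ℤ * (b * (d′ + d)) + w)) + (y * (- a * (d′ * d′)) + ((a * b) * d′ + ((a * b) * d + - a * w)))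
    e₁ = solve-∀
    e₂ : ∀ d u v w → d * (1ℤ * (d * d) + - 1ℤ * (0ℤ * (d + d)) + d) + (- 0ℤ * (d * d) + (u + (d * d + - 1ℤ * w))) ≡ (d * d * d + + 2 * (d * d)) + (1ℤ * u + - 1ℤ * w)
    e₂ = solve-∀
    row : ∀ i → ∑ (λ j → lap G i j * (δ j i * (d j * d j) + - 1ℤ * (a j i * (d j + d i)) + walk₂ j i))
        ≡ (d i * d i * d i + + 2 * (d i * d i)) + (1ℤ * ∑ (λ j → a i j * d j) + - 1ℤ * ∑ (λ j → a i j * walk₂ j i))
    row i = trans (∑-cong λ j → trans (e₁ (δ i j) (d i) (a i j) (δ j i) (d j) (a j i) (walk₂ j i))
          (cong (λ z → δ i j * F j + (δ j i * (- a i j * (d j * d j)) + (z * d j + (z * d i + - a i j * walk₂ j i)))) (arc-idem i j)))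
      (trans (∑-distrib-+ (λ j → δ i j * F j) (λ j → δ j i * (- a i j * (d j * d j)) + (a i j * d j + (a i j * d i + - a i j * walk₂ j i)))) (trans (cong₂ _+_ (∑-δ i F)
        (trans (∑-distrib-+ (λ j → δ j i * (- a i j * (d j * d j))) (λ j → a i j * d j + (a i j * d i + - a i j * walk₂ j i))) (cong₂ _+_ (∑-δ′ i (λ j → - a i j * (d j * d j)))
          (trans (∑-distrib-+ (λ j → a i j * d j) (λ j → a i j * d i + - a i j * walk₂ j i)) (cong (_+_ (∑ λ j → a i j * d j))
            (trans (∑-distrib-+ (λ j → a i j * d i) (λ j → - a i j * walk₂ j i)) (cong₂ _+_ (trans (∑-cong λ j → ℤP.*-comm (a i j) (d i)) (∑-* (d i) (a i)))
              (trans (∑-cong λ j → sym (neg (a i j) (walk₂ j i))) (∑-* (- 1ℤ) (λ j → a i j * walk₂ j i))))))))))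
        (trans (cong₂ (λ x y → d i * (x * (d i * d i) + - 1ℤ * (y * (d i + d i)) + walk₂ i i) + (- y * (d i * d i) + (∑ (λ j → a i j * d j) + (d i * d i + - 1ℤ * ∑ (λ j → a i j * walk₂ j i))))) (δ-refl i) (arc-irrefl G i))
          (trans (cong (λ z → d i * (1ℤ * (d i * d i) + - 1ℤ * (0ℤ * (d i + d i)) + z) + (- 0ℤ * (d i * d i) + (∑ (λ j → a i j * d j) + (d i * d i + - 1ℤ * ∑ (λ j → a i j * walk₂ j i))))) (∑-cong λ j → arc-idem i j))
            (e₂ (d i) (∑ (λ j → a i j * d j)) 0ℤ (∑ (λ j → a i j * walk₂ j i)))))))
      where
      F : Fin n → ℤ
      F j = d i * (δ j i * (d j * d j) + - 1ℤ * (a j i * (d j + d i)) + walk₂ j i)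
      neg : ∀ x y → - 1ℤ * (x * y) ≡ - x * y
      neg = solve-∀

module _ {n m} (G : Graph n) (H : Graph m) (same : ∀ y → lapD G 1ℤ y ≡ lapD H 1ℤ y) where
  private
    same′ : ∀ y → detI n y (lap G) ≡ detI m y (lap H)
    same′ y = trans (sym (lapD≡detI G y)) (trans (same y) (lapD≡detI H y))

    drop : ∀ c {a b m} → c + a ≈ c + b [ m ] → a ≈ b [ m ]
    drop c {a} {b} {m} (modulo q eq) = modulo q (trans (e₁ c a) (trans (cong (_- c) eq) (e₂ c b (m * q))))
      where
      e₁ : ∀ c a → a ≡ c + a - c
      e₁ = solve-∀
      e₂ : ∀ c b x → c + b + x - c ≡ b + x
      e₂ = solve-∀

    tr₁≡ : tr₁ (lap G) ≡ tr₁ (lap H)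
    tr₁≡ = ≈-all λ k → let y = + suc k in ≈-cancel y (+≤+ (s≤s z≤n)) (drop 1ℤ
      (≈-trans (≈-sym (detI₁ y n (lap G))) (≈-trans (≈-reflexive (same′ y)) (detI₁ y m (lap H)))))

    tr₂≡ : tr₂ (lap G) ≡ tr₂ (lap H)
    tr₂≡ = trans (sym (ℤP.neg-involutive (tr₂ (lap G)))) (trans (cong -_ neg≡) (ℤP.neg-involutive (tr₂ (lap H))))
      where
      neg≡ : - tr₂ (lap G) ≡ - tr₂ (lap H)
      neg≡ = ≈-all λ k → let y = + suc k in drop (tr₁ (lap G) * tr₁ (lap G)) (≈-cancel y (+≤+ (s≤s z≤n)) (≈-cancel y (+≤+ (s≤s z≤n))
        (conv y (drop (+ 2 + y * (+ 2 * tr₁ (lap G))) (≈-trans (≈-sym (detI₂ y n (lap G))) (≈-trans (≈-reflexive (cong (+ 2 *_) (same′ y)))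
          (≈-trans (detI₂ y m (lap H)) (≈-reflexive (cong (λ z → + 2 + y * (+ 2 * z) + y * y * (z * z - tr₂ (lap H))) (sym tr₁≡))))))))))
        where
        conv : ∀ y {a b m} → y * y * a ≈ y * y * b [ m ] → y * (y * a) ≈ y * (y * b) [ m ]
        conv y {a} {b} h = ≈-trans (≈-reflexive (sym (ℤP.*-assoc y y a))) (≈-trans h (≈-reflexive (ℤP.*-assoc y y b)))

    tr₃≡ : tr₃ (lap G) ≡ tr₃ (lap H)
    -- `P₃` contains the third power sum with the factor 2.
    tr₃≡ = ℤP.*-cancelˡ-≡ (+ 2) (tr₃ (lap G)) (tr₃ (lap H)) (≈-all λ k → let y = + suc k in
      drop (p₁ * p₁ * p₁ - + 3 * p₁ * p₂) (≈-cancel y (+≤+ (s≤s z≤n)) (≈-cancel y (+≤+ (s≤s z≤n)) (≈-cancel y (+≤+ (s≤s z≤n))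
        (conv y (drop (+ 6 + y * (+ 6 * p₁) + y * y * (+ 3 * (p₁ * p₁ - p₂))) (≈-trans (≈-sym (detI₃ y n (lap G))) (≈-trans (≈-reflexive (cong (+ 6 *_) (same′ y)))
          (≈-trans (detI₃ y m (lap H)) (≈-reflexive (cong₂ (λ z v → + 6 + y * (+ 6 * z) + y * y * (+ 3 * (z * z - v)) + y * y * y * (z * z * z - + 3 * z * v + + 2 * tr₃ (lap H))) (sym tr₁≡) (sym tr₂≡))))))))))))
      where
      p₁ = tr₁ (lap G)
      p₂ = tr₂ (lap G)
      e : ∀ y a → y * y * y * a ≡ y * (y * (y * a))
      e = solve-∀
      conv : ∀ y {a b m} → y * y * y * a ≈ y * y * y * b [ m ] → y * (y * (y * a)) ≈ y * (y * (y * b)) [ m ]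
      conv y {a} {b} h = ≈-trans (≈-reflexive (sym (e y a))) (≈-trans h (≈-reflexive (e y b)))

  degSum≡ : degSum G ≡ degSum H
  degSum≡ = trans (sym (tr₁-lap G)) (trans tr₁≡ (tr₁-lap H))

  degSum₂≡ : degSum₂ G ≡ degSum₂ H
  degSum₂≡ = +-cancelʳ (degSum G) (degSum₂ G) (degSum₂ H)
    (trans (sym (tr₂-lap G)) (trans tr₂≡ (trans (tr₂-lap H) (cong (_+_ (degSum₂ H)) (sym degSum≡)))))

  degSum₃≡ : degSum₃ G - closed₃ G ≡ degSum₃ H - closed₃ H
  degSum₃≡ = +-cancelʳ (+ 3 * degSum₂ G) (degSum₃ G - closed₃ G) (degSum₃ H - closed₃ H) (trans (e (degSum₃ G) (degSum₂ G) (closed₃ G))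
    (trans (sym (tr₃-lap G)) (trans tr₃≡ (trans (tr₃-lap H) (trans (cong (λ z → degSum₃ H + + 3 * z - closed₃ H) (sym degSum₂≡)) (sym (e (degSum₃ H) (degSum₂ G) (closed₃ H))))))))
    where
    e : ∀ x y z → x - z + + 3 * y ≡ x + + 3 * y - z
    e = solve-∀

-- Spanning trees

Conn : ∀ {n} → Graph n → Set
Conn {n} G = (S : Fin n → Bool) → (∀ i j → adj G i j ≡ true → S i ≡ S j) → ∀ i j → S i ≡ S j

-- By the matrix-tree theorem the value does not depend on the root r.
trees : ∀ {n} → Graph n → Fin n → ℤ
trees {n} G r = D n (δ r) (arc G)

0≤arc : ∀ {n} (G : Graph n) i j → 0ℤ ≤ arc G i j
0≤arc G i j = 0≤⟦⟧ (adj G i j)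

0≤δ : ∀ {n} (i j : Fin n) → 0ℤ ≤ δ i j
0≤δ i j = 0≤⟦⟧ (does (i ≟ j))

0≤trees : ∀ {n} (G : Graph n) r → 0ℤ ≤ trees G r
0≤trees {n} G r = D-nonneg n (0≤δ r) (0≤arc G)

-- `Conn` speaks of two-colourings constant along edges, so no walks are needed: vertices coloured
-- differently from r would form a set to which `D-closed` applies.
trees≢0⇒Conn : ∀ {n} (G : Graph n) r → trees G r ≢ 0ℤ → Conn G
trees≢0⇒Conn {n} G r t≢0 S closed i j = trans (root i) (sym (root j))
  where
  T : Fin n → Bool
  T i = not (does (S i BoolP.≟ S r))
  T-true : ∀ i → T i ≡ true → S i ≢ S r
  T-true i h with S i BoolP.≟ S r
  ... | no p = p
  T-false : ∀ i → T i ≡ false → S i ≡ S r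
  T-false i h with S i BoolP.≟ S r
  ... | yes p = p
  no-exit : ∀ i j → T i ≡ true → T j ≡ false → arc G i j ≡ 0ℤ
  no-exit i j hi hj with adj G i j in eq
  ... | false = refl
  ... | true  = contradiction (trans (closed i j eq) (T-false j hj)) (T-true i hi)
  root : ∀ i → S i ≡ S r
  root i with T i in eq
  ... | false = T-false i eq
  ... | true  = contradiction (D-closed n T {i} eq (λ k hk → δ-≢ {i = r} {k} λ { refl → T-true k hk refl }) no-exit) t≢0

missing : ∀ {n} → (Fin n → Bool) → ℕ
missing {zero}  R = 0
missing {suc n} R = (if R zero then 0 else 1) ℕ.+ missing (R ∘ suc)

insert : ∀ {n} → (Fin n → Bool) → Fin n → Fin n → Bool
insert R i j = does (j ≟ i) ∨ R j

missing-insert : ∀ {n} (R : Fin n → Bool) i → R i ≡ false → missing R ≡ suc (missing (insert R i))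
missing-insert R zero    h rewrite h = refl
missing-insert R (suc i) h = trans (cong ((if R zero then 0 else 1) ℕ.+_) (missing-insert (R ∘ suc) i h)) (ℕP.+-suc (if R zero then 0 else 1) _)

module _ {n} (G : Graph n) (r : Fin n) (conn : Conn G) where

  private
    RankedOn : (Fin n → Bool) → (Fin n → ℕ) → Set
    RankedOn R h = ∀ i → R i ≡ true → i ≢ r → ∃ λ j → R j ≡ true × h j ℕ.< h i × adj G i j ≡ true

    -- The reached set R gains a vertex adjacent to it, ranked one above its neighbour in R. When
    -- none is left, R is constant along edges and contains r, so `conn` makes it everything.
    -- `missing` is the termination measure.
    grow : ∀ k R h → missing R ≡ k → R r ≡ true → RankedOn R h → ∃ λ h → ∀ i → i ≢ r → ∃ λ j → h j ℕ.< h i × adj G i j ≡ true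
    grow k R h size r∈R ranked with any? (λ i → any? (λ j → (R i BoolP.≟ false) ×-dec (R j BoolP.≟ true) ×-dec (adj G i j BoolP.≟ true)))
    ... | no ¬exit = h , λ i i≢r → let j , _ , lt , e = ranked i (all i) i≢r in j , lt , e
      where
      closed : ∀ i j → adj G i j ≡ true → R i ≡ R j
      closed i j e with R i in eq | R j in eq′
      ... | true  | true  = refl
      ... | false | false = refl
      ... | false | true  = contradiction (i , j , eq , eq′ , e) ¬exit
      ... | true  | false = contradiction (j , i , eq′ , eq , trans (Graph.sym G j i) e) ¬exit
      all : ∀ i → R i ≡ true
      all i = trans (conn R closed i r) r∈R
    grow zero R h size r∈R ranked | yes (i , j , i∉ , _) = case trans (sym (missing-insert R i i∉)) size of λ ()
    grow (suc k) R h size r∈R ranked | yes (i , j , i∉ , j∈ , e) =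
      grow k (insert R i) h′ (ℕP.suc-injective (trans (sym (missing-insert R i i∉)) size)) (∈-insert r r∈R) ranked′
      where
      h′ : Fin n → ℕ
      h′ l = if does (l ≟ i) then suc (h j) else h l
      ∈-insert : ∀ l → R l ≡ true → insert R i l ≡ true
      ∈-insert l l∈ = trans (cong (does (l ≟ i) ∨_) l∈) (BoolP.∨-zeroʳ (does (l ≟ i)))
      old : ∀ l → R l ≡ true → h′ l ≡ h l
      old l l∈ with l ≟ i
      ... | no _ = refl
      ... | yes refl = case trans (sym i∉) l∈ of λ ()
      ranked′ : RankedOn (insert R i) h′
      ranked′ l l∈ l≢r with l ≟ i
      ... | yes refl = j , ∈-insert j j∈ , subst (ℕ._< suc (h j)) (sym (old j j∈)) ℕP.≤-refl , e
      ... | no _     with ranked l l∈ l≢r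
      ...   | m , m∈ , lt , e′ = m , ∈-insert m m∈ , subst (ℕ._< h l) (sym (old m m∈)) lt , e′

  rank : ∃ λ h → ∀ i → i ≢ r → ∃ λ j → h j ℕ.< h i × adj G i j ≡ true
  rank = grow (missing R) R (λ _ → 0) refl (dec-true (r ≟ r) refl) base
    where
    R : Fin n → Bool
    R i = does (i ≟ r)
    base : RankedOn R (λ _ → 0)
    base i i∈ i≢r = case trans (sym i∈) (dec-false (i ≟ r) i≢r) of λ ()

  Conn⇒trees : 1ℤ ≤ trees G r
  Conn⇒trees = D-positive n {h = proj₁ rank} (0≤δ r) (0≤arc G) step
    where
    step : Ranked (δ r) (arc G) (proj₁ rank)
    step i with i ≟ r
    ... | yes refl = inj₁ (subst (1ℤ ≤_) (sym (δ-refl r)) ℤP.≤-refl)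
    ... | no i≢r with proj₂ rank i i≢r
    ...   | j , lt , e = inj₂ (j , lt , subst (1ℤ ≤_) (sym (cong ⟦_⟧ e)) ℤP.≤-refl)

sameEdge : ∀ {n} → Fin n → Fin n → Fin n → Fin n → Bool
sameEdge i j k l = (does (k ≟ i) ∧ does (l ≟ j)) ∨ (does (k ≟ j) ∧ does (l ≟ i))

sameEdge-sym : ∀ {n} (i j k l : Fin n) → sameEdge i j k l ≡ sameEdge i j l k
sameEdge-sym i j k l = trans (BoolP.∨-comm (does (k ≟ i) ∧ does (l ≟ j)) _)
  (cong₂ _∨_ (BoolP.∧-comm (does (k ≟ j)) _) (BoolP.∧-comm (does (k ≟ i)) _))

delete : ∀ {n} → Graph n → Fin n → Fin n → Graph n
delete G i j = record
  { adj    = λ k l → adj G k l ∧ not (sameEdge i j k l)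
  ; sym    = λ k l → cong₂ (λ x y → x ∧ not y) (Graph.sym G k l) (sameEdge-sym i j k l)
  ; irrefl = λ k → cong (_∧ not (sameEdge i j k k)) (irrefl G k)
  }

delete-⊆ : ∀ {n} (G : Graph n) i j {k l} → adj (delete G i j) k l ≡ true → adj G k l ≡ true
delete-⊆ G i j {k} {l} h with adj G k l
... | true = refl

delete-∌ : ∀ {n} (G : Graph n) i j → adj (delete G i j) i j ≡ false
delete-∌ G i j rewrite dec-true (i ≟ i) refl | dec-true (j ≟ j) refl = BoolP.∧-zeroʳ (adj G i j)

delete-∌′ : ∀ {n} (G : Graph n) i j → adj (delete G i j) j i ≡ false
delete-∌′ G i j = trans (Graph.sym (delete G i j) j i) (delete-∌ G i j)

delete-intro : ∀ {n} (G : Graph n) i j {k l} → adj G k l ≡ true → ¬ (k ≡ i × l ≡ j) → ¬ (k ≡ j × l ≡ i) →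
               adj (delete G i j) k l ≡ true
delete-intro G i j {k} {l} h p q rewrite h with k ≟ i | l ≟ j | k ≟ j | l ≟ i
... | yes e | yes e′ | _ | _ = contradiction (e , e′) p
... | _ | _ | yes e | yes e′ = contradiction (e , e′) q
... | yes _ | no _ | yes _ | no _ = refl
... | yes _ | no _ | no _ | _ = refl
... | no _ | _ | yes _ | no _ = refl
... | no _ | _ | no _ | _ = refl

adj-≢ : ∀ {n} (G : Graph n) {i j} → adj G i j ≡ true → i ≢ j
adj-≢ G {i} h refl = case trans (sym h) (irrefl G i) of λ ()

⟦∧true⟧ : ∀ b → ⟦ b ⟧ ≡ ⟦ b ∧ true ⟧ + 0ℤ
⟦∧true⟧ true  = refl
⟦∧true⟧ false = refl

arc-delete : ∀ {n} (G : Graph n) i j → adj G i j ≡ true → ∀ k l →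
  arc G k l ≡ arc (delete G i j) k l + (δ k i * δ l j + δ k j * δ l i)
arc-delete G i j e k l with k ≟ i | l ≟ j | k ≟ j | l ≟ i
... | yes refl | _ | yes refl | _ = contradiction refl (adj-≢ G e)
... | _ | yes refl | _ | yes refl = contradiction refl (adj-≢ G e)
... | yes refl | yes refl | no _ | no _ rewrite e = refl
... | no _ | no _ | yes refl | yes refl rewrite trans (Graph.sym G k l) e = refl
... | yes _ | no _ | no _ | _ = ⟦∧true⟧ (adj G k l)
... | no _ | yes _ | yes _ | no _ = ⟦∧true⟧ (adj G k l)
... | no _ | yes _ | no _ | _ = ⟦∧true⟧ (adj G k l)
... | no _ | no _ | yes _ | no _ = ⟦∧true⟧ (adj G k l)
... | no _ | no _ | no _ | _ = ⟦∧true⟧ (adj G k l)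

module _ {n} (σ : Fin n → ℤ) (w : Weights n) (i : Fin n) where

  σ[_] : ℤ → Fin n → ℤ
  σ[ s ] k = if does (k ≟ i) then s else σ k

  w[_] : (Fin n → ℤ) → Weights n
  w[ u ] k l = if does (k ≟ i) then u l else w k l

  withRow : ℤ → (Fin n → ℤ) → ℤ
  withRow s u = D n σ[ s ] w[ u ]

  private
    at : ∀ {A : Set} {x y : A} → (if does (i ≟ i) then x else y) ≡ x
    at {x = x} {y} = cong (λ b → if b then x else y) (dec-true (i ≟ i) refl)
    off : ∀ {A : Set} {x y z : A} k → k ≢ i → (if does (k ≟ i) then x else y) ≡ (if does (k ≟ i) then z else y)
    off {x = x} {y} {z} k k≢i = trans (cong (λ b → if b then x else y) (dec-false (k ≟ i) k≢i)) (sym (cong (λ b → if b then z else y) (dec-false (k ≟ i) k≢i)))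

  withRow-self : withRow (σ i) (w i) ≡ D n σ w
  withRow-self = D-cong n same₁ λ k l _ → same₂ k l
    where
    same₁ : ∀ k → σ[ σ i ] k ≡ σ k
    same₁ k with k ≟ i
    ... | yes refl = refl
    ... | no _ = refl
    same₂ : ∀ k l → w[ w i ] k l ≡ w k l
    same₂ k l with k ≟ i
    ... | yes refl = refl
    ... | no _ = refl

  withRow-lin : ∀ x y {s s′ s″ u u′ u″} → s″ ≡ x * s + y * s′ → (∀ l → u″ l ≡ x * u l + y * u′ l) →
                withRow s″ u″ ≡ x * withRow s u + y * withRow s′ u′
  withRow-lin x y {s} {s′} {s″} {u} {u′} {u″} p q = D-row n i {x} {y} {σ[ s ]} {σ[ s′ ]} {σ[ s″ ]} {w[ u ]} {w[ u′ ]} {w[ u″ ]} (rowComb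
    (trans (at {x = s″} {σ i}) (trans p (sym (cong₂ (λ a b → x * a + y * b) (at {x = s} {σ i}) (at {x = s′} {σ i})))))
    (λ l → trans (at {x = u″ l} {w i l}) (trans (q l) (sym (cong₂ (λ a b → x * a + y * b) (at {x = u l} {w i l}) (at {x = u′ l} {w i l})))))
    (λ k → off {x = s} {σ k} {s″} k) (λ k → off {x = s′} {σ k} {s″} k)
    (λ k l → off {x = u l} {w k l} {u″ l} k) (λ k l → off {x = u′ l} {w k l} {u″ l} k))

  withRow-cong : ∀ {s s′ u u′} → s ≡ s′ → (∀ l → u l ≡ u′ l) → withRow s u ≡ withRow s′ u′
  withRow-cong {u = u} {u′} refl q = D-cong n (λ _ → refl) λ k l _ → same k l
    where
    same : ∀ k l → w[ u ] k l ≡ w[ u′ ] k l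
    same k l with does (k ≟ i)
    ... | true = q l
    ... | false = refl

linear-expand : ∀ {m} (L : (Fin m → ℤ) → ℤ) → (∀ {u v} → (∀ l → u l ≡ v l) → L u ≡ L v) →
  (∀ x y {u v t} → (∀ l → t l ≡ x * u l + y * v l) → L t ≡ x * L u + y * L v) →
  ∀ u → L u ≡ ∑ λ j → u j * L (δ j)
linear-expand {zero} L cg lin u = trans (lin 0ℤ 0ℤ {u} {u} {u} λ ()) refl
linear-expand {suc m} L cg lin u = trans (lin (u zero) 1ℤ {δ zero} {pad (u ∘ suc)} {u} split)
  (cong (_+_ (u zero * L (δ zero))) (trans (ℤP.*-identityˡ (L (pad (u ∘ suc))))
    (trans (linear-expand (L ∘ pad) (λ h → cg (pad-cong h)) (λ x y h → lin x y (pad-lin x y h)) (u ∘ suc))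
      (∑-cong λ j → cong (u (suc j) *_) (cg (pad-δ j))))))
  where
  pad : ∀ {m} → (Fin m → ℤ) → Fin (suc m) → ℤ
  pad u zero = 0ℤ
  pad u (suc l) = u l
  e₁ : ∀ x → x ≡ x * 1ℤ + 1ℤ * 0ℤ
  e₁ = solve-∀
  e₂ : ∀ x y → y ≡ x * 0ℤ + 1ℤ * y
  e₂ = solve-∀
  e₃ : ∀ x y → 0ℤ ≡ x * 0ℤ + y * 0ℤ
  e₃ = solve-∀
  split : ∀ l → u l ≡ u zero * δ zero l + 1ℤ * pad (u ∘ suc) l
  split zero = e₁ (u zero)
  split (suc l) = e₂ (u zero) (u (suc l))
  pad-cong : ∀ {u v : Fin m → ℤ} → (∀ l → u l ≡ v l) → ∀ l → pad u l ≡ pad v l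
  pad-cong h zero = refl
  pad-cong h (suc l) = h l
  pad-lin : ∀ x y {u v t : Fin m → ℤ} → (∀ l → t l ≡ x * u l + y * v l) → ∀ l → pad t l ≡ x * pad u l + y * pad v l
  pad-lin x y h zero = e₃ x y
  pad-lin x y h (suc l) = h l
  pad-δ : ∀ j l → pad (δ j) l ≡ δ (suc j) l
  pad-δ j zero = refl
  pad-δ j (suc l) = refl

∑-const : ∀ n x → ∑ {n} (λ _ → x) ≡ + n * x
∑-const zero x = refl
∑-const (suc n) x = trans (cong (_+_ x) (∑-const n x)) (e x (+ n))
  where
  e : ∀ x n → x + n * x ≡ (1ℤ + n) * x
  e = solve-∀

module _ {n} (G : Graph (suc n)) (r : Fin (suc n)) where
  private
    N = suc n
    a = arc G

  -- counts the spanning trees, oriented towards r, in which i points to j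
  treesVia : Fin N → Fin N → ℤ
  treesVia i j = withRow (δ r) a i 0ℤ (δ j)

  -- Row i is its root weight plus its arcs. For i = r the arcs contribute nothing, since without
  -- the root arc at r nothing reaches the root; for other i the root weight is zero.
  trees-row : ∀ i → trees G r ≡ δ r i * trees G r + ∑ λ j → a i j * treesVia i j
  trees-row i = trans (sym (withRow-self (δ r) a i)) (trans (withRow-lin (δ r) a i (δ r i) 1ℤ {1ℤ} {0ℤ} {δ r i} {λ _ → 0ℤ} {a i} (e₁ (δ r i)) (λ l → e₂ (δ r i) (a i l)))
    (cong₂ _+_ (rootRow i) (trans (ℤP.*-identityˡ (withRow (δ r) a i 0ℤ (a i)))
      (linear-expand (withRow (δ r) a i 0ℤ) (withRow-cong (δ r) a i refl) (λ x y → withRow-lin (δ r) a i x y (e₃ x y)) (a i)))))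
    where
    e₁ : ∀ x → x ≡ x * 1ℤ + 1ℤ * 0ℤ
    e₁ = solve-∀
    e₂ : ∀ x y → y ≡ x * 0ℤ + 1ℤ * y
    e₂ = solve-∀
    e₃ : ∀ x y → 0ℤ ≡ x * 0ℤ + y * 0ℤ
    e₃ = solve-∀
    e₄ : ∀ x y → 1ℤ * x + 1ℤ * y ≡ x + y
    e₄ = solve-∀
    zeroRoots : ∀ k → σ[_] (δ r) a r 0ℤ k ≡ 0ℤ
    zeroRoots k with k ≟ r
    ... | yes _ = refl
    ... | no k≢r = δ-≢ (k≢r ∘ sym)
    rootRow : ∀ i → δ r i * withRow (δ r) a i 1ℤ (λ _ → 0ℤ) ≡ δ r i * trees G r
    rootRow i with r ≟ i
    ... | no _ = refl
    ... | yes refl = cong (1ℤ *_) (sym (trans (sym (withRow-self (δ r) a r)) (trans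
            (withRow-lin (δ r) a r 1ℤ 1ℤ {1ℤ} {0ℤ} {δ r r} {λ _ → 0ℤ} {a r} (δ-refl r) (λ l → e₅ (a r l)))
            (trans (e₄ (withRow (δ r) a r 1ℤ (λ _ → 0ℤ)) (withRow (δ r) a r 0ℤ (a r)))
            (trans (cong (_+_ (withRow (δ r) a r 1ℤ (λ _ → 0ℤ)))
                     (D-closed N {w = w[_] (δ r) a r (a r)} (λ _ → true) {zero} refl (λ k _ → zeroRoots k) λ _ _ _ ()))
                   (ℤP.+-identityʳ (withRow (δ r) a r 1ℤ (λ _ → 0ℤ))))))))
      where
      e₅ : ∀ x → x ≡ 1ℤ * 0ℤ + 1ℤ * x
      e₅ = solve-∀

  -- In a tree oriented towards r each of the n other vertices has exactly one outgoing arc.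
  trees-arcs : ∑ (λ i → ∑ λ j → a i j * treesVia i j) ≡ + n * trees G r
  trees-arcs = trans (∑-cong λ i → trans (e₁ (δ r i) (trees G r) (∑ λ j → a i j * treesVia i j)) (cong (λ z → z + - 1ℤ * (δ r i * trees G r)) (sym (trees-row i))))
    (trans (∑-distrib-+ (λ _ → trees G r) (λ i → - 1ℤ * (δ r i * trees G r)))
    (trans (cong₂ _+_ (∑-const N (trees G r)) (trans (∑-* (- 1ℤ) (λ i → δ r i * trees G r)) (cong (- 1ℤ *_) (∑-δ r (λ _ → trees G r)))))
      (e₂ (+ n) (trees G r))))
    where
    e₁ : ∀ d x s → s ≡ d * x + s + - 1ℤ * (d * x)
    e₁ = solve-∀
    e₂ : ∀ n x → (1ℤ + n) * x + - 1ℤ * x ≡ n * x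
    e₂ = solve-∀

  -- An oriented tree uses the edge from i to j, from j to i, or not at all. The edge sits in two
  -- rows, which are treated one after the other; the leftover term with both orientations is a
  -- two-cycle without exit and vanishes.
  trees-delete : ∀ i j → adj G i j ≡ true → trees G r ≡ trees (delete G i j) r + treesVia i j + treesVia j i
  trees-delete i j e = trans step₁ (trans (cong (λ z → 1ℤ * z + 1ℤ * treesVia i j) step₂)
      (trans (e₁ (trees H r) Q (treesVia i j)) (cong (λ z → trees H r + treesVia i j + z) (sym step₃))))
    where
    H = delete G i j
    b = arc H
    i≢j = adj-≢ G e
    e₁ : ∀ x q y → 1ℤ * (1ℤ * x + 1ℤ * q) + 1ℤ * y ≡ x + y + q
    e₁ = solve-∀
    e₂ : ∀ x → x ≡ 1ℤ * x + 1ℤ * 0ℤ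
    e₂ = solve-∀
    e₃ : ∀ x d → x + (1ℤ * d + 0ℤ) ≡ 1ℤ * x + 1ℤ * d
    e₃ = solve-∀
    e₄ : ∀ x d → x + (0ℤ + 1ℤ * d) ≡ 1ℤ * x + 1ℤ * d
    e₄ = solve-∀
    -- Intermediate weights: the edge is gone from row i but still present in row j.
    z : Weights N
    z k l = if does (k ≟ i) then b i l else a k l
    σ′ : Fin N → ℤ
    σ′ = σ[_] (δ r) a j 0ℤ
    q : Weights N
    q k l = if does (k ≟ j) then δ i l else z k l
    Q = D N σ′ q
    rowᵢ : ∀ l → a i l ≡ 1ℤ * b i l + 1ℤ * δ j l
    rowᵢ l = trans (arc-delete G i j e i l) (trans (cong₂ (λ x y → b i l + (x * δ l j + y * δ l i)) (δ-refl i) (δ-≢ i≢j)) (trans (e₃ (b i l) (δ l j)) (cong (λ d → 1ℤ * b i l + 1ℤ * d) (δ-sym l j))))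
    rowⱼ : ∀ l → a j l ≡ 1ℤ * b j l + 1ℤ * δ i l
    rowⱼ l = trans (arc-delete G i j e j l) (trans (cong₂ (λ x y → b j l + (x * δ l j + y * δ l i)) (δ-≢ (i≢j ∘ sym)) (δ-refl j)) (trans (e₄ (b j l) (δ l i)) (cong (λ d → 1ℤ * b j l + 1ℤ * d) (δ-sym l i))))
    others : ∀ k l → k ≢ i → k ≢ j → a k l ≡ b k l
    others k l k≢i k≢j = trans (arc-delete G i j e k l) (trans (cong₂ (λ x y → b k l + (x * δ l j + y * δ l i)) (δ-≢ k≢i) (δ-≢ k≢j)) (ℤP.+-identityʳ (b k l)))
    step₁ : trees G r ≡ 1ℤ * D N (δ r) z + 1ℤ * treesVia i j
    step₁ = D-row N i {1ℤ} {1ℤ} {δ r} {σ[_] (δ r) a i 0ℤ} {δ r} {z} {w[_] (δ r) a i (δ j)} {a} (rowComb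
      (trans (e₂ (δ r i)) (cong (λ x → 1ℤ * δ r i + 1ℤ * x) (sym (cong (λ b → if b then 0ℤ else δ r i) (dec-true (i ≟ i) refl)))))
      (λ l → trans (rowᵢ l) (sym (cong₂ (λ x y → 1ℤ * x + 1ℤ * y) (cong (λ t → if t then b i l else a i l) (dec-true (i ≟ i) refl)) (cong (λ t → if t then δ j l else a i l) (dec-true (i ≟ i) refl)))))
      (λ _ _ → refl) (λ k k≢i → cong (λ t → if t then 0ℤ else δ r k) (dec-false (k ≟ i) k≢i))
      (λ k l k≢i → cong (λ t → if t then b i l else a k l) (dec-false (k ≟ i) k≢i))
      (λ k l k≢i → cong (λ t → if t then δ j l else a k l) (dec-false (k ≟ i) k≢i)))
    z-j : ∀ l → z j l ≡ a j l
    z-j l = cong (λ t → if t then b i l else a j l) (dec-false (j ≟ i) (i≢j ∘ sym))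
    step₂ : D N (δ r) z ≡ 1ℤ * trees H r + 1ℤ * Q
    step₂ = D-row N j {1ℤ} {1ℤ} {δ r} {σ′} {δ r} {b} {q} {z} (rowComb
      (trans (e₂ (δ r j)) (cong (λ x → 1ℤ * δ r j + 1ℤ * x) (sym (cong (λ b → if b then 0ℤ else δ r j) (dec-true (j ≟ j) refl)))))
      (λ l → trans (z-j l) (trans (rowⱼ l) (cong (λ x → 1ℤ * b j l + 1ℤ * x) (sym (cong (λ t → if t then δ i l else z j l) (dec-true (j ≟ j) refl))))))
      (λ _ _ → refl) (λ k k≢j → cong (λ t → if t then 0ℤ else δ r k) (dec-false (k ≟ j) k≢j))
      zb
      (λ k l k≢j → cong (λ t → if t then δ i l else z k l) (dec-false (k ≟ j) k≢j)))
      where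
      zb : ∀ k l → k ≢ j → b k l ≡ z k l
      zb k l k≢j = go (k ≟ i)
        where
        go : Dec (k ≡ i) → b k l ≡ z k l
        go (yes refl) = sym (cong (λ t → if t then b i l else a i l) (dec-true (i ≟ i) refl))
        go (no k≢i)   = trans (sym (others k l k≢i k≢j)) (sym (cong (λ t → if t then b i l else a k l) (dec-false (k ≟ i) k≢i)))
    σ″ : Fin N → ℤ
    σ″ = σ[_] σ′ a i 0ℤ
    q′ : Weights N
    q′ k l = if does (k ≟ i) then δ j l else w[_] (δ r) a j (δ i) k l
    two-cycle : D N σ″ q′ ≡ 0ℤ
    two-cycle = D-closed N (λ k → does (k ≟ i) ∨ does (k ≟ j)) {i} (cong (_∨ does (i ≟ j)) (dec-true (i ≟ i) refl)) noRoot noExit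
      where
      noRoot : ∀ k → (does (k ≟ i) ∨ does (k ≟ j)) ≡ true → σ″ k ≡ 0ℤ
      noRoot k h with k ≟ i | k ≟ j
      ... | yes _ | _ = refl
      ... | no _ | yes _ = refl
      noExit : ∀ k l → (does (k ≟ i) ∨ does (k ≟ j)) ≡ true → (does (l ≟ i) ∨ does (l ≟ j)) ≡ false → q′ k l ≡ 0ℤ
      noExit k l h h′ with k ≟ i | k ≟ j | l ≟ i | l ≟ j
      ... | yes _ | _ | no _ | no l≢j = δ-≢ (l≢j ∘ sym)
      ... | no _ | yes _ | no l≢i | no _ = δ-≢ (l≢i ∘ sym)
    step₃ : treesVia j i ≡ Q
    step₃ = trans (D-row N i {1ℤ} {1ℤ} {σ′} {σ″} {σ′} {q} {q′} {w[_] (δ r) a j (δ i)} (rowComb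
        (trans (e₂ (σ′ i)) (cong (λ x → 1ℤ * σ′ i + 1ℤ * x) (sym (cong (λ b → if b then 0ℤ else σ′ i) (dec-true (i ≟ i) refl)))))
        (λ l → trans (cong (λ t → if t then δ i l else a i l) (dec-false (i ≟ j) i≢j)) (trans (rowᵢ l)
          (sym (cong₂ (λ x y → 1ℤ * x + 1ℤ * y) (trans (cong (λ t → if t then δ i l else z i l) (dec-false (i ≟ j) i≢j)) (cong (λ t → if t then b i l else a i l) (dec-true (i ≟ i) refl)))
            (cong (λ t → if t then δ j l else w[_] (δ r) a j (δ i) i l) (dec-true (i ≟ i) refl))))))
        (λ _ _ → refl) (λ k k≢i → cong (λ t → if t then 0ℤ else σ′ k) (dec-false (k ≟ i) k≢i))
        (λ k l k≢i → cong (λ x → if does (k ≟ j) then δ i l else x) (cong (λ t → if t then b i l else a k l) (dec-false (k ≟ i) k≢i)))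
        (λ k l k≢i → cong (λ t → if t then δ j l else w[_] (δ r) a j (δ i) k l) (dec-false (k ≟ i) k≢i))))
      (trans (cong (λ x → 1ℤ * Q + 1ℤ * x) two-cycle) (sym (e₂ Q)))

  -- Each spanning tree omits all but n of the edges.
  trees-euler : ∀ s → degSum G ≡ + 2 * (+ n + s) →
    ∑ (λ i → ∑ λ j → a i j * trees (delete G i j) r) ≡ + 2 * s * trees G r
  trees-euler s h = trans (∑-cong λ i → ∑-cong λ j → term i j)
    (trans (∑-cong λ i → trans (∑-distrib-+ (λ j → t * a i j) (λ j → - 1ℤ * (a i j * treesVia i j) + - 1ℤ * (a j i * treesVia j i)))
        (cong₂ _+_ (∑-* t (a i)) (∑-lin (- 1ℤ) (- 1ℤ) (λ j → a i j * treesVia i j) (λ j → a j i * treesVia j i))))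
    (trans (∑-distrib-+ (λ i → t * deg G i) (λ i → - 1ℤ * ∑ (λ j → a i j * treesVia i j) + - 1ℤ * ∑ (λ j → a j i * treesVia j i)))
    (trans (cong₂ _+_ (trans (∑-* t (deg G)) (cong (t *_) h))
      (trans (∑-lin (- 1ℤ) (- 1ℤ) (λ i → ∑ (λ j → a i j * treesVia i j)) (λ i → ∑ (λ j → a j i * treesVia j i)))
        (cong₂ (λ x y → - 1ℤ * x + - 1ℤ * y) trees-arcs (trans (∑-comm (λ i j → a j i * treesVia j i)) trees-arcs))))
      (e₂ t (+ n) s))))
    where
    t = trees G r
    e₁ : ∀ x y z t → t ≡ x + y + z → 1ℤ * x ≡ t * 1ℤ + (- 1ℤ * (1ℤ * y) + - 1ℤ * (1ℤ * z))
    e₁ x y z t refl = e x y z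
      where
      e : ∀ x y z → 1ℤ * x ≡ (x + y + z) * 1ℤ + (- 1ℤ * (1ℤ * y) + - 1ℤ * (1ℤ * z))
      e = solve-∀
    e₂ : ∀ t n s → t * (+ 2 * (n + s)) + (- 1ℤ * (n * t) + - 1ℤ * (n * t)) ≡ + 2 * s * t
    e₂ = solve-∀
    e₃ : ∀ t → 0ℤ ≡ t * 0ℤ + 0ℤ
    e₃ = solve-∀
    term : ∀ i j → a i j * trees (delete G i j) r ≡ t * a i j + (- 1ℤ * (a i j * treesVia i j) + - 1ℤ * (a j i * treesVia j i))
    term i j = trans (go (adj G i j) refl) (cong (λ x → t * a i j + (- 1ℤ * (a i j * treesVia i j) + - 1ℤ * (x * treesVia j i))) (arc-sym G i j))
      where
      go : ∀ c → adj G i j ≡ c → a i j * trees (delete G i j) r ≡ t * a i j + (- 1ℤ * (a i j * treesVia i j) + - 1ℤ * (a i j * treesVia j i))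
      go true  eq = subst (λ x → x * trees (delete G i j) r ≡ t * x + (- 1ℤ * (x * treesVia i j) + - 1ℤ * (x * treesVia j i))) (sym (cong ⟦_⟧ eq))
                      (e₁ (trees (delete G i j) r) (treesVia i j) (treesVia j i) t (trees-delete i j eq))
      go false eq = subst (λ x → x * trees (delete G i j) r ≡ t * x + (- 1ℤ * (x * treesVia i j) + - 1ℤ * (x * treesVia j i))) (sym (cong ⟦_⟧ eq)) (e₃ t)

-- Spanning trees of triangle-free graphs with one or two independent cycles

TriFree : ∀ {n} → Graph n → Set
TriFree G = ∀ i j k → adj G i j ≡ true → adj G j k ≡ true → adj G k i ≡ true → ⊥

∑≡0 : ∀ {n} {f : Fin n → ℤ} → (∀ i → 0ℤ ≤ f i) → ∑ f ≡ 0ℤ → ∀ i → f i ≡ 0ℤ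
∑≡0 {f = f} h e i = ℤP.≤-antisym (subst (f i ≤_) e (term≤∑ h i)) (h i)

0≤closed₃-term : ∀ {n} (G : Graph n) i j k → 0ℤ ≤ arc G i j * (arc G j k * arc G k i)
0≤closed₃-term G i j k = 0≤* (0≤arc G i j) (0≤* (0≤arc G j k) (0≤arc G k i))

closed₃≡0⇒TriFree : ∀ {n} (G : Graph n) → closed₃ G ≡ 0ℤ → TriFree G
closed₃≡0⇒TriFree G h i j k p q r = case trans (sym (cong₂ _*_ (cong ⟦_⟧ p) (cong₂ _*_ (cong ⟦_⟧ q) (cong ⟦_⟧ r))))
    (∑≡0 (0≤closed₃-term G i j) (∑≡0 (λ j → 0≤∑ (0≤closed₃-term G i j)) (∑≡0 (λ i → 0≤∑ λ j → 0≤∑ (0≤closed₃-term G i j)) h i) j) k) of λ ()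

Conn-mono : ∀ {n} {G H : Graph n} → (∀ {k l} → adj G k l ≡ true → adj H k l ≡ true) → Conn G → Conn H
Conn-mono G⊆H conn S closed = conn S λ i j e → closed i j (G⊆H e)

delete-mono : ∀ {n} (G H : Graph n) i j → (∀ {k l} → adj G k l ≡ true → adj H k l ≡ true) →
              ∀ {k l} → adj (delete G i j) k l ≡ true → adj (delete H i j) k l ≡ true
delete-mono G H i j G⊆H {k} {l} e with adj G k l in eq
... | true = trans (cong (_∧ not (sameEdge i j k l)) (G⊆H eq)) e

NonBridge : ∀ {n} → Graph n → Fin n → Fin n → Set
NonBridge G i j = adj G i j ≡ true × Conn (delete G i j)

NonBridge-sym : ∀ {n} (G : Graph n) {i j} → NonBridge G i j → NonBridge G j i
NonBridge-sym G {i} {j} (e , c) = trans (Graph.sym G j i) e , Conn-mono {G = delete G i j} {delete G j i} (λ {k} {l} h →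
  trans (cong (λ b → adj G k l ∧ not b) (BoolP.∨-comm (does (k ≟ j) ∧ does (l ≟ i)) _)) h) c

infix 4 _#_
_#_ : ∀ {n} → Fin n × Fin n → Fin n × Fin n → Set
(i , j) # (k , l) = ¬ (k ≡ i × l ≡ j) × ¬ (k ≡ j × l ≡ i)

sumOver : ∀ {n} → Weights n → List (Fin n × Fin n) → ℤ
sumOver F []             = 0ℤ
sumOver F ((i , j) ∷ ps) = F i j + F j i + sumOver F ps

module _ {n} (i j : Fin n) where
  offEdge : Fin n → Fin n → ℤ
  offEdge k l = 1ℤ - (δ k i * δ l j + δ k j * δ l i)

  offEdge-# : ∀ {k l} → (i , j) # (k , l) → offEdge k l ≡ 1ℤ
  offEdge-# {k} {l} (p , q) with k ≟ i | l ≟ j | k ≟ j | l ≟ i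
  ... | yes e | yes e′ | _ | _ = contradiction (e , e′) p
  ... | _ | _ | yes e | yes e′ = contradiction (e , e′) q
  ... | yes _ | no _ | yes _ | no _ = refl
  ... | yes _ | no _ | no _ | yes _ = refl
  ... | yes _ | no _ | no _ | no _ = refl
  ... | no _ | yes _ | yes _ | no _ = refl
  ... | no _ | no _ | yes _ | no _ = refl
  ... | no _ | yes _ | no _ | yes _ = refl
  ... | no _ | yes _ | no _ | no _ = refl
  ... | no _ | no _ | no _ | yes _ = refl
  ... | no _ | no _ | no _ | no _ = refl

  0≤offEdge : i ≢ j → ∀ k l → 0ℤ ≤ offEdge k l
  0≤offEdge i≢j k l with k ≟ i | l ≟ j | k ≟ j | l ≟ i
  ... | yes refl | _ | yes refl | _ = contradiction refl i≢j
  ... | _ | yes refl | _ | yes refl = contradiction refl i≢j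
  ... | yes _ | yes _ | no _ | no _ = ℤP.≤-refl
  ... | no _ | no _ | yes _ | yes _ = ℤP.≤-refl
  ... | yes _ | no _ | no _ | yes _ = 0≤1
  ... | yes _ | no _ | no _ | no _ = 0≤1
  ... | no _ | yes _ | yes _ | no _ = 0≤1
  ... | no _ | no _ | yes _ | no _ = 0≤1
  ... | no _ | yes _ | no _ | no _ = 0≤1
  ... | no _ | no _ | no _ | yes _ = 0≤1
  ... | no _ | no _ | no _ | no _ = 0≤1

  ∑∑-edge : ∀ (F : Weights n) → ∑ (λ k → ∑ λ l → (δ k i * δ l j + δ k j * δ l i) * F k l) ≡ F i j + F j i
  ∑∑-edge F = trans (∑-cong λ k → trans (∑-cong λ l → e (δ k i) (δ l j) (δ k j) (δ l i) (F k l))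
      (trans (∑-lin (δ k i) (δ k j) (λ l → δ l j * F k l) (λ l → δ l i * F k l)) (cong₂ (λ x y → δ k i * x + δ k j * y) (∑-δ′ j (F k)) (∑-δ′ i (F k)))))
    (trans (∑-distrib-+ (λ k → δ k i * F k j) (λ k → δ k j * F k i)) (cong₂ _+_ (∑-δ′ i (λ k → F k j)) (∑-δ′ j (λ k → F k i))))
    where
    e : ∀ a b c d f → (a * b + c * d) * f ≡ a * (b * f) + c * (d * f)
    e = solve-∀

  ∑∑-split : ∀ (F : Weights n) → ∑ (λ k → ∑ (F k)) ≡ F i j + F j i + ∑ λ k → ∑ λ l → offEdge k l * F k l
  ∑∑-split F = trans (∑-cong λ k → trans (∑-cong λ l → e (δ k i * δ l j + δ k j * δ l i) (F k l)) (∑-distrib-+ (λ l → (δ k i * δ l j + δ k j * δ l i) * F k l) (λ l → offEdge k l * F k l)))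
    (trans (∑-distrib-+ (λ k → ∑ λ l → (δ k i * δ l j + δ k j * δ l i) * F k l) (λ k → ∑ λ l → offEdge k l * F k l))
      (cong (_+ ∑ (λ k → ∑ λ l → offEdge k l * F k l)) (∑∑-edge F)))
    where
    e : ∀ x f → f ≡ x * f + (1ℤ - x) * f
    e = solve-∀

-- Distinct edges occupy disjoint pairs of entries. One edge is split off from the double sum, and
-- multiplication by `offEdge` erases its two entries before the induction continues.
sumOver≤∑∑ : ∀ {n} {F : Weights n} → (∀ k l → 0ℤ ≤ F k l) → ∀ ps → AllPairs _#_ ps → All (λ p → proj₁ p ≢ proj₂ p) ps →
             sumOver F ps ≤ ∑ λ k → ∑ (F k)
sumOver≤∑∑ h [] _ _ = 0≤∑ λ k → 0≤∑ (h k)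
sumOver≤∑∑ {n} {F} h ((i , j) ∷ ps) (p ∷ q) (i≢j ∷ r) = subst (F i j + F j i + sumOver F ps ≤_) (sym (∑∑-split i j F))
  (ℤP.+-monoʳ-≤ (F i j + F j i) (subst (_≤ ∑ (λ k → ∑ (F′ k))) (same ps p) (sumOver≤∑∑ (λ k l → 0≤* (0≤offEdge i j i≢j k l) (h k l)) ps q r)))
  where
  F′ : Weights n
  F′ k l = offEdge i j k l * F k l
  unit : ∀ {k l} → (i , j) # (k , l) → F′ k l ≡ F k l
  unit {k} {l} d = trans (cong (_* F k l) (offEdge-# i j d)) (ℤP.*-identityˡ (F k l))
  same : ∀ ps → All ((i , j) #_) ps → sumOver F′ ps ≡ sumOver F ps
  same [] _ = refl
  same ((k , l) ∷ ps) ((d , d′) ∷ ds) = cong₂ _+_ (cong₂ _+_ (unit (d , d′)) (unit ((λ (e , e′) → d′ (e′ , e)) , λ (e , e′) → d (e′ , e)))) (same ps ds)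

degSum-delete : ∀ {n} (G : Graph n) i j → adj G i j ≡ true → degSum G ≡ degSum (delete G i j) + + 2
degSum-delete G i j e = trans (∑-cong λ k → trans (∑-cong λ l → trans (arc-delete G i j e k l) (cong (_+_ (arc (delete G i j) k l)) (sym (ℤP.*-identityʳ (δ k i * δ l j + δ k j * δ l i)))))
    (∑-distrib-+ (arc (delete G i j) k) (λ l → (δ k i * δ l j + δ k j * δ l i) * 1ℤ)))
  (trans (∑-distrib-+ (deg (delete G i j)) (λ k → ∑ λ l → (δ k i * δ l j + δ k j * δ l i) * 1ℤ)) (cong (_+_ (degSum (delete G i j))) (∑∑-edge i j (λ _ _ → 1ℤ))))

TriFree-delete : ∀ {n} (G : Graph n) i j → TriFree G → TriFree (delete G i j)
TriFree-delete G i j tf a b c p q r = tf a b c (delete-⊆ G i j p) (delete-⊆ G i j q) (delete-⊆ G i j r)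

record FourNonBridges {n} (G : Graph n) : Set where
  constructor four
  field
    p₁ p₂ p₃ p₄ : Fin n × Fin n
    distinct    : AllPairs _#_ (p₁ ∷ p₂ ∷ p₃ ∷ p₄ ∷ [])
    nonBridges  : All (λ (i , j) → NonBridge G i j) (p₁ ∷ p₂ ∷ p₃ ∷ p₄ ∷ [])

-- Four edges of a cycle through the non-bridge xy: xy itself and the first
-- three steps from y towards x along a rank function of G − xy.
module _ {n} (G : Graph n) (tf : TriFree G) {x y : Fin n} (xy : adj G x y ≡ true) (conn : Conn (delete G x y)) where
  private
    G₁ = delete G x y
    h : Fin n → ℕ
    h = proj₁ (rank G₁ x conn)
    next : ∀ i → i ≢ x → ∃ λ j → h j ℕ.< h i × adj G₁ i j ≡ true
    next = proj₂ (rank G₁ x conn)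

    -- A rank-decreasing walk from w to x stays strictly below u in rank, so it avoids the edge uv.
    belowJoined : ∀ {u v} → h v ℕ.< h u → (S : Fin n → Bool) → (∀ i j → adj (delete G u v) i j ≡ true → S i ≡ S j) →
             ∀ k w → h w ℕ.≤ k → h w ℕ.≤ h v → S w ≡ S x
    belowJoined {u} {v} lt S closed k w w≤k w≤v with w ≟ x
    ... | yes refl = refl
    ... | no w≢x with next w w≢x
    belowJoined {u} {v} lt S closed zero w w≤k w≤v | no w≢x | w′ , lt′ , e = contradiction (ℕP.≤-trans lt′ w≤k) λ ()
    belowJoined {u} {v} lt S closed (suc k) w w≤k w≤v | no w≢x | w′ , lt′ , e =
      trans (closed w w′ (delete-intro G u v (delete-⊆ G x y e)
          (λ { (refl , _) → ℕP.<⇒≱ lt w≤v })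
          (λ { (_ , refl) → ℕP.<⇒≱ lt (ℕP.≤-trans (ℕP.<⇒≤ lt′) w≤v) })))
        (belowJoined lt S closed k w′ (ℕP.≤-pred (ℕP.≤-trans lt′ w≤k)) (ℕP.≤-trans (ℕP.<⇒≤ lt′) w≤v))

    -- Removing a rank-decreasing edge uv that is joined to y keeps G connected.
    nonBridge : ∀ {u v} → h v ℕ.< h u → adj G₁ u v ≡ true →
      (∀ (S : Fin n → Bool) → (∀ i j → adj (delete G u v) i j ≡ true → S i ≡ S j) → S y ≡ S u) → NonBridge G u v
    nonBridge {u} {v} lt uv join = delete-⊆ G x y uv , λ S closed → conn S λ i j e → closed₁ S closed i j e
      where
      module _ (S : Fin n → Bool) (closed : ∀ i j → adj (delete G u v) i j ≡ true → S i ≡ S j) where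
        x-y : S x ≡ S y
        x-y = closed x y (delete-intro G u v xy
          (λ { (refl , refl) → case trans (sym uv) (delete-∌ G x y) of λ () })
          (λ { (refl , refl) → case trans (sym uv) (delete-∌′ G x y) of λ () }))
        u-v : S u ≡ S v
        u-v = trans (sym (join S closed)) (trans (sym x-y) (sym (belowJoined lt S closed (h v) v ℕP.≤-refl ℕP.≤-refl)))
        closed₁ : ∀ i j → adj G₁ i j ≡ true → S i ≡ S j
        closed₁ i j e with (i ≟ u) ×-dec (j ≟ v) | (i ≟ v) ×-dec (j ≟ u)
        ... | yes (refl , refl) | _ = u-v
        ... | no _ | yes (refl , refl) = sym u-v
        ... | no p | no q = closed i j (delete-intro G u v (delete-⊆ G x y e) p q)

    y≢x : y ≢ x
    y≢x = adj-≢ G xy ∘ sym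
    q₁ = proj₁ (next y y≢x)
    h₁ = proj₁ (proj₂ (next y y≢x))
    e₁ = proj₂ (proj₂ (next y y≢x))
    q₁≢x : q₁ ≢ x
    q₁≢x eq = case trans (sym (subst (λ z → adj G₁ y z ≡ true) eq e₁)) (delete-∌′ G x y) of λ ()
    q₂ = proj₁ (next q₁ q₁≢x)
    h₂ = proj₁ (proj₂ (next q₁ q₁≢x))
    e₂ = proj₂ (proj₂ (next q₁ q₁≢x))
    -- Here triangle-freeness enters: q₂ = x would make x, y, q₁ a triangle. So the walk has a third
    -- step.
    q₂≢x : q₂ ≢ x
    q₂≢x eq = tf x y q₁ xy (delete-⊆ G x y e₁) (delete-⊆ G x y (subst (λ z → adj G₁ q₁ z ≡ true) eq e₂))
    q₃ = proj₁ (next q₂ q₂≢x)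
    h₃ = proj₁ (proj₂ (next q₂ q₂≢x))
    e₃ = proj₂ (proj₂ (next q₂ q₂≢x))

    fromXY : ∀ {k l} → adj G₁ k l ≡ true → (x , y) # (k , l)
    fromXY e = (λ { (refl , refl) → case trans (sym e) (delete-∌ G x y) of λ () })
             , (λ { (refl , refl) → case trans (sym e) (delete-∌′ G x y) of λ () })

    lower : ∀ {u v k l} → h k ℕ.< h u → h l ℕ.< h u → (u , v) # (k , l)
    lower a b = (λ { (refl , _) → ℕP.<-irrefl refl a }) , (λ { (_ , refl) → ℕP.<-irrefl refl b })

  cycleEdges : FourNonBridges G
  cycleEdges = four (x , y) (y , q₁) (q₁ , q₂) (q₂ , q₃)
    ((fromXY e₁ ∷ fromXY e₂ ∷ fromXY e₃ ∷ [])
      ∷ (lower h₁ (ℕP.<-trans h₂ h₁) ∷ lower (ℕP.<-trans h₂ h₁) (ℕP.<-trans h₃ (ℕP.<-trans h₂ h₁)) ∷ [])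
      ∷ (lower h₂ (ℕP.<-trans h₃ h₂) ∷ []) ∷ [] ∷ [])
    ((xy , conn)
      ∷ nonBridge h₁ e₁ (λ S _ → refl)
      ∷ nonBridge h₂ e₂ (λ S closed → step₁ S closed h₂)
      ∷ nonBridge h₃ e₃ (λ S closed → trans
          (closed y q₁ (delete-intro G q₂ q₃ (delete-⊆ G x y e₁)
            (λ (eq , _) → ℕP.<-irrefl (cong h (sym eq)) (ℕP.<-trans h₂ h₁))
            (λ (eq , _) → ℕP.<-irrefl (cong h (sym eq)) (ℕP.<-trans h₃ (ℕP.<-trans h₂ h₁)))))
          (closed q₁ q₂ (delete-intro G q₂ q₃ (delete-⊆ G x y e₂)
            (λ (eq , _) → ℕP.<-irrefl (cong h (sym eq)) h₂)
            (λ (eq , _) → ℕP.<-irrefl (cong h (sym eq)) (ℕP.<-trans h₃ h₂)))))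
      ∷ [])
    where
    step₁ : ∀ (S : Fin n → Bool) → (∀ i j → adj (delete G q₁ q₂) i j ≡ true → S i ≡ S j) → h q₂ ℕ.< h q₁ → S y ≡ S q₁
    step₁ S closed lt = closed y q₁ (delete-intro G q₁ q₂ (delete-⊆ G x y e₁)
      (λ (eq , _) → ℕP.<-irrefl (cong h (sym eq)) h₁)
      (λ (eq , _) → ℕP.<-irrefl (cong h (sym eq)) (ℕP.<-trans lt h₁)))

positiveTerm : ∀ {n} {f : Fin n → ℤ} → (∀ i → 0ℤ ≤ f i) → 1ℤ ≤ ∑ f → ∃ λ i → 1ℤ ≤ f i
positiveTerm {zero} h (+≤+ ())
positiveTerm {suc n} {f} h p with 1ℤ ℤP.≤? f zero
... | yes q = zero , q
... | no ¬q = let i , r = positiveTerm (h ∘ suc) (subst (1ℤ ≤_) (trans (cong (_+ ∑ (f ∘ suc)) f₀) (ℤP.+-identityˡ (∑ (f ∘ suc)))) p) in suc i , r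
  where
  f₀ : f zero ≡ 0ℤ
  f₀ with f zero in eq
  ... | + zero  = refl
  ... | + suc k = contradiction (+≤+ (s≤s z≤n)) ¬q
  ... | -[1+ k ] = case subst (0ℤ ≤_) eq (h zero) of λ ()

1≤*⇒ : ∀ {a b} → 0ℤ ≤ a → 0ℤ ≤ b → 1ℤ ≤ a * b → 1ℤ ≤ b
1≤*⇒ {+ a} {+ zero} _ _ p = case subst (1ℤ ≤_) (ℤP.*-zeroʳ (+ a)) p of λ { (+≤+ ()) }
1≤*⇒ {+ a} {+ suc b} _ _ p = +≤+ (s≤s z≤n)

1≤⇒≢0 : ∀ {a} → 1ℤ ≤ a → a ≢ 0ℤ
1≤⇒≢0 (+≤+ ()) refl

module _ {n} (G : Graph (suc n)) (r : Fin (suc n)) where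
  private
    F : Weights (suc n)
    F i j = arc G i j * trees (delete G i j) r
    0≤F : ∀ i j → 0ℤ ≤ F i j
    0≤F i j = 0≤* (0≤arc G i j) (0≤trees (delete G i j) r)

  -- The right side of `trees-euler` is positive, so deleting some edge leaves a spanning tree and
  -- hence a connected graph.
  findNonBridge : ∀ s → degSum G ≡ + 2 * (+ n + + suc s) → Conn G → ∃ λ x → ∃ λ y → NonBridge G x y
  findNonBridge s h conn =
    let x , p = positiveTerm (λ i → 0≤∑ (0≤F i)) (subst (1ℤ ≤_) (sym (trees-euler G r (+ suc s) h)) (1≤* {+ 2 * + suc s} {trees G r} (+≤+ (s≤s z≤n)) (Conn⇒trees G r conn)))
        y , q = positiveTerm (0≤F x) p
    in x , y , edge x y q , trees≢0⇒Conn (delete G x y) r (1≤⇒≢0 (1≤*⇒ (0≤arc G x y) (0≤trees (delete G x y) r) q))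
    where
    edge : ∀ x y → 1ℤ ≤ F x y → adj G x y ≡ true
    edge x y q with adj G x y
    ... | true = refl
    ... | false = case q of λ { (+≤+ ()) }

  -- The double sum of `trees-euler` meets each edge in both orientations, so every listed
  -- non-bridge accounts for at least 2c of it.
  trees-lower : ∀ s c → degSum G ≡ + 2 * (+ n + s) → ∀ ps → AllPairs _#_ ps → All (λ (i , j) → NonBridge G i j) ps →
    (∀ {i j} → NonBridge G i j → c ≤ trees (delete G i j) r) → sumOver (λ _ _ → c) ps ≤ + 2 * s * trees G r
  trees-lower s c h ps distinct nbs bound = ℤP.≤-trans (each ps nbs)
    (subst (sumOver F ps ≤_) (trees-euler G r s h) (sumOver≤∑∑ 0≤F ps distinct (All.map (λ nb → adj-≢ G (proj₁ nb)) nbs)))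
    where
    entry : ∀ {i j} → NonBridge G i j → c ≤ F i j
    entry {i} {j} nb = subst (c ≤_) (sym (trans (cong (_* trees (delete G i j) r) (cong ⟦_⟧ (proj₁ nb))) (ℤP.*-identityˡ (trees (delete G i j) r)))) (bound nb)
    each : ∀ ps → All (λ (i , j) → NonBridge G i j) ps → sumOver (λ _ _ → c) ps ≤ sumOver F ps
    each [] [] = ℤP.≤-refl
    each ((i , j) ∷ ps) (nb ∷ nbs) = ℤP.+-mono-≤ (ℤP.+-mono-≤ (entry nb) (entry (NonBridge-sym G nb))) (each ps nbs)

private
  cancel₂ : ∀ {b} → + 8 ≤ + 2 * + 1 * b → + 4 ≤ b
  cancel₂ {b} h = ℤP.*-cancelˡ-≤-pos (+ 4) b (+ 2) h
  cancel₄ : ∀ {b} → + 40 ≤ + 2 * + 2 * b → + 10 ≤ b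
  cancel₄ {b} h = ℤP.*-cancelˡ-≤-pos (+ 10) b (+ 4) h

-- Four non-bridges each leave at least one tree, so 2·4 ≤ 2·1·τ for the number τ of trees.
trees-unicyclic : ∀ {n} (G : Graph (suc n)) → TriFree G → Conn G → degSum G ≡ + 2 * (+ n + + 1) → ∀ r → + 4 ≤ trees G r
trees-unicyclic G tf conn h r = fromFour (let x , y , xy , c = findNonBridge G r 0 h conn in cycleEdges G tf {x} {y} xy c)
  where
  fromFour : FourNonBridges G → + 4 ≤ trees G r
  fromFour (four p₁ p₂ p₃ p₄ distinct nbs) = cancel₂ (trees-lower G r (+ 1) 1ℤ h (p₁ ∷ p₂ ∷ p₃ ∷ p₄ ∷ []) distinct nbs
    λ {i} {j} nb → Conn⇒trees (delete G i j) r (proj₂ nb))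

bicyclic-delete : ∀ {n} (G : Graph (suc n)) → degSum G ≡ + 2 * (+ n + + 2) →
                  ∀ {i j} → adj G i j ≡ true → degSum (delete G i j) ≡ + 2 * (+ n + + 1)
bicyclic-delete {n} G h {i} {j} e = +-cancelʳ (+ 2) (degSum (delete G i j)) (+ 2 * (+ n + + 1)) (trans (sym (degSum-delete G i j e)) (trans h (ring (+ n))))
  where
  ring : ∀ n → + 2 * (n + + 2) ≡ + 2 * (n + + 1) + + 2
  ring = solve-∀

-- A non-bridge xy and four non-bridges of the graph without it make five, each leaving at least 4
-- trees: 2·5·4 ≤ 2·2·τ. Four edges would give only τ ≥ 8, short of the 9 trees that two triangles
-- have.
trees-bicyclic : ∀ {n} (G : Graph (suc n)) → TriFree G → Conn G → degSum G ≡ + 2 * (+ n + + 2) → ∀ r → + 10 ≤ trees G r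
trees-bicyclic {n} G tf conn h r = fromEdge (findNonBridge G r 1 h conn)
  where
  bound : ∀ {i j} → NonBridge G i j → + 4 ≤ trees (delete G i j) r
  bound {i} {j} (e , k) = trees-unicyclic (delete G i j) (TriFree-delete G i j tf) k (bicyclic-delete G h e) r
  module _ {x y : Fin (suc n)} (xy : NonBridge G x y) where
    apart : ∀ {k l} → adj (delete G x y) k l ≡ true → (x , y) # (k , l)
    apart e = (λ { (refl , refl) → case trans (sym e) (delete-∌ G x y) of λ () })
            , (λ { (refl , refl) → case trans (sym e) (delete-∌′ G x y) of λ () })
    lift : ∀ {i j} → NonBridge (delete G x y) i j → NonBridge G i j
    lift {i} {j} (e , k) = delete-⊆ G x y e , Conn-mono {G = delete (delete G x y) i j} {delete G i j} (delete-mono (delete G x y) G i j (delete-⊆ G x y)) k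
    fromFour : FourNonBridges (delete G x y) → + 10 ≤ trees G r
    fromFour (four p₁ p₂ p₃ p₄ distinct nbs) = cancel₄ (trees-lower G r (+ 2) (+ 4) h ((x , y) ∷ p₁ ∷ p₂ ∷ p₃ ∷ p₄ ∷ [])
      (All.map (λ nb → apart (proj₁ nb)) nbs ∷ distinct) (xy ∷ All.map lift nbs) bound)
  fromEdge : (∃ λ x → ∃ λ y → NonBridge G x y) → + 10 ≤ trees G r
  fromEdge (x , y , xy , c) = fromFour (xy , c)
    (let x′ , y′ , xy′ , c′ = findNonBridge (delete G x y) r 0 (bicyclic-delete G h xy) c in cycleEdges (delete G x y) (TriFree-delete G x y tf) {x′} {y′} xy′ c′)

-- Graphs with a distinguished centre, marked by a Boolean predicate

record PGraph : Set₁ where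
  constructor pgraph
  field
    V    : Set
    edge : V → V → Bool
    isC  : V → Bool
open PGraph

infix 4 _≃_
record _≃_ (G H : PGraph) : Set where
  field
    to      : V G → V H
    from    : V H → V G
    to∘from : ∀ v → to (from v) ≡ v
    from∘to : ∀ v → from (to v) ≡ v
    edge-eq : ∀ u v → edge G u v ≡ edge H (to u) (to v)
    isC-eq  : ∀ v → isC G v ≡ isC H (to v)
open _≃_

≃-refl : ∀ {G} → G ≃ G
≃-refl = record { to = λ v → v ; from = λ v → v ; to∘from = λ _ → refl ; from∘to = λ _ → refl
                ; edge-eq = λ _ _ → refl ; isC-eq = λ _ → refl }

≃-sym : ∀ {G H} → G ≃ H → H ≃ G
≃-sym {G} {H} f = record { to = from f ; from = to f ; to∘from = from∘to f ; from∘to = to∘from f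
  ; edge-eq = λ u v → sym (trans (edge-eq f (from f u) (from f v)) (cong₂ (edge H) (to∘from f u) (to∘from f v)))
  ; isC-eq = λ v → sym (trans (isC-eq f (from f v)) (cong (isC H) (to∘from f v))) }

≃-trans : ∀ {G H K} → G ≃ H → H ≃ K → G ≃ K
≃-trans f g = record { to = to g ∘ to f ; from = from f ∘ from g
  ; to∘from = λ v → trans (cong (to g) (to∘from f (from g v))) (to∘from g v)
  ; from∘to = λ v → trans (cong (from f) (from∘to g (to f v))) (from∘to f v)
  ; edge-eq = λ u v → trans (edge-eq f u v) (edge-eq g (to f u) (to f v))
  ; isC-eq = λ v → trans (isC-eq f v) (isC-eq g (to f v)) }

ext : (G : PGraph) → (V G → Bool) → PGraph
ext G N = pgraph (Maybe (V G)) e c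
  where
  e : Maybe (V G) → Maybe (V G) → Bool
  e nothing  nothing  = false
  e nothing  (just v) = N v
  e (just v) nothing  = N v
  e (just u) (just v) = edge G u v
  c : Maybe (V G) → Bool
  c nothing  = false
  c (just v) = isC G v

ext-cong : ∀ {G H N N′} (f : G ≃ H) → (∀ v → N v ≡ N′ (to f v)) → ext G N ≃ ext H N′
ext-cong {G} {H} {N} {N′} f h = record
  { to      = λ { nothing → nothing ; (just v) → just (to f v) }
  ; from    = λ { nothing → nothing ; (just v) → just (from f v) }
  ; to∘from = λ { nothing → refl ; (just v) → cong just (to∘from f v) }
  ; from∘to = λ { nothing → refl ; (just v) → cong just (from∘to f v) }
  ; edge-eq = λ { nothing nothing → refl ; nothing (just v) → h v ; (just v) nothing → h v ; (just u) (just v) → edge-eq f u v }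
  ; isC-eq  = λ { nothing → refl ; (just v) → isC-eq f v } }

data Branch : Set where
  tri  : Branch
  path : ℕ → Branch

size : Branch → ℕ
size tri      = 2
size (path t) = t

isNil : ℕ → Bool
isNil zero    = true
isNil (suc _) = false

isFirst : ∀ {n} → Fin n → Bool
isFirst zero    = true
isFirst (suc _) = false

-- In a path of t vertices, vertex 0 is the far end and vertex t − 1 is joined to the centre.
pathEdge : ∀ {t} → Fin t → Fin t → Bool
pathEdge zero    zero    = false
pathEdge zero    (suc j) = isFirst j
pathEdge (suc i) zero    = isFirst i
pathEdge (suc i) (suc j) = pathEdge i j

pathEnd : ∀ {t} → Fin t → Bool
pathEnd {suc t} zero    = isNil t
pathEnd {suc t} (suc i) = pathEnd i

inner : ∀ β → Fin (size β) → Fin (size β) → Bool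
inner tri      i j = not (does (i ≟ j))
inner (path t) i j = pathEdge i j

touch : ∀ β → Fin (size β) → Bool
touch tri      i = true
touch (path t) i = pathEnd i

-- Since the centre is recognised by the Boolean `isC`, adjacency to it is computed without deciding
-- equality in the vertex type.
attach : Branch → PGraph → PGraph
attach β G = pgraph (Fin (size β) ⊎ V G) e c
  where
  e : Fin (size β) ⊎ V G → Fin (size β) ⊎ V G → Bool
  e (inj₁ i) (inj₁ j) = inner β i j
  e (inj₁ i) (inj₂ v) = touch β i ∧ isC G v
  e (inj₂ v) (inj₁ i) = touch β i ∧ isC G v
  e (inj₂ u) (inj₂ v) = edge G u v
  c : Fin (size β) ⊎ V G → Bool
  c (inj₁ i) = false
  c (inj₂ v) = isC G v

PG : List Branch → PGraph
PG []       = pgraph ⊤ (λ _ _ → false) (λ _ → true)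
PG (β ∷ βs) = attach β (PG βs)

centre : ∀ βs → V (PG βs)
centre []       = tt
centre (β ∷ βs) = inj₂ (centre βs)

isC-centre : ∀ βs → isC (PG βs) (centre βs) ≡ true
isC-centre []       = refl
isC-centre (β ∷ βs) = isC-centre βs

attach-cong : ∀ β {G H} → G ≃ H → attach β G ≃ attach β H
attach-cong β f = record
  { to      = λ { (inj₁ i) → inj₁ i ; (inj₂ v) → inj₂ (to f v) }
  ; from    = λ { (inj₁ i) → inj₁ i ; (inj₂ v) → inj₂ (from f v) }
  ; to∘from = λ { (inj₁ i) → refl ; (inj₂ v) → cong inj₂ (to∘from f v) }
  ; from∘to = λ { (inj₁ i) → refl ; (inj₂ v) → cong inj₂ (from∘to f v) }
  ; edge-eq = λ { (inj₁ i) (inj₁ j) → refl ; (inj₁ i) (inj₂ v) → cong (touch β i ∧_) (isC-eq f v)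
                ; (inj₂ v) (inj₁ i) → cong (touch β i ∧_) (isC-eq f v) ; (inj₂ u) (inj₂ v) → edge-eq f u v }
  ; isC-eq  = λ { (inj₁ i) → refl ; (inj₂ v) → isC-eq f v } }

-- Vertices of a branch have `isC` false, so two branches never see each other and their order is
-- immaterial.
attach-swap : ∀ β γ {G} → attach β (attach γ G) ≃ attach γ (attach β G)
attach-swap β γ {G} = record
  { to      = λ { (inj₁ i) → inj₂ (inj₁ i) ; (inj₂ (inj₁ j)) → inj₁ j ; (inj₂ (inj₂ v)) → inj₂ (inj₂ v) }
  ; from    = λ { (inj₁ i) → inj₂ (inj₁ i) ; (inj₂ (inj₁ j)) → inj₁ j ; (inj₂ (inj₂ v)) → inj₂ (inj₂ v) }
  ; to∘from = λ { (inj₁ i) → refl ; (inj₂ (inj₁ j)) → refl ; (inj₂ (inj₂ v)) → refl }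
  ; from∘to = λ { (inj₁ i) → refl ; (inj₂ (inj₁ j)) → refl ; (inj₂ (inj₂ v)) → refl }
  ; edge-eq = λ { (inj₁ i) (inj₁ i′) → refl
                ; (inj₁ i) (inj₂ (inj₁ j)) → trans (BoolP.∧-zeroʳ (touch β i)) (sym (BoolP.∧-zeroʳ (touch γ j)))
                ; (inj₁ i) (inj₂ (inj₂ v)) → refl
                ; (inj₂ (inj₁ j)) (inj₁ i) → trans (BoolP.∧-zeroʳ (touch β i)) (sym (BoolP.∧-zeroʳ (touch γ j)))
                ; (inj₂ (inj₂ v)) (inj₁ i) → refl
                ; (inj₂ (inj₁ j)) (inj₂ (inj₁ j′)) → refl ; (inj₂ (inj₁ j)) (inj₂ (inj₂ v)) → refl
                ; (inj₂ (inj₂ v)) (inj₂ (inj₁ j)) → refl ; (inj₂ (inj₂ v)) (inj₂ (inj₂ v′)) → refl }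
  ; isC-eq  = λ { (inj₁ i) → refl ; (inj₂ (inj₁ j)) → refl ; (inj₂ (inj₂ v)) → refl } }

PG-perm : ∀ {βs γs} → βs ↭ γs → PG βs ≃ PG γs
PG-perm ListPerm.refl = ≃-refl
PG-perm (prep β p) = attach-cong β (PG-perm p)
PG-perm (swap β γ p) = ≃-trans (attach-swap β γ) (attach-cong γ (attach-cong β (PG-perm p)))
PG-perm (ListPerm.trans p q) = ≃-trans (PG-perm p) (PG-perm q)

tris : List Branch → ℕ
tris []            = 0
tris (tri ∷ βs)    = suc (tris βs)
tris (path t ∷ βs) = tris βs

paths : List Branch → List ℕ
paths []            = []
paths (tri ∷ βs)    = paths βs
paths (path t ∷ βs) = t ∷ paths βs

-- The empty path is a seed: growing it by `ext-path` starts a new path at the centre.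
attach-empty : ∀ {G} → attach (path 0) G ≃ G
attach-empty = record
  { to      = λ { (inj₂ v) → v }
  ; from    = inj₂
  ; to∘from = λ _ → refl
  ; from∘to = λ { (inj₂ v) → refl }
  ; edge-eq = λ { (inj₂ u) (inj₂ v) → refl }
  ; isC-eq  = λ { (inj₂ v) → refl } }

-- where attach (path t) G has to be extended to lengthen the path
tip : ∀ t {G} → V (attach (path t) G) → Bool
tip t     (inj₁ i) = isFirst i
tip t {G} (inj₂ v) = isNil t ∧ isC G v

ext-path : ∀ t {G} → ext (attach (path t) G) (tip t {G}) ≃ attach (path (suc t)) G
ext-path t = record
  { to      = λ { nothing → inj₁ zero ; (just (inj₁ i)) → inj₁ (suc i) ; (just (inj₂ v)) → inj₂ v }
  ; from    = λ { (inj₁ zero) → nothing ; (inj₁ (suc i)) → just (inj₁ i) ; (inj₂ v) → just (inj₂ v) }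
  ; to∘from = λ { (inj₁ zero) → refl ; (inj₁ (suc i)) → refl ; (inj₂ v) → refl }
  ; from∘to = λ { nothing → refl ; (just (inj₁ i)) → refl ; (just (inj₂ v)) → refl }
  ; edge-eq = λ { nothing nothing → refl ; nothing (just (inj₁ i)) → refl ; nothing (just (inj₂ v)) → refl
                ; (just (inj₁ i)) nothing → refl ; (just (inj₂ v)) nothing → refl
                ; (just (inj₁ i)) (just (inj₁ j)) → refl ; (just (inj₁ i)) (just (inj₂ v)) → refl
                ; (just (inj₂ v)) (just (inj₁ i)) → refl ; (just (inj₂ u)) (just (inj₂ v)) → refl }
  ; isC-eq  = λ { nothing → refl ; (just (inj₁ i)) → refl ; (just (inj₂ v)) → refl } }

ext-centre : ∀ {G} → ext G (isC G) ≃ attach (path 1) G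
ext-centre {G} = ≃-trans (ext-cong {N′ = tip 0 {G}} (≃-sym attach-empty) λ _ → refl) (ext-path 0)

closing : ∀ {G} → V (attach (path 1) G) → Bool
closing     (inj₁ i) = true
closing {G} (inj₂ v) = isC G v

-- This lets triangles arise one vertex at a time, out of a path of length 1.
ext-tri : ∀ {G} → ext (attach (path 1) G) (closing {G}) ≃ attach tri G
ext-tri = record
  { to      = λ { nothing → inj₁ zero ; (just (inj₁ zero)) → inj₁ (suc zero) ; (just (inj₂ v)) → inj₂ v }
  ; from    = λ { (inj₁ zero) → nothing ; (inj₁ (suc zero)) → just (inj₁ zero) ; (inj₂ v) → just (inj₂ v) }
  ; to∘from = λ { (inj₁ zero) → refl ; (inj₁ (suc zero)) → refl ; (inj₂ v) → refl }
  ; from∘to = λ { nothing → refl ; (just (inj₁ zero)) → refl ; (just (inj₂ v)) → refl }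
  ; edge-eq = λ { nothing nothing → refl ; nothing (just (inj₁ zero)) → refl ; nothing (just (inj₂ v)) → refl
                ; (just (inj₁ zero)) nothing → refl ; (just (inj₂ v)) nothing → refl
                ; (just (inj₁ zero)) (just (inj₁ zero)) → refl ; (just (inj₁ zero)) (just (inj₂ v)) → refl
                ; (just (inj₂ v)) (just (inj₁ zero)) → refl ; (just (inj₂ u)) (just (inj₂ v)) → refl }
  ; isC-eq  = λ { nothing → refl ; (just (inj₁ zero)) → refl ; (just (inj₂ v)) → refl } }

ext-attach : ∀ β {G} (N : V (attach β G) → Bool) → (∀ i → N (inj₁ i) ≡ false) →
             ext (attach β G) N ≃ attach β (ext G (N ∘ inj₂))
ext-attach β {G} N h = record
  { to      = λ { nothing → inj₂ nothing ; (just (inj₁ i)) → inj₁ i ; (just (inj₂ v)) → inj₂ (just v) }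
  ; from    = λ { (inj₁ i) → just (inj₁ i) ; (inj₂ nothing) → nothing ; (inj₂ (just v)) → just (inj₂ v) }
  ; to∘from = λ { (inj₁ i) → refl ; (inj₂ nothing) → refl ; (inj₂ (just v)) → refl }
  ; from∘to = λ { nothing → refl ; (just (inj₁ i)) → refl ; (just (inj₂ v)) → refl }
  ; edge-eq = λ { nothing nothing → refl ; nothing (just (inj₁ i)) → off i ; nothing (just (inj₂ v)) → refl
                ; (just (inj₁ i)) nothing → off i ; (just (inj₂ v)) nothing → refl
                ; (just (inj₁ i)) (just (inj₁ j)) → refl ; (just (inj₁ i)) (just (inj₂ v)) → refl
                ; (just (inj₂ v)) (just (inj₁ i)) → refl ; (just (inj₂ u)) (just (inj₂ v)) → refl }
  ; isC-eq  = λ { nothing → refl ; (just (inj₁ i)) → refl ; (just (inj₂ v)) → refl } }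
  where
  off : ∀ i → N (inj₁ i) ≡ touch β i ∧ false
  off i = trans (h i) (sym (BoolP.∧-zeroʳ (touch β i)))

pathEdge-before : ∀ {t} (i : Fin t) → ∃ λ p → pathEdge (suc i) p ≡ true × toℕ p ℕ.≤ toℕ i
pathEdge-before zero    = zero , refl , z≤n
pathEdge-before (suc i) = let p , e , lt = pathEdge-before i in suc p , e , s≤s lt

pathEdge-after : ∀ {t} (i : Fin t) → pathEnd i ≡ true ⊎ ∃ λ q → pathEdge i q ≡ true × toℕ i ℕ.< toℕ q
pathEdge-after {suc zero}    zero = inj₁ refl
pathEdge-after {suc (suc t)} zero = inj₂ (suc zero , refl , s≤s z≤n)
pathEdge-after {suc t} (suc i) with pathEdge-after i
... | inj₁ e            = inj₁ e
... | inj₂ (q , e , lt) = inj₂ (suc q , e , s≤s lt)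

bool-eq : ∀ {a b} → (a ≡ true → b ≡ true) → (b ≡ true → a ≡ true) → a ≡ b
bool-eq {true}  {b}     f g = sym (f refl)
bool-eq {false} {true}  f g = g refl
bool-eq {false} {false} f g = refl

Pendant : ∀ βs → V (PG βs) → Set
Pendant βs w = isC (PG βs) w ≡ false × (∀ u u′ → edge (PG βs) w u ≡ true → edge (PG βs) w u′ ≡ true → u ≡ u′)

Positive : List Branch → Set
Positive βs = All (1 ℕ.≤_) (paths βs)

data FarEnd : ∀ β → Fin (size β) → Set where
  farEnd : ∀ {t} → FarEnd (path (suc t)) zero

-- A triangle vertex sees its partner and the centre; a path vertex other than the far end sees its
-- predecessor and either its successor or the centre. Two neighbours contradict `Pendant`.
pendant-cases : ∀ {β βs} i → ¬ Pendant (β ∷ βs) (inj₁ i) ⊎ FarEnd β i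
pendant-cases {tri} {βs} i = inj₁ λ (_ , uniq) →
  case uniq (inj₁ (other i)) (inj₂ (centre βs)) (other-edge i) (isC-centre βs) of λ ()
  where
  other : Fin 2 → Fin 2
  other zero       = suc zero
  other (suc zero) = zero
  other-edge : ∀ i → not (does (i ≟ other i)) ≡ true
  other-edge zero       = refl
  other-edge (suc zero) = refl
pendant-cases {path (suc t)} zero = inj₂ farEnd
pendant-cases {path (suc t)} {βs} (suc i) with pathEdge-before i | pathEdge-after (suc i)
... | p , e , le | inj₁ end = inj₁ λ (_ , uniq) →
  case uniq (inj₁ p) (inj₂ (centre βs)) e (cong₂ _∧_ end (isC-centre βs)) of λ ()
... | p , e , le | inj₂ (q , e′ , lt) = inj₁ λ (_ , uniq) → case uniq (inj₁ p) (inj₁ q) e e′ of λ { refl → ℕP.<⇒≱ lt (ℕP.m≤n⇒m≤1+n le) }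

pendant-deep : ∀ {β βs w} → Pendant (β ∷ βs) (inj₂ w) → Pendant βs w
pendant-deep (c , uniq) = c , λ u u′ e e′ → case uniq (inj₂ u) (inj₂ u′) e e′ of λ { refl → refl }

-- The new vertex prolongs the path that w ends. Branches further inside are reached by
-- `ext-attach`, as the new vertex avoids those in front.
ext-pendant : ∀ βs w → Pendant βs w → (N : V (PG βs) → Bool) → N w ≡ true → (∀ v → N v ≡ true → v ≡ w) →
  ∃ λ γs → ext (PG βs) N ≃ PG γs × tris γs ≡ tris βs × length (paths γs) ≡ length (paths βs) × (Positive βs → Positive γs)
ext-pendant [] tt (() , _) N Nw N-only
ext-pendant (β ∷ βs) (inj₁ i) pen N Nw N-only with pendant-cases {β} {βs} i
... | inj₁ ¬pen = contradiction pen ¬pen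
... | inj₂ (farEnd {t}) = path (suc (suc t)) ∷ βs
  , ≃-trans (ext-cong {N′ = tip (suc t) {PG βs}} ≃-refl at-tip) (ext-path (suc t)) , refl , refl , λ { (_ ∷ p) → s≤s z≤n ∷ p }
  where
  at-tip : ∀ v → N v ≡ tip (suc t) {PG βs} v
  at-tip (inj₁ zero)    = Nw
  at-tip (inj₁ (suc j)) = bool-eq (λ e → case N-only (inj₁ (suc j)) e of λ ()) λ ()
  at-tip (inj₂ v)       = bool-eq (λ e → case N-only (inj₂ v) e of λ ()) λ ()
ext-pendant (β ∷ βs) (inj₂ w) pen N Nw N-only
  with ext-pendant βs w (pendant-deep {β} {βs} pen) (N ∘ inj₂) Nw (λ v e → case N-only (inj₂ v) e of λ { refl → refl })
... | γs , f , t , k , pos = β ∷ γs , ≃-trans (ext-attach β N outside) (attach-cong β f) , tris-∷ β t , paths-∷ β k , positive-∷ β pos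
  where
  outside : ∀ i → N (inj₁ i) ≡ false
  outside i = bool-eq (λ e → case N-only (inj₁ i) e of λ ()) λ ()
  tris-∷ : ∀ β → tris γs ≡ tris βs → tris (β ∷ γs) ≡ tris (β ∷ βs)
  tris-∷ tri      h = cong suc h
  tris-∷ (path _) h = h
  paths-∷ : ∀ β → length (paths γs) ≡ length (paths βs) → length (paths (β ∷ γs)) ≡ length (paths (β ∷ βs))
  paths-∷ tri      h = h
  paths-∷ (path _) h = cong suc h
  positive-∷ : ∀ β → (Positive βs → Positive γs) → Positive (β ∷ βs) → Positive (β ∷ γs)
  positive-∷ tri      h p       = h p
  positive-∷ (path _) h (q ∷ p) = q ∷ h p

-- A far end adjacent to the centre belongs to a path of length 1, which the new vertex turns into a
-- triangle; one path is traded for one triangle.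
ext-close : ∀ βs w → Pendant βs w → edge (PG βs) w (centre βs) ≡ true → (N : V (PG βs) → Bool) → N w ≡ true →
  (∀ v → isC (PG βs) v ≡ true → N v ≡ true) → (∀ v → N v ≡ true → v ≡ w ⊎ isC (PG βs) v ≡ true) →
  ∃ λ γs → ext (PG βs) N ≃ PG γs × tris γs ≡ suc (tris βs) × suc (length (paths γs)) ≡ length (paths βs) × (Positive βs → Positive γs)
ext-close [] tt (() , _) e N Nw N-c N-only
ext-close (β ∷ βs) (inj₁ i) pen e N Nw N-c N-only with pendant-cases {β} {βs} i
... | inj₁ ¬pen = contradiction pen ¬pen
-- On a longer path the far end does not touch the centre.
... | inj₂ (farEnd {suc t}) = case e of λ ()
... | inj₂ (farEnd {zero}) = tri ∷ βs
  , ≃-trans (ext-cong {N′ = closing {PG βs}} ≃-refl at) ext-tri , refl , refl , λ { (_ ∷ p) → p }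
  where
  at : ∀ v → N v ≡ closing {PG βs} v
  at (inj₁ zero) = Nw
  at (inj₂ v)    = bool-eq (λ e → case N-only (inj₂ v) e of λ { (inj₂ c) → c }) (N-c (inj₂ v))
ext-close (β ∷ βs) (inj₂ w) pen e N Nw N-c N-only
  with ext-close βs w (pendant-deep {β} {βs} pen) e (N ∘ inj₂) Nw (λ v → N-c (inj₂ v))
         (λ v e → case N-only (inj₂ v) e of λ { (inj₁ refl) → inj₁ refl ; (inj₂ c) → inj₂ c })
... | γs , f , t , k , pos = β ∷ γs , ≃-trans (ext-attach β N outside) (attach-cong β f) , tris-∷ β t , paths-∷ β k , positive-∷ β pos
  where
  outside : ∀ i → N (inj₁ i) ≡ false
  outside i = bool-eq (λ e → case N-only (inj₁ i) e of λ { (inj₁ ()) ; (inj₂ ()) }) λ ()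
  tris-∷ : ∀ β → tris γs ≡ suc (tris βs) → tris (β ∷ γs) ≡ suc (tris (β ∷ βs))
  tris-∷ tri      h = cong suc h
  tris-∷ (path _) h = h
  paths-∷ : ∀ β → suc (length (paths γs)) ≡ length (paths βs) → suc (length (paths (β ∷ γs))) ≡ length (paths (β ∷ βs))
  paths-∷ tri      h = h
  paths-∷ (path _) h = cong suc h
  positive-∷ : ∀ β → (Positive βs → Positive γs) → Positive (β ∷ βs) → Positive (β ∷ γs)
  positive-∷ tri      h p       = h p
  positive-∷ (path _) h (q ∷ p) = q ∷ h p

-- Removal of a vertex and its effect on degrees, closed walks and connectedness

toPG : ∀ {n} → Graph n → Fin n → PGraph
toPG {n} H c = pgraph (Fin n) (adj H) (λ v → does (v ≟ c))

remove : ∀ {n} → Graph (suc n) → Fin (suc n) → Graph n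
remove H v = record
  { adj    = λ i j → adj H (punchIn v i) (punchIn v j)
  ; sym    = λ i j → Graph.sym H (punchIn v i) (punchIn v j)
  ; irrefl = λ i → irrefl H (punchIn v i)
  }

≟-injective : ∀ {m n} (f : Fin m → Fin n) → (∀ {i j} → f i ≡ f j → i ≡ j) → ∀ i j → does (i ≟ j) ≡ does (f i ≟ f j)
≟-injective f inj i j with i ≟ j
... | yes refl = sym (dec-true (f i ≟ f i) refl)
... | no i≢j   = sym (dec-false (f i ≟ f j) (i≢j ∘ inj))

remove-≃ : ∀ {n} (H : Graph (suc n)) v c → toPG H (punchIn v c) ≃ ext (toPG (remove H v) c) (λ i → adj H v (punchIn v i))
remove-≃ {n} H v c = ≃-sym (record
  { to      = back
  ; from    = λ u → forth u (v ≟ u)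
  ; to∘from = λ u → back-forth u (v ≟ u)
  ; from∘to = λ { nothing → forth-v (v ≟ v) ; (just i) → forth-punchIn i (v ≟ punchIn v i) }
  ; edge-eq = λ { nothing nothing → sym (irrefl H v) ; nothing (just i) → refl ; (just i) nothing → Graph.sym H v (punchIn v i) ; (just i) (just j) → refl }
  ; isC-eq  = λ { nothing → sym (dec-false (v ≟ punchIn v c) (punchInᵢ≢i v c ∘ sym)) ; (just i) → ≟-injective (punchIn v) (punchIn-injective v _ _) i c } })
  where
  back : Maybe (Fin n) → Fin (suc n)
  back nothing  = v
  back (just i) = punchIn v i
  forth : ∀ u → Dec (v ≡ u) → Maybe (Fin n)
  forth u (yes _)  = nothing
  forth u (no v≢u) = just (punchOut v≢u)
  back-forth : ∀ u d → back (forth u d) ≡ u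
  back-forth u (yes refl) = refl
  back-forth u (no v≢u)   = punchIn-punchOut v≢u
  forth-v : ∀ d → forth v d ≡ nothing
  forth-v (yes _)  = refl
  forth-v (no v≢v) = contradiction refl v≢v
  forth-punchIn : ∀ i d → forth (punchIn v i) d ≡ just i
  forth-punchIn i (yes e) = contradiction (sym e) (punchInᵢ≢i v i)
  forth-punchIn i (no _)  = cong just (trans (punchOut-cong v refl) (punchOut-punchIn v))

∑-mono : ∀ {n} {f g : Fin n → ℤ} → (∀ i → f i ≤ g i) → ∑ f ≤ ∑ g
∑-mono {zero}  h = ℤP.≤-refl
∑-mono {suc n} h = ℤP.+-mono-≤ (h zero) (∑-mono (h ∘ suc))

∑δ : ∀ {n} (i : Fin n) → ∑ (δ i) ≡ 1ℤ
∑δ i = trans (∑-cong λ t → sym (ℤP.*-identityʳ (δ i t))) (∑-δ i (λ _ → 1ℤ))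

+-cancelˡ-≤ : ∀ a {b c} → a + b ≤ a + c → b ≤ c
+-cancelˡ-≤ a {b} {c} h = subst₂ _≤_ (e a b) (e a c) (ℤP.+-monoʳ-≤ (- a) h)
  where
  e : ∀ a b → - a + (a + b) ≡ b
  e = solve-∀

arc-true : ∀ {n} (G : Graph n) {i j} → adj G i j ≡ true → arc G i j ≡ 1ℤ
arc-true G e = cong ⟦_⟧ e

arc-false : ∀ {n} (G : Graph n) {i j} → (adj G i j ≢ true) → arc G i j ≡ 0ℤ
arc-false G {i} {j} ne with adj G i j
... | true  = contradiction refl ne
... | false = refl

adj-sym : ∀ {n} (G : Graph n) {i j} → adj G i j ≡ true → adj G j i ≡ true
adj-sym G {i} {j} e = trans (Graph.sym G j i) e

two≤deg : ∀ {n} (G : Graph n) {i j k} → adj G i j ≡ true → adj G i k ≡ true → j ≢ k → + 2 ≤ deg G i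
two≤deg G {i} {j} {k} ej ek j≢k = subst (_≤ deg G i) (trans (∑-distrib-+ (δ j) (δ k)) (cong₂ _+_ (∑δ j) (∑δ k))) (∑-mono below)
  where
  below : ∀ t → δ j t + δ k t ≤ arc G i t
  below t with j ≟ t | k ≟ t
  ... | yes refl | yes refl = contradiction refl j≢k
  ... | yes refl | no _ = ℤP.≤-reflexive (sym (arc-true G ej))
  ... | no _ | yes refl = ℤP.≤-reflexive (sym (arc-true G ek))
  ... | no _ | no _ = 0≤arc G i t

three≤deg : ∀ {n} (G : Graph n) {i j k l} → adj G i j ≡ true → adj G i k ≡ true → adj G i l ≡ true →
            j ≢ k → j ≢ l → k ≢ l → + 3 ≤ deg G i
three≤deg G {i} {j} {k} {l} ej ek el j≢k j≢l k≢l =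
  subst (_≤ deg G i) (trans (∑-distrib-+ (λ t → δ j t + δ k t) (δ l)) (cong₂ _+_ (trans (∑-distrib-+ (δ j) (δ k)) (cong₂ _+_ (∑δ j) (∑δ k))) (∑δ l))) (∑-mono below)
  where
  below : ∀ t → δ j t + δ k t + δ l t ≤ arc G i t
  below t with j ≟ t | k ≟ t | l ≟ t
  ... | yes refl | yes refl | _ = contradiction refl j≢k
  ... | yes refl | _ | yes refl = contradiction refl j≢l
  ... | _ | yes refl | yes refl = contradiction refl k≢l
  ... | yes refl | no _ | no _ = ℤP.≤-reflexive (sym (arc-true G ej))
  ... | no _ | yes refl | no _ = ℤP.≤-reflexive (sym (arc-true G ek))
  ... | no _ | no _ | yes refl = ℤP.≤-reflexive (sym (arc-true G el))
  ... | no _ | no _ | no _ = 0≤arc G i t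

deg≤1⇒unique : ∀ {n} (G : Graph n) {i j k} → deg G i ≤ 1ℤ → adj G i j ≡ true → adj G i k ≡ true → j ≡ k
deg≤1⇒unique G {i} {j} {k} d ej ek with j ≟ k
... | yes e = e
... | no j≢k = case ℤP.≤-trans (two≤deg G ej ek j≢k) d of λ { (+≤+ (s≤s ())) }

deg≤2⇒pair : ∀ {n} (G : Graph n) {i j k l} → deg G i ≤ + 2 → adj G i j ≡ true → adj G i k ≡ true → j ≢ k →
             adj G i l ≡ true → l ≡ j ⊎ l ≡ k
deg≤2⇒pair G {i} {j} {k} {l} d ej ek j≢k el with l ≟ j | l ≟ k
... | yes e | _ = inj₁ e
... | no _ | yes e = inj₂ e
... | no l≢j | no l≢k = case ℤP.≤-trans (three≤deg G ej ek el j≢k (l≢j ∘ sym) (l≢k ∘ sym)) d of λ { (+≤+ (s≤s (s≤s ()))) }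

-- The indicator of an isolated v would be constant along edges and yet separate v from a second
-- vertex.
neighbour : ∀ {n} (G : Graph (2 ℕ.+ n)) → Conn G → ∀ v → ∃ λ j → adj G v j ≡ true
neighbour G conn v with any? (λ j → adj G v j BoolP.≟ true)
... | yes p = p
... | no ¬p = case trans (sym (dec-true (v ≟ v) refl)) (trans (conn (λ i → does (i ≟ v)) closed v (punchIn v zero))
    (dec-false (punchIn v zero ≟ v) (punchInᵢ≢i v zero))) of λ ()
  where
  closed : ∀ i j → adj G i j ≡ true → does (i ≟ v) ≡ does (j ≟ v)
  closed i j e with i ≟ v | j ≟ v
  ... | yes refl | _ = contradiction (j , e) ¬p
  ... | no _ | yes refl = contradiction (i , adj-sym G e) ¬p
  ... | no _ | no _ = refl

module _ {n} (H : Graph (suc n)) (v : Fin (suc n)) where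
  private
    K = remove H v

  deg-remove : ∀ i → deg H (punchIn v i) ≡ arc H (punchIn v i) v + deg K i
  deg-remove i = sum-remove {i = v} (arc H (punchIn v i))

  deg-removed : deg H v ≡ ∑ λ i → arc H v (punchIn v i)
  deg-removed = trans (sum-remove {i = v} (arc H v)) (trans (cong (_+ ∑ (λ i → arc H v (punchIn v i))) (arc-irrefl H v)) (ℤP.+-identityˡ (∑ (λ i → arc H v (punchIn v i)))))

  degSum-remove : degSum H ≡ degSum K + + 2 * deg H v
  degSum-remove = trans (sum-remove {i = v} (deg H)) (trans (cong (_+_ (deg H v)) (trans (∑-cong deg-remove) (trans (∑-distrib-+ (λ i → arc H (punchIn v i) v) (deg K))
      (cong (_+ degSum K) (trans (∑-cong λ i → arc-sym H (punchIn v i) v) (sym deg-removed)))))) (e (deg H v) (degSum K)))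
    where
    e : ∀ d s → d + (d + s) ≡ s + + 2 * d
    e = solve-∀

  -- Ordered pairs of adjacent neighbours of v, two for each triangle through v. Such a triangle has
  -- six closed walks, whence the factor 3 in `closed₃-remove`.
  nbrWalks : ℤ
  nbrWalks = ∑ λ t → arc H v (punchIn v t) * ∑ λ k → arc K t k * arc H v (punchIn v k)

  -- Once v is moved to the front, this is `tr₃-suc` for the adjacency matrix, whose corner entry is
  -- zero.
  closed₃-remove : closed₃ H ≡ closed₃ K + + 3 * nbrWalks
  closed₃-remove = trans (∑-permute (λ i → ∑ λ j → ∑ λ k → f i j k) π) (trans (∑-cong λ i → trans (∑-permute (λ j → ∑ λ k → f (π′ i) j k) π) (∑-cong λ j → ∑-permute (λ k → f (π′ i) (π′ j) k) π))
    (trans (tr₃-suc (λ i j → arc H (π′ i) (π′ j)))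
      (trans (cong (λ z → closed₃ K + z * z * z + + 3 * z * border (λ i j → arc H (π′ i) (π′ j)) + + 3 * border₂ (λ i j → arc H (π′ i) (π′ j))) (arc-irrefl H v))
        (trans (e (closed₃ K) (border (λ i j → arc H (π′ i) (π′ j))) (border₂ (λ i j → arc H (π′ i) (π′ j)))) (cong (λ z → closed₃ K + + 3 * z) (∑-cong λ t → cong (arc H v (punchIn v t) *_) (∑-cong λ k → cong (arc K t k *_) (arc-sym H (punchIn v k) v))))))))
    where
    f : Fin (suc n) → Fin (suc n) → Fin (suc n) → ℤ
    f i j k = arc H i j * (arc H j k * arc H k i)
    π = Perm.insert zero v Perm.id
    π′ = π ⟨$⟩ʳ_
    e : ∀ x b w → x + 0ℤ * 0ℤ * 0ℤ + + 3 * 0ℤ * b + + 3 * w ≡ x + + 3 * w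
    e = solve-∀

  -- A colouring of the remaining graph extends to v by the common colour of its neighbours.
  Conn-remove : Conn H → ∀ x → (∀ S → (∀ i j → adj K i j ≡ true → S i ≡ S j) → ∀ i → adj H v (punchIn v i) ≡ true → S i ≡ S x) → Conn K
  Conn-remove conn x nbrs S closed i j = trans (sym (insertAt-punchIn S v (S x) i))
      (trans (conn S⁺ closed⁺ (punchIn v i) (punchIn v j)) (insertAt-punchIn S v (S x) j))
    where
    S⁺ = insertAt S v (S x)
    at-v : ∀ i → adj H v (punchIn v i) ≡ true → S⁺ v ≡ S⁺ (punchIn v i)
    at-v i e = trans (insertAt-lookup S v (S x)) (trans (sym (nbrs S closed i e)) (sym (insertAt-punchIn S v (S x) i)))
    closed⁺ : ∀ k l → adj H k l ≡ true → S⁺ k ≡ S⁺ l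
    closed⁺ k l e with v ≟ k | v ≟ l
    ... | yes refl | yes refl = refl
    ... | yes refl | no v≢l = subst (λ l → adj H v l ≡ true → S⁺ v ≡ S⁺ l) (punchIn-punchOut v≢l) (at-v (punchOut v≢l)) e
    ... | no v≢k | yes refl = sym (subst (λ k → adj H v k ≡ true → S⁺ v ≡ S⁺ k) (punchIn-punchOut v≢k) (at-v (punchOut v≢k)) (adj-sym H e))
    ... | no v≢k | no v≢l = subst (λ k → adj H k l ≡ true → S⁺ k ≡ S⁺ l) (punchIn-punchOut v≢k)
      (subst (λ l → adj H (punchIn v (punchOut v≢k)) l ≡ true → S⁺ (punchIn v (punchOut v≢k)) ≡ S⁺ l) (punchIn-punchOut v≢l)
        (λ e → trans (insertAt-punchIn S v (S x) (punchOut v≢k)) (trans (closed (punchOut v≢k) (punchOut v≢l) e) (sym (insertAt-punchIn S v (S x) (punchOut v≢l)))))) e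

  deg-remove-≤ : ∀ i → deg K i ≤ deg H (punchIn v i)
  deg-remove-≤ i = subst (deg K i ≤_) (sym (deg-remove i)) (≤-+ˡ (0≤arc H (punchIn v i) v))

Structured : ∀ {n} → Graph n → Fin n → ℕ → Set
Structured H c s = ∃ λ βs → toPG H c ≃ PG βs × tris βs ≡ s × Positive βs × deg H c ≡ + (2 ℕ.* s ℕ.+ length (paths βs))

-- The structure of a connected graph with at most one vertex of degree above 2

StructureThm : ℕ → Set
StructureThm n = (H : Graph (suc n)) (c : Fin (suc n)) (s : ℕ) → Conn H → (∀ v → v ≢ c → deg H v ≤ + 2) →
  closed₃ H ≡ + 6 * + s → degSum H ≡ + 2 * (+ n + + s) → Structured H c s

centre-unique : ∀ {n} (K : Graph n) c βs (f : toPG K c ≃ PG βs) {v} → isC (PG βs) v ≡ true → from f v ≡ c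
centre-unique K c βs f {v} h with from f v ≟ c | trans (isC-eq f (from f v)) (trans (cong (isC (PG βs)) (to∘from f v)) h)
... | yes e | _ = e
... | no _ | ()

edge-from : ∀ {n} (K : Graph n) c βs (f : toPG K c ≃ PG βs) q u → edge (PG βs) (to f q) u ≡ adj K q (from f u)
edge-from K c βs f q u = sym (trans (edge-eq f q (from f u)) (cong (edge (PG βs) (to f q)) (to∘from f u)))

-- Removing p costs one triangle, two edges and one vertex, so the cyclomatic number still equals
-- the number of triangles. As q has degree at most 2, the centre remains its only neighbour, and
-- putting p back is `ext-close` at q.
structure-tri : ∀ {n} → StructureThm n → (H : Graph (2 ℕ.+ n)) (p : Fin (2 ℕ.+ n)) (c q : Fin (suc n)) (s : ℕ) →
  adj H p (punchIn p c) ≡ true → adj H p (punchIn p q) ≡ true → adj H (punchIn p c) (punchIn p q) ≡ true →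
  Conn H → (∀ v → v ≢ punchIn p c → deg H v ≤ + 2) → closed₃ H ≡ + 6 * + suc s → degSum H ≡ + 2 * (+ suc n + + suc s) →
  Structured H (punchIn p c) (suc s)
structure-tri {n} ih H p c q s pc pq cq conn degs c₃ ds = finish (ih K c s connK degsK c₃K dsK)
  where
  K = remove H p
  c≢q : c ≢ q
  c≢q refl = adj-≢ H cq refl
  nbrs : ∀ i → adj H p (punchIn p i) ≡ true → i ≡ c ⊎ i ≡ q
  nbrs i e with deg≤2⇒pair H (degs p (punchInᵢ≢i p c ∘ sym)) pc pq (c≢q ∘ punchIn-injective p c q) e
  ... | inj₁ h = inj₁ (punchIn-injective p i c h)
  ... | inj₂ h = inj₂ (punchIn-injective p i q h)
  row : ∀ i → arc H p (punchIn p i) ≡ δ c i + δ q i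
  row i with c ≟ i | q ≟ i
  ... | yes refl | yes refl = contradiction refl c≢q
  ... | yes refl | no _ = arc-true H pc
  ... | no _ | yes refl = arc-true H pq
  ... | no c≢i | no q≢i = arc-false H λ e → case nbrs i e of λ { (inj₁ h) → c≢i (sym h) ; (inj₂ h) → q≢i (sym h) }
  deg-p : deg H p ≡ + 2
  deg-p = trans (deg-removed H p) (trans (∑-cong row) (trans (∑-distrib-+ (δ c) (δ q)) (cong₂ _+_ (∑δ c) (∑δ q))))
  ∑row : ∀ (f : Fin (suc n) → ℤ) → ∑ (λ t → arc H p (punchIn p t) * f t) ≡ f c + f q
  ∑row f = trans (∑-cong λ t → trans (cong (_* f t) (row t)) (ℤP.*-distribʳ-+ (f t) (δ c t) (δ q t)))
    (trans (∑-distrib-+ (λ t → δ c t * f t) (λ t → δ q t * f t)) (cong₂ _+_ (∑-δ c f) (∑-δ q f)))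
  walks : nbrWalks H p ≡ + 2
  walks = trans (∑row (λ t → ∑ λ k → arc K t k * arc H p (punchIn p k))) (trans (cong₂ _+_ (inner′ c) (inner′ q))
    (cong₂ _+_ (cong₂ _+_ (arc-irrefl K c) (arc-true K cq)) (cong₂ _+_ (arc-true K (adj-sym K cq)) (arc-irrefl K q))))
    where
    inner′ : ∀ t → ∑ (λ k → arc K t k * arc H p (punchIn p k)) ≡ arc K t c + arc K t q
    inner′ t = trans (∑-cong λ k → ℤP.*-comm (arc K t k) (arc H p (punchIn p k))) (∑row (arc K t))
  c₃K : closed₃ K ≡ + 6 * + s
  c₃K = +-cancelʳ (+ 6) (closed₃ K) (+ 6 * + s) (trans (cong (λ z → closed₃ K + + 3 * z) (sym walks)) (trans (sym (closed₃-remove H p)) (trans c₃ (e (+ s)))))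
    where
    e : ∀ s → + 6 * (1ℤ + s) ≡ + 6 * s + + 6
    e = solve-∀
  dsK : degSum K ≡ + 2 * (+ n + + s)
  dsK = +-cancelʳ (+ 4) (degSum K) (+ 2 * (+ n + + s)) (trans (cong (λ z → degSum K + + 2 * z) (sym deg-p)) (trans (sym (degSum-remove H p)) (trans ds (e (+ n) (+ s)))))
    where
    e : ∀ n s → + 2 * ((1ℤ + n) + (1ℤ + s)) ≡ + 2 * (n + s) + + 4
    e = solve-∀
  degsK : ∀ v → v ≢ c → deg K v ≤ + 2
  degsK v v≢c = ℤP.≤-trans (deg-remove-≤ H p v) (degs (punchIn p v) (v≢c ∘ punchIn-injective p v c))
  connK : Conn K
  connK = Conn-remove H p conn c λ S closed i e → case nbrs i e of λ { (inj₁ refl) → refl ; (inj₂ refl) → sym (closed c q cq) }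
  q-nbr : ∀ x → adj K q x ≡ true → x ≡ c
  q-nbr x e with deg≤2⇒pair H (degs (punchIn p q) (c≢q ∘ sym ∘ punchIn-injective p q c)) (adj-sym H pq) (adj-sym H cq) (punchInᵢ≢i p c ∘ sym) e
  ... | inj₁ h = contradiction h (punchInᵢ≢i p x)
  ... | inj₂ h = punchIn-injective p x c h
  finish : Structured K c s → Structured H (punchIn p c) (suc s)
  finish (βs , f , t , pos , d) = γs , ≃-trans (remove-≃ H p c) (≃-trans (ext-cong {N′ = N ∘ from f} f λ v → cong N (sym (from∘to f v))) g)
      , trans t′ (cong suc t) , pos′ pos , deg-centre
    where
    N : Fin (suc n) → Bool
    N i = adj H p (punchIn p i)
    w = to f q
    pendant : Pendant βs w
    pendant = trans (sym (isC-eq f q)) (dec-false (q ≟ c) (c≢q ∘ sym)) , λ u u′ e e′ →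
      trans (sym (to∘from f u)) (trans (cong (to f) (trans (q-nbr (from f u) (trans (sym (edge-from K c βs f q u)) e))
        (sym (q-nbr (from f u′) (trans (sym (edge-from K c βs f q u′)) e′))))) (to∘from f u′))
    result = ext-close βs w pendant
      (trans (edge-from K c βs f q (centre βs)) (trans (cong (adj K q) (centre-unique K c βs f (isC-centre βs))) (adj-sym K cq)))
      (N ∘ from f) (trans (cong N (from∘to f q)) pq)
      (λ v h → trans (cong N (centre-unique K c βs f h)) pc)
      (λ v h → case nbrs (from f v) h of λ
        { (inj₁ e) → inj₂ (trans (cong (isC (PG βs)) (sym (to∘from f v))) (trans (sym (isC-eq f (from f v))) (dec-true (from f v ≟ c) e)))
        ; (inj₂ e) → inj₁ (trans (sym (to∘from f v)) (cong (to f) e)) })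
    γs = proj₁ result
    g = proj₁ (proj₂ result)
    t′ = proj₁ (proj₂ (proj₂ result))
    k′ = proj₁ (proj₂ (proj₂ (proj₂ result)))
    pos′ = proj₂ (proj₂ (proj₂ (proj₂ result)))
    deg-centre : deg H (punchIn p c) ≡ + (2 ℕ.* suc s ℕ.+ length (paths γs))
    deg-centre = trans (deg-remove H p c) (trans (cong₂ _+_ (arc-true H (adj-sym H pc)) d)
      (cong +_ (trans (cong (λ z → suc (2 ℕ.* s ℕ.+ z)) (sym k′)) (arith s (length (paths γs))))))
      where
      arith : ∀ s k → suc (2 ℕ.* s ℕ.+ suc k) ≡ 2 ℕ.* suc s ℕ.+ k
      arith s k = trans (cong suc (ℕP.+-suc (2 ℕ.* s) k)) (cong (ℕ._+ k) (sym (ℕP.*-suc 2 s)))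

-- With no triangles the graph is a tree. A leaf at the centre is a new path of length 1. A leaf at
-- another vertex u prolongs a path, because u has degree at most 2 and is pendant once the leaf is
-- gone.
structure-leaf : ∀ {n} → StructureThm n → (H : Graph (2 ℕ.+ n)) (v : Fin (2 ℕ.+ n)) (c u : Fin (suc n)) →
  adj H v (punchIn v u) ≡ true → deg H v ≤ 1ℤ →
  Conn H → (∀ v′ → v′ ≢ punchIn v c → deg H v′ ≤ + 2) → closed₃ H ≡ + 6 * + 0 → degSum H ≡ + 2 * (+ suc n + + 0) →
  Structured H (punchIn v c) 0
structure-leaf {n} ih H v c u vu dv conn degs c₃ ds = finish (ih K c 0 connK degsK c₃K dsK) (u ≟ c)
  where
  K = remove H v
  nbrs : ∀ i → adj H v (punchIn v i) ≡ true → i ≡ u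
  nbrs i e = punchIn-injective v i u (deg≤1⇒unique H dv e vu)
  row : ∀ i → arc H v (punchIn v i) ≡ δ u i
  row i with u ≟ i
  ... | yes refl = arc-true H vu
  ... | no u≢i = arc-false H λ e → u≢i (sym (nbrs i e))
  deg-v : deg H v ≡ 1ℤ
  deg-v = trans (deg-removed H v) (trans (∑-cong row) (∑δ u))
  ∑row : ∀ (f : Fin (suc n) → ℤ) → ∑ (λ t → arc H v (punchIn v t) * f t) ≡ f u
  ∑row f = trans (∑-cong λ t → cong (_* f t) (row t)) (∑-δ u f)
  walks : nbrWalks H v ≡ 0ℤ
  walks = trans (∑row (λ t → ∑ λ k → arc K t k * arc H v (punchIn v k)))
    (trans (∑-cong λ k → ℤP.*-comm (arc K u k) (arc H v (punchIn v k))) (trans (∑row (arc K u)) (arc-irrefl K u)))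
  c₃K : closed₃ K ≡ + 6 * + 0
  c₃K = trans (sym (ℤP.+-identityʳ (closed₃ K))) (trans (cong (λ z → closed₃ K + + 3 * z) (sym walks)) (trans (sym (closed₃-remove H v)) c₃))
  dsK : degSum K ≡ + 2 * (+ n + + 0)
  dsK = +-cancelʳ (+ 2) (degSum K) (+ 2 * (+ n + + 0)) (trans (cong (λ z → degSum K + + 2 * z) (sym deg-v)) (trans (sym (degSum-remove H v)) (trans ds (e (+ n)))))
    where
    e : ∀ n → + 2 * ((1ℤ + n) + 0ℤ) ≡ + 2 * (n + 0ℤ) + + 2
    e = solve-∀
  degsK : ∀ i → i ≢ c → deg K i ≤ + 2
  degsK i i≢c = ℤP.≤-trans (deg-remove-≤ H v i) (degs (punchIn v i) (i≢c ∘ punchIn-injective v i c))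
  connK : Conn K
  connK = Conn-remove H v conn u λ S closed i e → cong S (nbrs i e)
  N : Fin (suc n) → Bool
  N i = adj H v (punchIn v i)
  finish : Structured K c 0 → Dec (u ≡ c) → Structured H (punchIn v c) 0
  finish (βs , f , t , pos , d) (yes refl) = path 1 ∷ βs
    , ≃-trans (remove-≃ H v c) (≃-trans (ext-cong {N′ = isC (PG βs)} f λ i → trans (atCentre i) (isC-eq f i)) ext-centre)
    , t , s≤s z≤n ∷ pos , trans (deg-remove H v c) (cong₂ _+_ (arc-true H (adj-sym H vu)) d)
    where
    atCentre : ∀ i → N i ≡ does (i ≟ c)
    atCentre i with i ≟ c
    ... | yes refl = vu
    ... | no i≢c = bool-eq (λ e → contradiction (nbrs i e) i≢c) λ ()
  finish (βs , f , t , pos , d) (no u≢c) = γs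
    , ≃-trans (remove-≃ H v c) (≃-trans (ext-cong {N′ = N ∘ from f} f λ i → cong N (sym (from∘to f i))) g)
    , trans t′ t , pos′ pos , deg-centre
    where
    deg-u : deg K u ≤ 1ℤ
    deg-u = +-cancelˡ-≤ 1ℤ (subst (_≤ + 2) (trans (deg-remove H v u) (cong (_+ deg K u) (arc-true H (adj-sym H vu)))) (degs (punchIn v u) (u≢c ∘ punchIn-injective v u c)))
    w = to f u
    pendant : Pendant βs w
    pendant = trans (sym (isC-eq f u)) (dec-false (u ≟ c) u≢c) , λ x x′ e e′ →
      trans (sym (to∘from f x)) (trans (cong (to f) (deg≤1⇒unique K deg-u (trans (sym (edge-from K c βs f u x)) e) (trans (sym (edge-from K c βs f u x′)) e′))) (to∘from f x′))
    result = ext-pendant βs w pendant (N ∘ from f) (trans (cong N (from∘to f u)) vu)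
      (λ x h → trans (sym (to∘from f x)) (cong (to f) (nbrs (from f x) h)))
    γs = proj₁ result
    g = proj₁ (proj₂ result)
    t′ = proj₁ (proj₂ (proj₂ result))
    k′ = proj₁ (proj₂ (proj₂ (proj₂ result)))
    pos′ = proj₂ (proj₂ (proj₂ (proj₂ result)))
    deg-centre : deg H (punchIn v c) ≡ + (2 ℕ.* 0 ℕ.+ length (paths γs))
    deg-centre = trans (deg-remove H v c) (trans (cong (_+ deg K c) (arc-false H λ e → u≢c (sym (nbrs c (adj-sym H e)))))
      (trans (ℤP.+-identityˡ (deg K c)) (trans d (cong +_ (sym k′)))))

module _ {n} (H : Graph (2 ℕ.+ n)) (c : Fin (2 ℕ.+ n)) (conn : Conn H) (degs : ∀ v → v ≢ c → deg H v ≤ + 2) where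

  -- A triangle avoiding c would be a connected component.
  triangle-centre : ∀ {i j k} → adj H i j ≡ true → adj H j k ≡ true → adj H k i ≡ true →
    ∃ λ p → ∃ λ q → adj H c p ≡ true × adj H p q ≡ true × adj H q c ≡ true
  triangle-centre {i} {j} {k} ij jk ki with i ≟ c | j ≟ c | k ≟ c
  ... | yes refl | _ | _ = j , k , ij , jk , ki
  ... | no _ | yes refl | _ = k , i , jk , ki , ij
  ... | no _ | no _ | yes refl = i , j , ki , ij , jk
  ... | no i≢c | no j≢c | no k≢c = case trans (sym (∈T i (inj₁ refl))) (trans (conn T closed i c) c∉T) of λ ()
    where
    T : Fin (2 ℕ.+ n) → Bool
    T x = does (x ≟ i) ∨ (does (x ≟ j) ∨ does (x ≟ k))
    ∈T : ∀ x → x ≡ i ⊎ (x ≡ j ⊎ x ≡ k) → T x ≡ true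
    ∈T x (inj₁ e) rewrite dec-true (x ≟ i) e = refl
    ∈T x (inj₂ (inj₁ e)) rewrite dec-true (x ≟ j) e = BoolP.∨-zeroʳ (does (x ≟ i))
    ∈T x (inj₂ (inj₂ e)) rewrite dec-true (x ≟ k) e = trans (cong (does (x ≟ i) ∨_) (BoolP.∨-zeroʳ (does (x ≟ j)))) (BoolP.∨-zeroʳ (does (x ≟ i)))
    T⇒ : ∀ x → T x ≡ true → x ≡ i ⊎ (x ≡ j ⊎ x ≡ k)
    T⇒ x h with x ≟ i | x ≟ j | x ≟ k
    ... | yes e | _ | _ = inj₁ e
    ... | no _ | yes e | _ = inj₂ (inj₁ e)
    ... | no _ | no _ | yes e = inj₂ (inj₂ e)
    c∉T : T c ≡ false
    c∉T rewrite dec-false (c ≟ i) (i≢c ∘ sym) | dec-false (c ≟ j) (j≢c ∘ sym) | dec-false (c ≟ k) (k≢c ∘ sym) = refl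
    step : ∀ x y → adj H x y ≡ true → T x ≡ true → T y ≡ true
    step x y e h with T⇒ x h
    ... | inj₁ refl = ∈T y (case deg≤2⇒pair H (degs i i≢c) ij (adj-sym H ki) (adj-≢ H jk) e of λ { (inj₁ a) → inj₂ (inj₁ a) ; (inj₂ a) → inj₂ (inj₂ a) })
    ... | inj₂ (inj₁ refl) = ∈T y (case deg≤2⇒pair H (degs j j≢c) jk (adj-sym H ij) (adj-≢ H ki) e of λ { (inj₁ a) → inj₂ (inj₂ a) ; (inj₂ a) → inj₁ a })
    ... | inj₂ (inj₂ refl) = ∈T y (case deg≤2⇒pair H (degs k k≢c) ki (adj-sym H jk) (adj-≢ H ij) e of λ { (inj₁ a) → inj₁ a ; (inj₂ a) → inj₂ (inj₁ a) })
    closed : ∀ x y → adj H x y ≡ true → T x ≡ T y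
    closed x y e = bool-eq (step x y e) (step y x (adj-sym H e))

  -- Otherwise n + 1 vertices of degree at least 2 and a centre of degree at least 1 exceed the
  -- degree sum 2(n + 1) of a tree.
  find-leaf : degSum H ≡ + 2 * (+ suc n + + 0) → ∃ λ v → v ≢ c × deg H v ≤ 1ℤ
  find-leaf ds with any? (λ v → ¬? (v ≟ c) ×-dec (deg H v ℤP.≤? 1ℤ))
  ... | yes p = p
  ... | no ¬p = contradiction (subst (+ 2 * + suc n + 1ℤ ≤_) (trans ds (e (+ suc n))) bound) λ h → ℤP.<-irrefl refl (ℤP.suc[i]≤j⇒i<j (subst (_≤ + 2 * + suc n) (ℤP.+-comm (+ 2 * + suc n) 1ℤ) h))
    where
    e : ∀ n → + 2 * (n + 0ℤ) ≡ + 2 * n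
    e = solve-∀
    big : ∀ i → + 2 ≤ deg H (punchIn c i)
    big i with deg H (punchIn c i) ℤP.≤? 1ℤ
    ... | yes h = contradiction (punchIn c i , punchInᵢ≢i c i , h) ¬p
    ... | no h = ℤP.i<j⇒suc[i]≤j (ℤP.≰⇒> h)
    one : 1ℤ ≤ deg H c
    one = let j , e = neighbour H conn c in ℤP.≤-trans (ℤP.≤-reflexive (sym (arc-true H e))) (term≤∑ (0≤arc H c) j)
    bound : + 2 * + suc n + 1ℤ ≤ degSum H
    bound = subst (+ 2 * + suc n + 1ℤ ≤_) (trans (ℤP.+-comm (∑ (λ i → deg H (punchIn c i))) (deg H c)) (sym (sum-remove {i = c} (deg H))))
      (ℤP.+-mono-≤ (subst (_≤ ∑ (λ i → deg H (punchIn c i))) (trans (∑-const (suc n) (+ 2)) (ℤP.*-comm (+ suc n) (+ 2))) (∑-mono big)) one)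

-- Triangles are removed as long as there are any, and the remaining tree is taken apart leaf by
-- leaf. Longer cycles cannot occur, as the cyclomatic number equals the number of triangles.
structure : ∀ n → StructureThm n
structure zero H zero zero conn degs c₃ ds = [] , single , refl , [] , trans (ℤP.+-identityʳ (arc H zero zero)) (arc-irrefl H zero)
  where
  single : toPG H zero ≃ PG []
  single = record { to = λ _ → tt ; from = λ _ → zero ; to∘from = λ _ → refl ; from∘to = λ { zero → refl }
                  ; edge-eq = λ { zero zero → irrefl H zero } ; isC-eq = λ { zero → refl } }
structure zero H zero (suc s) conn degs c₃ ds = case trans (sym (cong (λ z → z * (z * z) + 0ℤ + 0ℤ + 0ℤ) (arc-irrefl H zero))) c₃ of λ ()
structure (suc n) H c (suc s) conn degs c₃ ds = found (positiveTerm (λ i → 0≤∑ λ j → 0≤∑ (0≤closed₃-term H i j)) (subst (1ℤ ≤_) (sym c₃) (+≤+ (s≤s z≤n))))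
  where
  remove-p : ∀ p q → adj H c p ≡ true → adj H p q ≡ true → adj H q c ≡ true → Structured H c (suc s)
  remove-p p q cp pq qc with p ≟ c | p ≟ q
  ... | yes refl | _ = contradiction refl (adj-≢ H cp)
  ... | _ | yes refl = contradiction refl (adj-≢ H pq)
  ... | no p≢c | no p≢q with punchOut p≢c | punchIn-punchOut p≢c | punchOut p≢q | punchIn-punchOut p≢q
  ...   | c′ | refl | q′ | refl = structure-tri (structure n) H p c′ q′ s (adj-sym H cp) pq (adj-sym H qc) conn degs c₃ ds
  ones : ∀ a b c → 1ℤ ≤ ⟦ a ⟧ * (⟦ b ⟧ * ⟦ c ⟧) → a ≡ true × b ≡ true × c ≡ true
  ones true true true _ = refl , refl , refl
  ones true true false (+≤+ ())
  ones true false c (+≤+ ())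
  ones false b c (+≤+ ())
  found : (∃ λ i → 1ℤ ≤ ∑ λ j → ∑ λ k → arc H i j * (arc H j k * arc H k i)) → Structured H c (suc s)
  found (i , h) with positiveTerm (λ j → 0≤∑ (0≤closed₃-term H i j)) h
  ... | j , h′ with positiveTerm (0≤closed₃-term H i j) h′
  ...   | k , h″ with ones (adj H i j) (adj H j k) (adj H k i) h″
  ...     | ij , jk , ki = let p , q , cp , pq , qc = triangle-centre H c conn degs ij jk ki in remove-p p q cp pq qc
structure (suc n) H c zero conn degs c₃ ds = leaf (find-leaf H c conn degs ds)
  where
  leaf : (∃ λ v → v ≢ c × deg H v ≤ 1ℤ) → Structured H c 0
  leaf (v , v≢c , dv) with neighbour H conn v
  ... | u , vu with punchOut v≢c | punchIn-punchOut v≢c | punchOut (adj-≢ H vu) | punchIn-punchOut (adj-≢ H vu)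
  ...   | c′ | refl | u′ | refl = structure-leaf (structure n) H v c′ u′ vu dv conn degs c₃ ds

-- The characteristic polynomial of a branched graph

grounded : ∀ {n} → (Fin n → ℤ) → Weights n → Fin n → ℤ
grounded σ w p = withRow σ w p 1ℤ (λ _ → 0ℤ)

-- Linearity in row p. In `grounded` that row is a unit vector, so the value is the determinant with
-- row and column p struck out.
D-addRoot : ∀ n σ (w : Weights n) p x → D n (λ i → σ i + x * δ p i) w ≡ D n σ w + x * grounded σ w p
D-addRoot n σ w p x = trans (D-row n p {1ℤ} {x} {σ} {σ[_] σ w p 1ℤ} {λ i → σ i + x * δ p i} {w} {w[_] σ w p (λ _ → 0ℤ)} {w} (rowComb
    (trans (cong (λ z → σ p + x * z) (δ-refl p)) (trans (e₁ (σ p) x) (cong (λ z → 1ℤ * σ p + x * z) (sym (cong (λ b → if b then 1ℤ else σ p) (dec-true (p ≟ p) refl))))))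
    (λ j → trans (e₂ (w p j) x) (cong (λ z → 1ℤ * w p j + x * z) (sym (cong (λ b → if b then 0ℤ else w p j) (dec-true (p ≟ p) refl)))))
    (λ i i≢p → sym (off i i≢p))
    (λ i i≢p → trans (cong (λ b → if b then 1ℤ else σ i) (dec-false (i ≟ p) i≢p)) (sym (off i i≢p)))
    (λ _ _ _ → refl)
    (λ i j i≢p → cong (λ b → if b then 0ℤ else w i j) (dec-false (i ≟ p) i≢p))))
  (cong (_+ x * grounded σ w p) (ℤP.*-identityˡ (D n σ w)))
  where
  e₁ : ∀ s x → s + x * 1ℤ ≡ 1ℤ * s + x * 1ℤ
  e₁ = solve-∀
  e₂ : ∀ s x → s ≡ 1ℤ * s + x * 0ℤ
  e₂ = solve-∀
  e₃ : ∀ s x → s + x * 0ℤ ≡ s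
  e₃ = solve-∀
  off : ∀ i → i ≢ p → σ i + x * δ p i ≡ σ i
  off i i≢p = trans (cong (λ z → σ i + x * z) (δ-≢ (i≢p ∘ sym))) (e₃ (σ i) x)

δδ-off : ∀ {n} {i j p : Fin n} → i ≢ j → ∀ x y → x + δ j p * (y * δ p i) ≡ x
δδ-off {i = i} {j} {p} i≢j x y with j ≟ p | p ≟ i
... | yes refl | yes refl = contradiction refl i≢j
... | yes refl | no _ = e x y
  where
  e : ∀ x y → x + 1ℤ * (y * 0ℤ) ≡ x
  e = solve-∀
... | no _ | _ = ℤP.+-identityʳ x

∑-weight : ∀ {n} b p (f : Fin n → ℤ) → ∑ (λ t → b * δ p t * f t) ≡ b * f p
∑-weight b p f = trans (∑-cong λ t → ℤP.*-assoc b (δ p t) (f t)) (trans (∑-* b (λ t → δ p t * f t)) (cong (b *_) (∑-δ p f)))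

-- Vertex 0 hangs on p: contracted into the root it adds b′ to the root weight of p, contracted into
-- p it leaves only a loop. The two directions have separate weights because grounding one end
-- switches one of them off.
D-leaf : ∀ n {σ w} p a b b′ → σ zero ≡ a → (∀ j → w zero (suc j) ≡ b * δ p j) → (∀ i → w (suc i) zero ≡ b′ * δ p i) →
  D (suc n) σ w ≡ (a + b) * D n (σ ∘ suc) (rest w) + a * (b′ * grounded (σ ∘ suc) (rest w) p)
D-leaf n {σ} {w} p a b b′ h₀ hᵣ h_c = trans (cong₂ _+_
    (cong₂ _*_ h₀ (trans (D-cong n {w = rest w} {w′ = rest w} (λ i → cong (_+_ (σ (suc i))) (h_c i)) λ _ _ _ → refl) (D-addRoot n (σ ∘ suc) (rest w) p b′)))
    (trans (∑-cong λ t → cong (_* D n (σ ∘ suc) (merge w t)) (hᵣ t)) (trans (∑-weight b p (λ t → D n (σ ∘ suc) (merge w t)))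
      (cong (b *_) (D-cong n {w = merge w p} {w′ = rest w} (λ _ → refl) λ i j i≢j → trans (cong (λ z → rest w i j + δ j p * z) (h_c i)) (δδ-off i≢j (rest w i j) b′))))))
  (e a b b′ (D n (σ ∘ suc) (rest w)) (grounded (σ ∘ suc) (rest w) p))
  where
  e : ∀ a b b′ d g → a * (d + b′ * g) + b * d ≡ (a + b) * d + a * (b′ * g)
  e = solve-∀

-- In `twoStep` every sum collapses to its term at c. The factor (a + b)(a + 3b) is the determinant
-- of the block of the two triangle vertices.
D-tri : ∀ n {σ w} c a b b′ → σ zero ≡ a → σ (suc zero) ≡ a → w zero (suc zero) ≡ b → w (suc zero) zero ≡ b →
  (∀ j → w zero (suc (suc j)) ≡ b * δ c j) → (∀ j → w (suc zero) (suc (suc j)) ≡ b * δ c j) →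
  (∀ i → w (suc (suc i)) zero ≡ b′ * δ c i) → (∀ i → w (suc (suc i)) (suc zero) ≡ b′ * δ c i) →
  D (2 ℕ.+ n) σ w ≡ (a + b) * (a + + 3 * b) * D n (λ i → σ (suc (suc i))) (rest (rest w))
                  + + 2 * a * (a + + 3 * b) * (b′ * grounded (λ i → σ (suc (suc i))) (rest (rest w)) c)
D-tri n {σ} {w} c a b b′ h₀ h₁ h₀₁ h₁₀ r₀ r₁ c₀ c₁ = trans (D-twoStep σ w) (trans
    (add₄ (cong₂ _*_ (cong₂ (λ x y → x + y) (cong₂ _+_ (cong₂ _*_ h₀ h₁) (cong₂ _*_ h₀ h₁₀)) (cong₂ _*_ h₁ h₀₁)) both)
          (cong₂ _+_ (cong₂ _*_ h₀ (trans (collapse r₁ (rootTo σ w)) (cong (b *_) one))) (cong₂ _*_ h₁ (trans (collapse r₀ (toRoot σ w)) (cong (b *_) one′))))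
          (cong₂ _+_ (cong₂ _*_ h₀₁ (trans (collapse r₁ (λ u → toTo σ w u u)) (cong (b *_) none))) (cong₂ _*_ h₁₀ (trans (collapse r₀ (λ u → toTo σ w u u)) (cong (b *_) none))))
          (trans (∑-cong λ t → trans (∑-* (w zero (suc (suc t))) (λ u → w (suc zero) (suc (suc u)) * toTo σ w t u)) (cong (w zero (suc (suc t)) *_) (collapse r₁ (toTo σ w t))))
            (trans (collapse r₀ (λ t → b * toTo σ w t c)) (cong (λ z → b * (b * z)) none))))
    (e a b b′ d g))
  where
  σ′ = λ (i : Fin n) → σ (suc (suc i))
  w′ = rest (rest w)
  d = D n σ′ w′
  g = grounded σ′ w′ c
  add₄ : ∀ {x x′ y y′ z z′ t t′ : ℤ} → x ≡ x′ → y ≡ y′ → z ≡ z′ → t ≡ t′ → x + y + z + t ≡ x′ + y′ + z′ + t′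
  add₄ refl refl refl refl = refl
  collapse : ∀ {v : Fin n → ℤ} → (∀ j → v j ≡ b * δ c j) → ∀ f → ∑ (λ t → v t * f t) ≡ b * f c
  collapse h f = trans (∑-cong λ t → cong (_* f t) (h t)) (∑-weight b c f)
  both : bothRoot σ w ≡ d + + 2 * b′ * g
  both = trans (D-cong n {w = w′} {w′ = w′} (λ i → trans (cong₂ (λ x y → σ′ i + x + y) (c₀ i) (c₁ i)) (e₁ (σ′ i) b′ (δ c i))) λ _ _ _ → refl) (D-addRoot n σ′ w′ c (+ 2 * b′))
    where
    e₁ : ∀ s b d → s + b * d + b * d ≡ s + + 2 * b * d
    e₁ = solve-∀
  one : rootTo σ w c ≡ d + b′ * g
  one = trans (D-cong n {w = λ i j → w′ i j + δ j c * w (suc (suc i)) (suc zero)} {w′ = w′} (λ i → cong (_+_ (σ′ i)) (c₀ i)) λ i j i≢j → trans (cong (λ z → w′ i j + δ j c * z) (c₁ i)) (δδ-off i≢j (w′ i j) b′)) (D-addRoot n σ′ w′ c b′)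
  one′ : toRoot σ w c ≡ d + b′ * g
  one′ = trans (D-cong n {w = λ i j → w′ i j + δ j c * w (suc (suc i)) zero} {w′ = w′} (λ i → cong (_+_ (σ′ i)) (c₁ i)) λ i j i≢j → trans (cong (λ z → w′ i j + δ j c * z) (c₀ i)) (δδ-off i≢j (w′ i j) b′)) (D-addRoot n σ′ w′ c b′)
  none : toTo σ w c c ≡ d
  none = D-cong n {w = λ i j → w′ i j + δ j c * w (suc (suc i)) zero + δ j c * w (suc (suc i)) (suc zero)} {w′ = w′} (λ _ → refl) λ i j i≢j →
    trans (cong₂ (λ x y → w′ i j + δ j c * x + δ j c * y) (c₀ i) (c₁ i)) (trans (cong (_+ δ j c * (b′ * δ c i)) (δδ-off i≢j (w′ i j) b′)) (δδ-off i≢j (w′ i j) b′))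
  e : ∀ a b b′ d g → (a * a + a * b + a * b) * (d + + 2 * b′ * g) + (a * (b * (d + b′ * g)) + a * (b * (d + b′ * g)))
      + (b * (b * d) + b * (b * d)) + b * (b * d)
    ≡ (a + b) * (a + + 3 * b) * d + + 2 * a * (a + + 3 * b) * (b′ * g)
  e = solve-∀

rootW : ∀ {n} → (Fin n → Bool) → ℤ → Fin n → ℤ
rootW g a i = if g i then 1ℤ else a

arcW : ∀ {n} → Graph n → (Fin n → Bool) → ℤ → Weights n
arcW K g b i j = if g i then 0ℤ else b * arc K i j

-- lapD with the vertices of g merged into the root
val : ∀ {n} → Graph n → (Fin n → Bool) → ℤ → ℤ → ℤ
val {n} K g a b = D n (rootW g a) (arcW K g b)

cons : ∀ {n} → Graph n → (Fin n → Bool) → Graph (suc n)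
cons {n} K N = record { adj = e ; sym = s ; irrefl = r }
  where
  e : Fin (suc n) → Fin (suc n) → Bool
  e zero    zero    = false
  e zero    (suc j) = N j
  e (suc i) zero    = N i
  e (suc i) (suc j) = adj K i j
  s : ∀ i j → e i j ≡ e j i
  s zero    zero    = refl
  s zero    (suc j) = refl
  s (suc i) zero    = refl
  s (suc i) (suc j) = Graph.sym K i j
  r : ∀ i → e i i ≡ false
  r zero    = refl
  r (suc i) = irrefl K i

cons-≃ : ∀ {n} (K : Graph n) N c → toPG (cons K N) (suc c) ≃ ext (toPG K c) N
cons-≃ K N c = record
  { to      = λ { zero → nothing ; (suc i) → just i }
  ; from    = λ { nothing → zero ; (just i) → suc i }
  ; to∘from = λ { nothing → refl ; (just i) → refl }
  ; from∘to = λ { zero → refl ; (suc i) → refl }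
  ; edge-eq = λ { zero zero → refl ; zero (suc j) → refl ; (suc i) zero → refl ; (suc i) (suc j) → refl }
  ; isC-eq  = λ { zero → refl ; (suc i) → refl } }

at : ∀ {n} → Fin n → Fin n → Bool
at p i = does (i ≟ p)

⟦at⟧ : ∀ {n} (p i : Fin n) → ⟦ at p i ⟧ ≡ δ p i
⟦at⟧ p i = δ-sym i p

_∪_ : ∀ {n} → (Fin n → Bool) → Fin n → Fin n → Bool
(g ∪ p) i = at p i ∨ g i

triNbrs : ∀ {n} → Fin n → Fin (suc n) → Bool
triNbrs c zero    = true
triNbrs c (suc i) = at c i

lift₂ : ∀ {n} → (Fin n → Bool) → Fin (2 ℕ.+ n) → Bool
lift₂ g zero          = false
lift₂ g (suc zero)    = false
lift₂ g (suc (suc i)) = g i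

module _ (a b : ℤ) where

  grounded-val : ∀ {n} (K : Graph n) g p →
    grounded (rootW g a) (arcW K g b) p ≡ val K (g ∪ p) a b
  grounded-val {n} K g p = D-cong n {w = w[_] (rootW g a) (arcW K g b) p (λ _ → 0ℤ)} {w′ = arcW K (g ∪ p) b} root arcs
    where
    root : ∀ i → (if at p i then 1ℤ else (if g i then 1ℤ else a)) ≡ (if (g ∪ p) i then 1ℤ else a)
    root i with at p i
    ... | true  = refl
    ... | false = refl
    arcs : ∀ i j → i ≢ j → (if at p i then 0ℤ else (if g i then 0ℤ else b * arc K i j)) ≡ (if (g ∪ p) i then 0ℤ else b * arc K i j)
    arcs i j _ with at p i
    ... | true  = refl
    ... | false = refl

  back : ∀ {n} → (Fin n → Bool) → Fin n → ℤ
  back g p = if g p then 0ℤ else b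

  backArc : ∀ {n} (g : Fin n → Bool) p i → (if g i then 0ℤ else b * ⟦ at p i ⟧) ≡ back g p * δ p i
  backArc g p i with p ≟ i
  ... | yes refl with g p
  ...   | true  = refl
  ...   | false = cong (λ z → b * ⟦ z ⟧) (dec-true (p ≟ p) refl)
  backArc g p i | no p≢i with g i
  ...   | true  = sym (ℤP.*-zeroʳ (back g p))
  ...   | false = trans (cong (λ z → b * ⟦ z ⟧) (dec-false (i ≟ p) (p≢i ∘ sym))) (trans (ℤP.*-zeroʳ b) (sym (ℤP.*-zeroʳ (back g p))))

  val-leaf : ∀ {n} (K : Graph n) p (g : Fin (suc n) → Bool) → g zero ≡ false →
    val (cons K (at p)) g a b ≡ (a + b) * val K (g ∘ suc) a b + a * (back (g ∘ suc) p * val K ((g ∘ suc) ∪ p) a b)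
  val-leaf {n} K p g g₀ = trans (D-leaf n {rootW g a} {arcW (cons K (at p)) g b} p a b (back (g ∘ suc) p) (cong (λ z → if z then 1ℤ else a) g₀)
      (λ j → trans (cong (λ z → if z then 0ℤ else b * ⟦ at p j ⟧) g₀) (cong (b *_) (⟦at⟧ p j)))
      (backArc (g ∘ suc) p))
    (cong (λ z → (a + b) * val K (g ∘ suc) a b + a * (back (g ∘ suc) p * z)) (grounded-val K (g ∘ suc) p))

  val-leaf-grounded : ∀ {n} (K : Graph n) p (g : Fin (suc n) → Bool) → g zero ≡ true →
    val (cons K (at p)) g a b ≡ val K (g ∘ suc) a b + back (g ∘ suc) p * val K ((g ∘ suc) ∪ p) a b
  val-leaf-grounded {n} K p g g₀ = trans (D-leaf n {rootW g a} {arcW (cons K (at p)) g b} p 1ℤ 0ℤ (back (g ∘ suc) p) (cong (λ z → if z then 1ℤ else a) g₀)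
      (λ j → cong (λ z → if z then 0ℤ else b * ⟦ at p j ⟧) g₀)
      (backArc (g ∘ suc) p))
    (trans (cong (λ z → (1ℤ + 0ℤ) * val K (g ∘ suc) a b + 1ℤ * (back (g ∘ suc) p * z)) (grounded-val K (g ∘ suc) p))
      (e (val K (g ∘ suc) a b) (back (g ∘ suc) p * val K ((g ∘ suc) ∪ p) a b)))
    where
    e : ∀ x y → (1ℤ + 0ℤ) * x + 1ℤ * y ≡ x + y
    e = solve-∀

  val-tri : ∀ {n} (K : Graph n) c (g : Fin n → Bool) →
    val (cons (cons K (at c)) (triNbrs c)) (lift₂ g) a b ≡
    (a + b) * (a + + 3 * b) * val K g a b + + 2 * a * (a + + 3 * b) * (back g c * val K (g ∪ c) a b)
  val-tri {n} K c g = trans (D-tri n {rootW (lift₂ g) a} {arcW (cons (cons K (at c)) (triNbrs c)) (lift₂ g) b} c a b (back g c) refl refl (ℤP.*-identityʳ b) (ℤP.*-identityʳ b)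
      (λ j → cong (b *_) (⟦at⟧ c j)) (λ j → cong (b *_) (⟦at⟧ c j)) (backArc g c) (backArc g c))
    (cong (λ z → (a + b) * (a + + 3 * b) * val K g a b + + 2 * a * (a + + 3 * b) * (back g c * z)) (grounded-val K g c))

  -- Transfer matrix for one more path vertex, acting on the value of the graph and its value with
  -- the current tip grounded.
  step : ℤ × ℤ → ℤ × ℤ
  step (x , z) = (a + b) * x + a * (b * z) , x + b * z

  chain : ℕ → ℤ × ℤ → ℤ × ℤ
  chain zero    xz = xz
  chain (suc t) xz = step (chain t xz)

  -- lapD of PG βs, and the same with the centre merged into the root
  poly : List Branch → ℤ × ℤ
  poly []            = a , 1ℤ
  poly (path t ∷ βs) = let x , z = poly βs in proj₁ (chain t (x , z)) , proj₁ (chain t (z , 0ℤ))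
  poly (tri ∷ βs)    = let x , z = poly βs in
    (a + b) * (a + + 3 * b) * x + + 2 * a * (a + + 3 * b) * (b * z) , (a + b) * (a + + 3 * b) * z

val-cong : ∀ {n} (K : Graph n) {g g′} → (∀ i → g i ≡ g′ i) → ∀ a b → val K g a b ≡ val K g′ a b
val-cong {n} K {g} {g′} h a b = D-cong n {w = arcW K g b} {w′ = arcW K g′ b} (λ i → cong (λ z → if z then 1ℤ else a) (h i)) λ i j _ → cong (λ z → if z then 0ℤ else b * arc K i j) (h i)

∅ : ∀ {n} → Fin n → Bool
∅ _ = false

-- Reference graphs for branch lists and their invariants

degSum-cons : ∀ {n} (K : Graph n) N → degSum (cons K N) ≡ degSum K + + 2 * ∑ (λ i → ⟦ N i ⟧)
degSum-cons K N = trans (cong₂ _+_ (ℤP.+-identityˡ (∑ (λ i → ⟦ N i ⟧))) (∑-distrib-+ (λ i → ⟦ N i ⟧) (deg K))) (e (∑ (λ i → ⟦ N i ⟧)) (degSum K))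
  where
  e : ∀ x s → x + (x + s) ≡ s + + 2 * x
  e = solve-∀

∑-bump : ∀ {n} (f : ℤ → ℤ) (d : Fin n → ℤ) p x → ∑ (λ i → f (x * δ p i + d i)) ≡ ∑ (λ i → f (d i)) + (f (x + d p) - f (d p))
∑-bump f d p x = trans (∑-cong pt) (trans (∑-distrib-+ (λ i → f (d i)) (λ i → δ p i * (f (x + d i) - f (d i)))) (cong (_+_ (∑ (λ i → f (d i)))) (∑-δ p (λ i → f (x + d i) - f (d i)))))
  where
  e₁ : ∀ u v → u ≡ v + 1ℤ * (u - v)
  e₁ = solve-∀
  e₂ : ∀ v → v ≡ v + 0ℤ
  e₂ = solve-∀
  pt : ∀ i → f (x * δ p i + d i) ≡ f (d i) + δ p i * (f (x + d i) - f (d i))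
  pt i with p ≟ i
  ... | yes refl = trans (cong (λ z → f (z + d i)) (ℤP.*-identityʳ x)) (e₁ (f (x + d i)) (f (d i)))
  ... | no _ = trans (cong f (trans (cong (_+ d i) (ℤP.*-zeroʳ x)) (ℤP.+-identityˡ (d i)))) (e₂ (f (d i)))

∑⟦at⟧ : ∀ {n} (p : Fin n) → ∑ (λ i → ⟦ at p i ⟧) ≡ 1ℤ
∑⟦at⟧ p = trans (∑-cong λ i → trans (⟦at⟧ p i) (sym (ℤP.*-identityʳ (δ p i)))) (∑-δ p (λ _ → 1ℤ))

closed₃-cons : ∀ {n} (K : Graph n) N → closed₃ (cons K N) ≡ closed₃ K + + 3 * ∑ (λ t → ⟦ N t ⟧ * ∑ (λ k → arc K t k * ⟦ N k ⟧))
closed₃-cons K N = trans (tr₃-suc (arc (cons K N))) (e (closed₃ K) (border (arc (cons K N))) (border₂ (arc (cons K N))))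
  where
  e : ∀ x b w → x + 0ℤ * 0ℤ * 0ℤ + + 3 * 0ℤ * b + + 3 * w ≡ x + + 3 * w
  e = solve-∀

∑-at : ∀ {n} (p : Fin n) f → ∑ (λ t → ⟦ at p t ⟧ * f t) ≡ f p
∑-at p f = trans (∑-cong λ t → cong (_* f t) (⟦at⟧ p t)) (∑-δ p f)

closed₃-leaf : ∀ {n} (K : Graph n) p → closed₃ (cons K (at p)) ≡ closed₃ K
closed₃-leaf K p = trans (closed₃-cons K (at p)) (trans (cong (λ z → closed₃ K + + 3 * z)
    (trans (∑-at p (λ t → ∑ λ k → arc K t k * ⟦ at p k ⟧)) (trans (∑-cong λ k → ℤP.*-comm (arc K p k) ⟦ at p k ⟧) (trans (∑-at p (arc K p)) (arc-irrefl K p)))))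
  (ℤP.+-identityʳ (closed₃ K)))

-- A concrete graph assembled by `cons`, so that all invariants follow the recursion on branches.
-- Its degree sequence is recorded through functions vanishing at 1 and 2, the degrees found away
-- from the centre.
record Model (βs : List Branch) : Set where
  field
    {n}       : ℕ
    K         : Graph (suc n)
    c         : Fin (suc n)
    iso       : toPG K c ≃ PG βs
    n-eq      : n ≡ 2 ℕ.* tris βs ℕ.+ ListAction.sum (paths βs)
    deg-c     : deg K c ≡ + (2 ℕ.* tris βs ℕ.+ length (paths βs))
    degs      : ∀ (f : ℤ → ℤ) → f (+ 1) ≡ 0ℤ → f (+ 2) ≡ 0ℤ → ∑ (λ i → f (deg K i)) ≡ f (deg K c)
    degSum-eq : degSum K ≡ + 2 * (+ n + + tris βs)
    closed-eq : closed₃ K ≡ + 6 * + tris βs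
    value     : ∀ a b → val K ∅ a b ≡ proj₁ (poly a b βs)
    valueC    : ∀ a b → val K (at c) a b ≡ proj₂ (poly a b βs)

model-[] : Model []
model-[] = record
  { K = K₁ ; c = zero ; n-eq = refl ; deg-c = refl
  ; iso = record { to = λ _ → tt ; from = λ _ → zero ; to∘from = λ _ → refl ; from∘to = λ { zero → refl }
                 ; edge-eq = λ _ _ → refl ; isC-eq = λ { zero → refl } }
  ; degs = λ f _ _ → ℤP.+-identityʳ (f 0ℤ)
  ; degSum-eq = refl ; closed-eq = refl
  ; value = λ a b → e a ; valueC = λ a b → refl }
  where
  K₁ : Graph 1
  K₁ = record { adj = λ _ _ → false ; sym = λ _ _ → refl ; irrefl = λ _ → refl }
  e : ∀ a → a * 1ℤ + 0ℤ ≡ a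
  e = solve-∀

-- A pendant path under construction: p is its current far end.
record Chain (βs : List Branch) (t : ℕ) : Set where
  field
    {n}       : ℕ
    K         : Graph (suc n)
    c p       : Fin (suc n)
    p≢c       : p ≢ c
    iso       : toPG K c ≃ attach (path (suc t)) (PG βs)
    tip-eq    : ∀ v → at p v ≡ tip (suc t) {PG βs} (to iso v)
    n-eq      : n ≡ 2 ℕ.* tris βs ℕ.+ (suc t ℕ.+ ListAction.sum (paths βs))
    deg-c     : deg K c ≡ + (2 ℕ.* tris βs ℕ.+ suc (length (paths βs)))
    deg-p     : deg K p ≡ 1ℤ
    degs      : ∀ (f : ℤ → ℤ) → f (+ 1) ≡ 0ℤ → f (+ 2) ≡ 0ℤ → ∑ (λ i → f (deg K i)) ≡ f (deg K c)
    degSum-eq : degSum K ≡ + 2 * (+ n + + tris βs)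
    closed-eq : closed₃ K ≡ + 6 * + tris βs
    value     : ∀ a b → (val K ∅ a b , val K (at p) a b) ≡ chain a b (suc t) (poly a b βs)
    valueC    : ∀ a b → (val K (at c) a b , val K (at c ∪ p) a b) ≡ chain a b (suc t) (proj₂ (poly a b βs) , 0ℤ)

private
  sum-step : ∀ {n} (K : Graph n) p (f : ℤ → ℤ) → ∑ (λ i → f (deg (cons K (at p)) i)) ≡ f 1ℤ + (∑ (λ i → f (deg K i)) + (f (1ℤ + deg K p) - f (deg K p)))
  sum-step K p f = cong₂ _+_ (cong f (trans (ℤP.+-identityˡ (∑ (λ i → ⟦ at p i ⟧))) (∑⟦at⟧ p)))
    (trans (∑-cong λ i → cong (λ z → f (z + deg K i)) (trans (⟦at⟧ p i) (sym (ℤP.*-identityˡ (δ p i))))) (∑-bump f (deg K) p 1ℤ))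

  degSum-step : ∀ {n} (K : Graph n) p m s → degSum K ≡ + 2 * (+ m + s) → degSum (cons K (at p)) ≡ + 2 * (+ suc m + s)
  degSum-step K p m s h = trans (degSum-cons K (at p)) (trans (cong₂ (λ x y → x + + 2 * y) h (∑⟦at⟧ p)) (e (+ m) s))
    where
    e : ∀ m s → + 2 * (m + s) + + 2 * 1ℤ ≡ + 2 * ((1ℤ + m) + s)
    e = solve-∀

chain-start : ∀ {βs} → Model βs → Chain βs 0
chain-start {βs} M = record
  { K = cons K (at c) ; c = suc c ; p = zero ; p≢c = λ ()
  ; iso = ≃-trans (cons-≃ K (at c) c) (≃-trans (ext-cong {N′ = isC (PG βs)} iso (isC-eq iso)) ext-centre)
  ; tip-eq = λ { zero → refl ; (suc v) → refl }
  ; n-eq = trans (cong suc n-eq) (sym (ℕP.+-suc (2 ℕ.* tris βs) _))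
  ; deg-c = trans (cong₂ _+_ (trans (⟦at⟧ c c) (δ-refl c)) deg-c) (cong +_ (sym (ℕP.+-suc (2 ℕ.* tris βs) _)))
  ; deg-p = trans (ℤP.+-identityˡ (∑ (λ i → ⟦ at c i ⟧))) (∑⟦at⟧ c)
  ; degs = λ f f₁ f₂ → trans (sum-step K c f) (trans (cong₂ (λ x y → x + (y + (f (1ℤ + deg K c) - f (deg K c)))) f₁ (degs f f₁ f₂))
      (trans (e (f (deg K c)) (f (1ℤ + deg K c))) (cong (λ z → f (z + deg K c)) (sym (trans (⟦at⟧ c c) (δ-refl c))))))
  ; degSum-eq = degSum-step K c n (+ tris βs) degSum-eq
  ; closed-eq = trans (closed₃-leaf K c) closed-eq
  ; value = λ a b → cong₂ _,_
      (trans (val-leaf a b K c ∅ refl) (cong₂ (λ x z → (a + b) * x + a * (b * z)) (value a b) (trans (∅∪c a b) (valueC a b))))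
      (trans (val-leaf-grounded a b K c (at zero) refl) (cong₂ (λ x z → x + b * z) (value a b) (trans (∅∪c a b) (valueC a b))))
  -- The centre is grounded already and sends no arc to the new vertex; hence the second component 0
  -- of the starting pair.
  ; valueC = λ a b → cong₂ _,_
      (trans (val-leaf a b K c (at (suc c)) refl) (trans (cong (λ z → (a + b) * val K (at c) a b + a * (z * val K (at c ∪ c) a b)) (back-c a b))
        (trans (cong (λ x → (a + b) * x + a * 0ℤ) (valueC a b)) (cong (λ z → (a + b) * proj₂ (poly a b βs) + a * z) (sym (ℤP.*-zeroʳ b))))))
      (trans (val-leaf-grounded a b K c (at (suc c) ∪ zero) refl) (trans (cong (λ z → val K (at c) a b + z * val K (at c ∪ c) a b) (back-c a b))
        (cong₂ _+_ (valueC a b) (sym (ℤP.*-zeroʳ b))))) }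
  where
  open Model M
  e : ∀ x y → 0ℤ + (x + (y - x)) ≡ y
  e = solve-∀
  ∅∪c : ∀ a b → val K (∅ ∪ c) a b ≡ val K (at c) a b
  ∅∪c = val-cong K λ i → BoolP.∨-identityʳ (at c i)
  back-c : ∀ a b → back a b (at c) c ≡ 0ℤ
  back-c a b = cong (λ z → if z then 0ℤ else b) (dec-true (c ≟ c) refl)

chain-step : ∀ {βs t} → Chain βs t → Chain βs (suc t)
chain-step {βs} {t} M = record
  { K = cons K (at p) ; c = suc c ; p = zero ; p≢c = λ ()
  ; iso = ≃-trans (cons-≃ K (at p) c) (≃-trans (ext-cong {N′ = tip (suc t) {PG βs}} iso tip-eq) (ext-path (suc t)))
  ; tip-eq = λ { zero → refl ; (suc v) → far (to iso v) }
  ; n-eq = trans (cong suc n-eq) (sym (ℕP.+-suc (2 ℕ.* tris βs) _))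
  ; deg-c = trans (cong₂ _+_ (trans (⟦at⟧ p c) (δ-≢ p≢c)) deg-c) (ℤP.+-identityˡ _)
  ; deg-p = trans (ℤP.+-identityˡ (∑ (λ i → ⟦ at p i ⟧))) (∑⟦at⟧ p)
  -- The old tip passes from degree 1 to degree 2 and the new tip has degree 1, where f vanishes.
  ; degs = λ f f₁ f₂ → trans (sum-step K p f) (trans (cong₂ (λ x y → x + (y + (f (1ℤ + deg K p) - f (deg K p)))) f₁ (degs f f₁ f₂))
      (trans (cong (λ z → 0ℤ + (f (deg K c) + (f (1ℤ + z) - f z))) deg-p) (trans (cong₂ (λ x y → 0ℤ + (f (deg K c) + (x - y))) f₂ f₁)
        (trans (e (f (deg K c))) (cong f (trans (sym (ℤP.+-identityˡ (deg K c))) (cong (_+ deg K c) (sym (trans (⟦at⟧ p c) (δ-≢ p≢c))))))))))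
  ; degSum-eq = degSum-step K p n (+ tris βs) degSum-eq
  ; closed-eq = trans (closed₃-leaf K p) closed-eq
  ; value = λ a b → cong₂ _,_
      (trans (val-leaf a b K p ∅ refl) (cong₂ (λ x z → (a + b) * x + a * (b * z)) (cong proj₁ (value a b)) (trans (∅∪p a b) (cong proj₂ (value a b)))))
      (trans (val-leaf-grounded a b K p (at zero) refl) (cong₂ (λ x z → x + b * z) (cong proj₁ (value a b)) (trans (∅∪p a b) (cong proj₂ (value a b)))))
  ; valueC = λ a b → cong₂ _,_
      (trans (val-leaf a b K p (at (suc c)) refl) (trans (cong (λ z → (a + b) * val K (at c) a b + a * (z * val K (at c ∪ p) a b)) (back-p a b))
        (cong₂ (λ x z → (a + b) * x + a * (b * z)) (cong proj₁ (valueC a b)) (cong proj₂ (valueC a b)))))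
      (trans (val-leaf-grounded a b K p (at (suc c) ∪ zero) refl) (trans (cong (λ z → val K (at c) a b + z * val K (at c ∪ p) a b) (back-p a b))
        (cong₂ (λ x z → x + b * z) (cong proj₁ (valueC a b)) (cong proj₂ (valueC a b))))) }
  where
  open Chain M
  e : ∀ x → 0ℤ + (x + (0ℤ - 0ℤ)) ≡ x
  e = solve-∀
  far : ∀ (v : V (attach (path (suc t)) (PG βs))) → false ≡ tip (suc (suc t)) {PG βs} (to (ext-path (suc t) {PG βs}) (just v))
  far (inj₁ i) = refl
  far (inj₂ v) = refl
  ∅∪p : ∀ a b → val K (∅ ∪ p) a b ≡ val K (at p) a b
  ∅∪p = val-cong K λ i → BoolP.∨-identityʳ (at p i)
  back-p : ∀ a b → back a b (at c) p ≡ b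
  back-p a b = cong (λ z → if z then 0ℤ else b) (dec-false (p ≟ c) p≢c)

chain-build : ∀ {βs} t → Model βs → Chain βs t
chain-build zero    M = chain-start M
chain-build (suc t) M = chain-step (chain-build t M)

model-path : ∀ {βs} t → Model βs → Model (path (suc t) ∷ βs)
model-path t M = record
  { K = K ; c = c ; iso = iso ; n-eq = n-eq ; deg-c = deg-c ; degs = degs ; degSum-eq = degSum-eq ; closed-eq = closed-eq
  ; value = λ a b → cong proj₁ (value a b) ; valueC = λ a b → cong proj₁ (valueC a b) }
  where open Chain (chain-build t M)

model-tri : ∀ {βs} → Model βs → Model (tri ∷ βs)
model-tri {βs} M = record
  { K = K₂ ; c = suc (suc c)
  ; iso = ≃-trans (cons-≃ K₁ N (suc c)) (≃-trans (ext-cong {N′ = closing {PG βs}} iso₁ N-eq) ext-tri)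
  ; n-eq = trans (cong (2 ℕ.+_) n-eq) (cong (ℕ._+ ListAction.sum (paths βs)) (sym (ℕP.*-suc 2 (tris βs))))
  ; deg-c = trans deg-c₂ (trans (cong (_+_ (+ 2)) deg-c) (cong +_ (cong (ℕ._+ length (paths βs)) (sym (ℕP.*-suc 2 (tris βs))))))
  ; degs = λ f f₁ f₂ → trans (cong₂ _+_ (trans (cong f deg₀) f₂) (cong₂ _+_ (trans (cong f deg₁) f₂) (trans (∑-cong λ i → cong f (degᵢ i)) (∑-bump f (deg K) c (+ 2)))))
      (trans (cong (λ z → 0ℤ + (0ℤ + (z + (f (+ 2 + deg K c) - f (deg K c))))) (degs f f₁ f₂)) (trans (e (f (deg K c)) (f (+ 2 + deg K c))) (cong f (sym deg-c₂))))
  ; degSum-eq = trans (degSum-cons K₁ N) (trans (cong₂ (λ x y → x + + 2 * (1ℤ + y)) (degSum-step K c n (+ tris βs) degSum-eq) (∑⟦at⟧ c)) (e₂ (+ n) (+ tris βs)))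
  ; closed-eq = trans (closed₃-cons K₁ N) (trans (cong₂ (λ x y → x + + 3 * y) (trans (closed₃-leaf K c) closed-eq) walks) (e₃ (+ tris βs)))
  ; value = λ a b → trans (val-cong K₂ {∅} {lift₂ ∅} (λ { zero → refl ; (suc zero) → refl ; (suc (suc i)) → refl }) a b)
      (trans (val-tri a b K c ∅) (cong₂ (λ x z → (a + b) * (a + + 3 * b) * x + + 2 * a * (a + + 3 * b) * (b * z)) (value a b) (trans (∅∪c a b) (valueC a b))))
  ; valueC = λ a b → trans (val-cong K₂ {at (suc (suc c))} {lift₂ (at c)} (λ { zero → refl ; (suc zero) → refl ; (suc (suc i)) → refl }) a b)
      (trans (val-tri a b K c (at c)) (trans (cong (λ z → (a + b) * (a + + 3 * b) * val K (at c) a b + + 2 * a * (a + + 3 * b) * (z * val K (at c ∪ c) a b)) (back-c a b))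
        (trans (cong₂ _+_ (cong ((a + b) * (a + + 3 * b) *_) (valueC a b)) (ℤP.*-zeroʳ (+ 2 * a * (a + + 3 * b)))) (ℤP.+-identityʳ ((a + b) * (a + + 3 * b) * proj₂ (poly a b βs)))))) }
  where
  open Model M
  K₁ = cons K (at c)
  N : Fin (2 ℕ.+ n) → Bool
  N = triNbrs c
  K₂ = cons K₁ N
  iso₁ : toPG K₁ (suc c) ≃ attach (path 1) (PG βs)
  iso₁ = Chain.iso (chain-start M)
  N-eq : ∀ v → N v ≡ closing {PG βs} (to iso₁ v)
  N-eq zero    = refl
  N-eq (suc v) = isC-eq iso v
  ∅∪c : ∀ a b → val K (∅ ∪ c) a b ≡ val K (at c) a b
  ∅∪c = val-cong K λ i → BoolP.∨-identityʳ (at c i)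
  back-c : ∀ a b → back a b (at c) c ≡ 0ℤ
  back-c a b = cong (λ z → if z then 0ℤ else b) (dec-true (c ≟ c) refl)
  e : ∀ x y → 0ℤ + (0ℤ + (x + (y - x))) ≡ y
  e = solve-∀
  e₂ : ∀ n s → + 2 * ((1ℤ + n) + s) + + 2 * (1ℤ + 1ℤ) ≡ + 2 * ((+ 2 + n) + (1ℤ + s))
  e₂ = solve-∀
  e₃ : ∀ s → + 6 * s + + 3 * + 2 ≡ + 6 * (1ℤ + s)
  e₃ = solve-∀
  deg-c₂ : deg K₂ (suc (suc c)) ≡ + 2 + deg K c
  deg-c₂ = trans (cong (λ z → z + (z + deg K c)) (trans (⟦at⟧ c c) (δ-refl c))) (sym (ℤP.+-assoc 1ℤ 1ℤ (deg K c)))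
  deg₀ : deg K₂ zero ≡ + 2
  deg₀ = cong (λ z → 0ℤ + (1ℤ + z)) (∑⟦at⟧ c)
  deg₁ : deg K₂ (suc zero) ≡ + 2
  deg₁ = cong (λ z → 1ℤ + (0ℤ + z)) (∑⟦at⟧ c)
  degᵢ : ∀ i → deg K₂ (suc (suc i)) ≡ + 2 * δ c i + deg K i
  degᵢ i = trans (cong (λ z → z + (z + deg K i)) (⟦at⟧ c i)) (e₄ (δ c i) (deg K i))
    where
    e₄ : ∀ z d → z + (z + d) ≡ + 2 * z + d
    e₄ = solve-∀
  walks : ∑ (λ t → ⟦ N t ⟧ * ∑ (λ k → arc K₁ t k * ⟦ N k ⟧)) ≡ + 2
  walks = cong₂ _+_
    (trans (ℤP.*-identityˡ (∑ (λ k → arc K₁ zero k * ⟦ N k ⟧))) (trans (ℤP.+-identityˡ (∑ (λ k → ⟦ at c k ⟧ * ⟦ at c k ⟧)))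
      (trans (∑-at c (λ k → ⟦ at c k ⟧)) (trans (⟦at⟧ c c) (δ-refl c)))))
    (trans (∑-at c (λ t → ⟦ at c t ⟧ * 1ℤ + ∑ (λ k → arc K t k * ⟦ at c k ⟧)))
      (cong₂ _+_ (trans (ℤP.*-identityʳ ⟦ at c c ⟧) (trans (⟦at⟧ c c) (δ-refl c)))
        (trans (∑-cong λ k → ℤP.*-comm (arc K c k) ⟦ at c k ⟧) (trans (∑-at c (arc K c)) (arc-irrefl K c)))))

model : ∀ βs → Positive βs → Model βs
model []                 _             = model-[]
model (tri ∷ βs)         pos           = model-tri (model βs pos)
model (path (suc t) ∷ βs) (_ ∷ pos)    = model-path t (model βs pos)

-- Recovering the path lengths

-- With a = (1 − y)² and b = y the elimination step for a path has eigenvalues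
-- 1 and y², so a path of length t multiplies by polynomials in y²ᵗ.

pow : ℤ → ℕ → ℤ
pow y t = (y * y) ^ t

-- The effect of a path on the pair x and y(1 - y)z, multiplied by the denominator 1 + y. In these
-- coordinates the matrices are triangular with equal diagonal entries, so they commute.
branch : ℤ → ℕ → ℤ × ℤ → ℤ × ℤ
branch y t (A , B) = (1ℤ + y * pow y t) * A + (1ℤ - pow y t) * B , (1ℤ + y * pow y t) * B

branches : ℤ → List ℕ → ℤ × ℤ → ℤ × ℤ
branches y []       p = p
branches y (t ∷ ts) p = branch y t (branches y ts p)

branch-comm : ∀ y t u p → branch y t (branch y u p) ≡ branch y u (branch y t p)
branch-comm y t u (A , B) = cong₂ _,_ (e₁ y (pow y t) (pow y u) A B) (e₂ y (pow y t) (pow y u) B)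
  where
  e₁ : ∀ y t u A B → (1ℤ + y * t) * ((1ℤ + y * u) * A + (1ℤ - u) * B) + (1ℤ - t) * ((1ℤ + y * u) * B)
                   ≡ (1ℤ + y * u) * ((1ℤ + y * t) * A + (1ℤ - t) * B) + (1ℤ - u) * ((1ℤ + y * t) * B)
  e₁ = solve-∀
  e₂ : ∀ y t u B → (1ℤ + y * t) * ((1ℤ + y * u) * B) ≡ (1ℤ + y * u) * ((1ℤ + y * t) * B)
  e₂ = solve-∀

branches-↭ : ∀ y {ts us} p → ts ↭ us → branches y ts p ≡ branches y us p
branches-↭ y p ListPerm.refl = refl
branches-↭ y p (prep t h) = cong (branch y t) (branches-↭ y p h)
branches-↭ y p (swap t u h) = trans (branch-comm y t u _) (cong (branch y u ∘ branch y t) (branches-↭ y p h))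
branches-↭ y p (ListPerm.trans h k) = trans (branches-↭ y p h) (branches-↭ y p k)

branches-inner : ∀ y t ts p → branches y (t ∷ ts) p ≡ branches y ts (branch y t p)
branches-inner y t []       p = refl
branches-inner y t (u ∷ ts) p = trans (branch-comm y t u (branches y ts p)) (cong (branch y u) (branches-inner y t ts p))

count : ℕ → List ℕ → ℕ
count a []       = 0
count a (t ∷ ts) with t ℕ.≟ a
... | yes _ = suc (count a ts)
... | no _  = count a ts

count-head : ∀ a ts → count a (a ∷ ts) ≡ suc (count a ts)
count-head a ts with a ℕ.≟ a
... | yes _  = refl
... | no a≢a = contradiction refl a≢a

count-skip : ∀ {a t} ts → t ≢ a → count a (t ∷ ts) ≡ count a ts
count-skip {a} {t} ts t≢a with t ℕ.≟ a
... | yes t≡a = contradiction t≡a t≢a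
... | no _    = refl

count>0⇒∈ : ∀ a ts → 1 ℕ.≤ count a ts → a ∈ ts
count>0⇒∈ a (t ∷ ts) h with t ℕ.≟ a
... | yes refl = here refl
... | no _     = there (count>0⇒∈ a ts h)

∈⇒count>0 : ∀ {a ts} → a ∈ ts → 1 ℕ.≤ count a ts
∈⇒count>0 {a} {t ∷ ts} h with t ℕ.≟ a
∈⇒count>0 h | yes _ = s≤s z≤n
∈⇒count>0 (here refl) | no a≢a = contradiction refl a≢a
∈⇒count>0 (there h)   | no _   = ∈⇒count>0 h

≈-modulus : ∀ {a b m m′} → m ≡ m′ → a ≈ b [ m ] → a ≈ b [ m′ ]
≈-modulus refl h = h

-- As `pow y (suc d)` is divisible by y², to this order a path adds B ≈ y to A and leaves B alone,
-- whatever its length.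
branch-low : ∀ y d {α₁ A B} → A ≈ 1ℤ + α₁ * y [ y * y ] → B ≈ y - y * y [ y * (y * y) ] →
  let A′ , B′ = branch y (suc d) (A , B) in A′ ≈ 1ℤ + (α₁ + 1ℤ) * y [ y * y ] × B′ ≈ y - y * y [ y * (y * y) ]
branch-low y d {α₁} (modulo q refl) (modulo r refl) = modulo _ (eα y α₁ q r (pow y d)) , modulo _ (eβ y r (pow y d))
  where
  eα : ∀ y α q r u → (1ℤ + y * (y * y * u)) * (1ℤ + α * y + y * y * q) + (1ℤ - y * y * u) * (y - y * y + y * (y * y) * r)
     ≡ 1ℤ + (α + 1ℤ) * y + y * y * (q + y * u * (1ℤ + α * y + y * y * q) + - 1ℤ + y * r - u * (y - y * y + y * (y * y) * r))
  eα = solve-∀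
  eβ : ∀ y r u → (1ℤ + y * (y * y * u)) * (y - y * y + y * (y * y) * r) ≡ y - y * y + y * (y * y) * (r + u * (y - y * y + y * (y * y) * r))
  eβ = solve-∀

module _ (y α₁ α β : ℤ) (α-low : α ≈ 1ℤ + α₁ * y [ y * y ]) (β-low : β ≈ y - y * y [ y * (y * y) ]) where

  -- the expansion modulo y²ᵃ⁺³ when no path is shorter than a = suc d
  record Expansion (d : ℕ) (ts : List ℕ) : Set where
    constructor expand
    M = y * y * pow y (suc d)
    k = + length ts
    c = + count (suc d) ts
    A = proj₁ (branches y ts (α , β))
    B = proj₂ (branches y ts (α , β))
    field
      A-high : A ≈ α + k * β + c * (α₁ + k) * M [ M * y ]
      B-high : B ≈ β + c * M [ M * y ]
      A-low  : A ≈ 1ℤ + (α₁ + k) * y [ y * y ]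
      B-low  : B ≈ y - y * y [ y * (y * y) ]

  branch-sum : ∀ p A B → (1ℤ + y * p) * A + (1ℤ - p) * B ≡ A + B + p * (y * A - B)
  branch-sum = go y
    where
    go : ∀ y p A B → (1ℤ + y * p) * A + (1ℤ - p) * B ≡ A + B + p * (y * A - B)
    go = solve-∀

  branch-sum₂ : ∀ p B → (1ℤ + y * p) * B ≡ B + p * (y * B)
  branch-sum₂ = go y
    where
    go : ∀ y p B → (1ℤ + y * p) * B ≡ B + p * (y * B)
    go = solve-∀

  -- The new A is A + B + p(yA - B) with p = y²ᵗ. The low orders give yA - B = (α₁ + k + 1)y² modulo
  -- y³, with k the paths already present; so a path of length a contributes at order y²ᵃ⁺², while
  -- the correction of a longer one is divisible by y²ᵃ⁺³.
  expansion : ∀ d ts → All (suc d ℕ.≤_) ts → Expansion d ts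
  expansion d [] [] = expand (≈-reflexive (e₁ α β α₁ (y * y * pow y (suc d)))) (≈-reflexive (e₂ β (y * y * pow y (suc d))))
      (≈-trans α-low (≈-reflexive (e₃ α₁ y))) β-low
    where
    e₁ : ∀ α β α₁ m → α ≡ α + 0ℤ * β + 0ℤ * (α₁ + 0ℤ) * m
    e₁ = solve-∀
    e₂ : ∀ β m → β ≡ β + 0ℤ * m
    e₂ = solve-∀
    e₃ : ∀ α y → 1ℤ + α * y ≡ 1ℤ + (α + 0ℤ) * y
    e₃ = solve-∀
  expansion d (zero ∷ ts) (() ∷ h)
  expansion d (suc t ∷ ts) (d≤t ∷ h) with suc t ℕ.≟ suc d | expansion d ts h
  ... | yes refl | expand hA hB lA lB = expand
      (≈-trans (≈-reflexive (branch-sum p A₀ B₀)) (≈-trans (≈-+ (≈-+ hA hB) (≈-modulus (e₂ y p) (≈-scale p (difference lA lB)))) (≈-reflexive (trans (e₁ α β α₁ k₀ c₀ y p) (cong (λ n → α + (1ℤ + k₀) * β + + n * (α₁ + (1ℤ + k₀)) * (y * y * p)) (sym (count-head (suc d) ts)))))))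
      (≈-trans (≈-reflexive (branch-sum₂ p B₀)) (≈-trans (≈-+ hB (≈-modulus (e₂ y p) (≈-scale p (scaled lB)))) (≈-reflexive (trans (e₃ β c₀ y p) (cong (λ n → β + + n * (y * y * p)) (sym (count-head (suc d) ts)))))))
      (≈-trans (proj₁ low) (≈-reflexive (e₄ α₁ k₀ y))) (proj₂ low)
    where
    p = pow y (suc d)
    A₀ = proj₁ (branches y ts (α , β))
    B₀ = proj₂ (branches y ts (α , β))
    k₀ = + length ts
    c₀ = + count (suc d) ts
    low = branch-low y d {α₁ + k₀} lA lB
    difference : A₀ ≈ 1ℤ + (α₁ + k₀) * y [ y * y ] → B₀ ≈ y - y * y [ y * (y * y) ] → y * A₀ - B₀ ≈ (α₁ + k₀ + 1ℤ) * (y * y) [ y * (y * y) ]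
    difference hA hB = ≈-trans (≈-+ (≈-scale y hA) (≈-neg hB)) (≈-reflexive (e (α₁ + k₀) y))
      where
      e : ∀ a y → y * (1ℤ + a * y) + - (y - y * y) ≡ (a + 1ℤ) * (y * y)
      e = solve-∀
    scaled : B₀ ≈ y - y * y [ y * (y * y) ] → y * B₀ ≈ y * y [ y * (y * y) ]
    scaled (modulo r eq) = modulo (- 1ℤ + y * r) (trans (cong (y *_) eq) (e y r))
      where
      e : ∀ y r → y * (y - y * y + y * (y * y) * r) ≡ y * y + y * (y * y) * (- 1ℤ + y * r)
      e = solve-∀
    e₁ : ∀ α β α₁ k c y p → α + k * β + c * (α₁ + k) * (y * y * p) + (β + c * (y * y * p)) + p * ((α₁ + k + 1ℤ) * (y * y))
       ≡ α + (1ℤ + k) * β + (1ℤ + c) * (α₁ + (1ℤ + k)) * (y * y * p)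
    e₁ = solve-∀
    e₂ : ∀ y p → p * (y * (y * y)) ≡ y * y * p * y
    e₂ = solve-∀
    e₃ : ∀ β c y p → β + c * (y * y * p) + p * (y * y) ≡ β + (1ℤ + c) * (y * y * p)
    e₃ = solve-∀
    e₄ : ∀ a k y → 1ℤ + (a + k + 1ℤ) * y ≡ 1ℤ + (a + (1ℤ + k)) * y
    e₄ = solve-∀
  ... | no t≢ | expand hA hB lA lB = expand
      (≈-trans (≈-reflexive (branch-sum (pow y (suc t)) A₀ B₀)) (≈-trans (≈-+ (≈-+ hA hB) (negligible (difference lB))) (≈-reflexive (trans (e₁ α β α₁ k₀ c₀ (y * y * p)) (cong (λ n → α + (1ℤ + k₀) * β + + n * (α₁ + (1ℤ + k₀)) * (y * y * p)) (sym (count-skip ts t≢)))))))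
      (≈-trans (≈-reflexive (branch-sum₂ (pow y (suc t)) B₀)) (≈-trans (≈-+ hB (negligible (modulo B₀ (sym (ℤP.+-identityˡ (y * B₀)))))) (≈-reflexive (trans (ℤP.+-identityʳ (β + c₀ * (y * y * p))) (cong (λ n → β + + n * (y * y * p)) (sym (count-skip ts t≢)))))))
      (≈-trans (proj₁ low) (≈-reflexive (e₄ α₁ k₀ y))) (proj₂ low)
    where
    p = pow y (suc d)
    A₀ = proj₁ (branches y ts (α , β))
    B₀ = proj₂ (branches y ts (α , β))
    k₀ = + length ts
    c₀ = + count (suc d) ts
    low = branch-low y t {α₁ + k₀} lA lB
    excess : ∃ λ l → suc t ≡ suc d ℕ.+ suc l
    excess = let l , e = ℕP.m≤n⇒∃[o]m+o≡n (ℕP.≤∧≢⇒< d≤t (t≢ ∘ sym)) in l , trans (sym e) (cong suc (sym (ℕP.+-suc d l)))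
    w = pow y (proj₁ excess)
    split : pow y (suc t) ≡ p * (y * y * w)
    split = trans (cong (pow y) (proj₂ excess)) (ℤP.^-distribˡ-+-* (y * y) (suc d) (suc (proj₁ excess)))
    difference : B₀ ≈ y - y * y [ y * (y * y) ] → y * A₀ - B₀ ≈ 0ℤ [ y ]
    difference (modulo r eq) = modulo (A₀ - (1ℤ - y + y * y * r)) (trans (cong (λ z → y * A₀ - z) eq) (e y A₀ r))
      where
      e : ∀ y A r → y * A - (y - y * y + y * (y * y) * r) ≡ 0ℤ + y * (A - (1ℤ - y + y * y * r))
      e = solve-∀
    negligible : ∀ {z} → z ≈ 0ℤ [ y ] → pow y (suc t) * z ≈ 0ℤ [ y * y * p * y ]
    negligible (modulo q refl) = modulo (w * q) (trans (cong (_* (0ℤ + y * q)) split) (e y p w q))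
      where
      e : ∀ y p w q → p * (y * y * w) * (0ℤ + y * q) ≡ 0ℤ + y * y * p * y * (w * q)
      e = solve-∀
    e₁ : ∀ α β α₁ k c m → α + k * β + c * (α₁ + k) * m + (β + c * m) + 0ℤ ≡ α + (1ℤ + k) * β + c * (α₁ + (1ℤ + k)) * m
    e₁ = solve-∀
    e₄ : ∀ a k y → 1ℤ + (a + k + 1ℤ) * y ≡ 1ℤ + (a + (1ℤ + k)) * y
    e₄ = solve-∀

minimum : ∀ x xs → ∃ λ m → m ∈ x ∷ xs × All (m ℕ.≤_) (x ∷ xs)
minimum x [] = x , here refl , ℕP.≤-refl ∷ []
minimum x (z ∷ xs) with minimum z xs
... | m , m∈ , h with x ℕ.≤? m
...   | yes x≤m = x , here refl , ℕP.≤-refl ∷ All.map (ℕP.≤-trans x≤m) h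
...   | no x≰m  = m , there m∈ , ℕP.<⇒≤ (ℕP.≰⇒> x≰m) ∷ h

1≤pow : ∀ y t → 1ℤ ≤ y → 1ℤ ≤ pow y t
1≤pow y zero    h = ℤP.≤-refl
1≤pow y (suc t) h = 1≤* (1≤* h h) (1≤pow y t h)

-- The contribution of the graph apart from the listed paths, known to the orders that `expansion`
-- asks for.
record Base (α₁ : ℤ) : Set where
  field
    α β : ℤ → ℤ
    α-eq : ∀ y → α y ≈ 1ℤ + α₁ * y [ y * y ]
    β-eq : ∀ y → β y ≈ y - y * y [ y * (y * y) ]

SameBranches : ∀ {α₁} → Base α₁ → List ℕ → List ℕ → Set
SameBranches base ts us = let open Base base in
  ∀ j → let y = + suc j in proj₁ (branches y ts (α y , β y)) ≡ proj₁ (branches y us (α y , β y))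

module _ {α₁} (base : Base α₁) (d : ℕ) (ts us : List ℕ) (len : length ts ≡ length us)
         (hts : All (suc d ℕ.≤_) ts) (hus : All (suc d ℕ.≤_) us) where
  open Base base
  private
    K = α₁ + + length ts

  count-≈ : ∀ y → 1ℤ ≤ y → proj₁ (branches y ts (α y , β y)) ≡ proj₁ (branches y us (α y , β y)) →
            + count (suc d) ts * K ≈ + count (suc d) us * K [ y ]
  count-≈ y 1≤y same = ≈-cancel m (1≤* {y * y} {pow y (suc d)} (1≤* 1≤y 1≤y) (1≤pow y (suc d) 1≤y))
      (tidy (α y + + length ts * β y) (+ count (suc d) ts * K) (+ count (suc d) us * K) both)
    where
    m = y * y * pow y (suc d)
    high : ∀ zs → All (suc d ℕ.≤_) zs → proj₁ (branches y zs (α y , β y)) ≈ α y + + length zs * β y + + count (suc d) zs * (α₁ + + length zs) * m [ m * y ]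
    high zs hzs = Expansion.A-high (expansion y α₁ (α y) (β y) (α-eq y) (β-eq y) d zs hzs)
    both : α y + + length ts * β y + + count (suc d) ts * K * m ≈ α y + + length ts * β y + + count (suc d) us * K * m [ m * y ]
    both = ≈-trans (≈-sym (high ts hts)) (≈-trans (≈-reflexive same)
      (subst (λ k → proj₁ (branches y us (α y , β y)) ≈ α y + + k * β y + + count (suc d) us * (α₁ + + k) * m [ m * y ]) (sym len) (high us hus)))
    tidy : ∀ x a b → x + a * m ≈ x + b * m [ m * y ] → m * a ≈ m * b [ m * y ]
    tidy x a b (modulo z eq) = modulo z (trans (e₁ m x a) (trans (cong (_- x) eq) (e₂ m x b (m * y * z))))
      where
      e₁ : ∀ M x a → M * a ≡ x + a * M - x
      e₁ = solve-∀
      e₂ : ∀ M x b z → x + b * M + z - x ≡ M * b + z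
      e₂ = solve-∀

  -- In `A-high` the two lists can differ only in the number of paths of length suc d, whose
  -- coefficient `K` is then cancelled.
  count-eq : K ≢ 0ℤ → SameBranches base ts us → count (suc d) ts ≡ count (suc d) us
  count-eq nz same = ℤP.+-injective (ℤP.*-cancelʳ-≡ (+ count (suc d) ts) (+ count (suc d) us) K {{≢-nonZero nz}}
    (≈-all λ j → count-≈ (+ suc j) (+≤+ (s≤s z≤n)) (same j)))

-- A matched path moves into the base: α₁ rises by 1 while the list loses an entry, so the sum whose
-- nonvanishing `count-eq` needs is preserved.
extend : ∀ {α₁} → Base α₁ → ℕ → Base (α₁ + 1ℤ)
extend {α₁} base d = record
  { α    = λ y → proj₁ (branch y (suc d) (α y , β y))
  ; β    = λ y → proj₂ (branch y (suc d) (α y , β y))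
  ; α-eq = λ y → proj₁ (branch-low y d {α₁} (α-eq y) (β-eq y))
  ; β-eq = λ y → proj₂ (branch-low y d {α₁} (α-eq y) (β-eq y)) }
  where open Base base

∈⇒↭ : ∀ {m} {ts : List ℕ} → m ∈ ts → ∃ λ us → ts ↭ m ∷ us
∈⇒↭ {m} h with ∈-∃++ h
... | xs , zs , refl = xs ++ zs , shift m xs zs

-- The least length in either list occurs equally often in both. One copy is taken from each into
-- the base, and the shorter lists are compared.
branches-injective : ∀ k {α₁} (base : Base α₁) ts us → length ts ≡ k → length us ≡ k → All (1 ℕ.≤_) ts → All (1 ℕ.≤_) us →
  α₁ + + k ≢ 0ℤ → SameBranches base ts us → ts ↭ us
branches-injective zero base [] [] _ _ _ _ _ _ = ↭-refl
branches-injective (suc k) {α₁} base (t ∷ ts) us lt lu pt pu nz same with minimum t (ts ++ us)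
... | zero , m∈ , h = case All.lookup (AllP.++⁺ pt pu) m∈ of λ ()
... | suc d , m∈ , h with AllP.++⁻ (t ∷ ts) h
...   | hts , hus = go (∈⇒↭ (proj₁ both)) (∈⇒↭ (proj₂ both))
  where
  counts : count (suc d) (t ∷ ts) ≡ count (suc d) us
  counts = count-eq base d (t ∷ ts) us (trans lt (sym lu)) hts hus (subst (λ z → α₁ + + z ≢ 0ℤ) (sym lt) nz) same
  both : suc d ∈ t ∷ ts × suc d ∈ us
  both with ∈-++⁻ (t ∷ ts) m∈
  ... | inj₁ i = i , count>0⇒∈ (suc d) us (subst (1 ℕ.≤_) counts (∈⇒count>0 i))
  ... | inj₂ i = count>0⇒∈ (suc d) (t ∷ ts) (subst (1 ℕ.≤_) (sym counts) (∈⇒count>0 i)) , i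
  go : (∃ λ ts′ → t ∷ ts ↭ suc d ∷ ts′) → (∃ λ us′ → us ↭ suc d ∷ us′) → t ∷ ts ↭ us
  go (ts′ , p) (us′ , p′) = ↭-trans p (↭-trans (prep (suc d) (branches-injective k (extend base d) ts′ us′
      (ℕP.suc-injective (trans (sym (↭-length p)) lt)) (ℕP.suc-injective (trans (sym (↭-length p′)) lu))
      (All.tail (All-resp-↭ p pt)) (All.tail (All-resp-↭ p′ pu))
      (λ e → nz (trans (e₀ α₁ (+ k)) e)) same′)) (↭-sym p′))
    where
    open Base base
    e₀ : ∀ a k → a + (1ℤ + k) ≡ a + 1ℤ + k
    e₀ = solve-∀
    same′ : SameBranches (extend base d) ts′ us′
    same′ j = let y = + suc j in trans (cong proj₁ (sym (trans (branches-↭ y (α y , β y) p) (branches-inner y (suc d) ts′ (α y , β y)))))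
      (trans (same j) (cong proj₁ (trans (branches-↭ y (α y , β y) p′) (branches-inner y (suc d) us′ (α y , β y)))))

-- Powers of the step matrix from its eigenvalues 1 and y²; the factors 1 + y and (1 + y)(1 - y)
-- clear the denominators.
chain-closed : ∀ y t x z → let X , Z = chain ((1ℤ - y) * (1ℤ - y)) y t (x , z) ; u = pow y t in
  (1ℤ + y) * X ≡ (1ℤ + y * u) * x + (1ℤ - u) * (y * (1ℤ - y) * z) ×
  (1ℤ + y) * (1ℤ - y) * Z ≡ (1ℤ - u) * x + (1ℤ - y) * (y + u) * z
chain-closed y zero x z = e₁ y x z , e₂ y x z
  where
  e₁ : ∀ y x z → (1ℤ + y) * x ≡ (1ℤ + y * 1ℤ) * x + (1ℤ - 1ℤ) * (y * (1ℤ - y) * z)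
  e₁ = solve-∀
  e₂ : ∀ y x z → (1ℤ + y) * (1ℤ - y) * z ≡ (1ℤ - 1ℤ) * x + (1ℤ - y) * (y + 1ℤ) * z
  e₂ = solve-∀
chain-closed y (suc t) x z with chain ((1ℤ - y) * (1ℤ - y)) y t (x , z) | chain-closed y t x z
... | X , Z | hX , hZ =
    trans (e₁ y X Z) (trans (cong₂ (λ p q → (1ℤ - y + y * y) * p + y * (1ℤ - y) * q) hX hZ) (e₂ y (pow y t) x z))
  , trans (e₃ y X Z) (trans (cong₂ (λ p q → (1ℤ - y) * p + y * q) hX hZ) (e₄ y (pow y t) x z))
  where
  e₁ : ∀ y X Z → (1ℤ + y) * (((1ℤ - y) * (1ℤ - y) + y) * X + (1ℤ - y) * (1ℤ - y) * (y * Z))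
     ≡ (1ℤ - y + y * y) * ((1ℤ + y) * X) + y * (1ℤ - y) * ((1ℤ + y) * (1ℤ - y) * Z)
  e₁ = solve-∀
  e₂ : ∀ y u x z → (1ℤ - y + y * y) * ((1ℤ + y * u) * x + (1ℤ - u) * (y * (1ℤ - y) * z)) + y * (1ℤ - y) * ((1ℤ - u) * x + (1ℤ - y) * (y + u) * z)
     ≡ (1ℤ + y * (y * y * u)) * x + (1ℤ - y * y * u) * (y * (1ℤ - y) * z)
  e₂ = solve-∀
  e₃ : ∀ y X Z → (1ℤ + y) * (1ℤ - y) * (X + y * Z) ≡ (1ℤ - y) * ((1ℤ + y) * X) + y * ((1ℤ + y) * (1ℤ - y) * Z)
  e₃ = solve-∀
  e₄ : ∀ y u x z → (1ℤ - y) * ((1ℤ + y * u) * x + (1ℤ - u) * (y * (1ℤ - y) * z)) + y * ((1ℤ - u) * x + (1ℤ - y) * (y + u) * z)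
     ≡ (1ℤ - y * y * u) * x + (1ℤ - y) * (y + y * y * u) * z
  e₄ = solve-∀

module _ (y : ℤ) where
  private
    a = (1ℤ - y) * (1ℤ - y)

  ySeries : List Branch → ℤ × ℤ
  ySeries βs = let x , z = poly a y βs in x , y * (1ℤ - y) * z

  ySeries-paths : ∀ ts βs → let k = (1ℤ + y) ^ length ts ; x , z = ySeries (map path ts ++ βs) in
    (k * x , k * z) ≡ branches y ts (ySeries βs)
  ySeries-paths [] βs = cong₂ _,_ (ℤP.*-identityˡ (proj₁ (ySeries βs))) (ℤP.*-identityˡ (proj₂ (ySeries βs)))
  ySeries-paths (t ∷ ts) βs = trans (cong₂ _,_
      (trans (e₁ (1ℤ + y) k (proj₁ (chain a y t (x , z)))) (trans (cong (k *_) (proj₁ (chain-closed y t x z))) (e₂ k (1ℤ + y * pow y t) x (1ℤ - pow y t) (y * (1ℤ - y) * z))))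
      (trans (e₃ (1ℤ + y) k (y * (1ℤ - y)) (proj₁ (chain a y t (z , 0ℤ)))) (trans (cong (λ p → k * (y * (1ℤ - y)) * p) (proj₁ (chain-closed y t z 0ℤ))) (e₄ k (y * (1ℤ - y)) (1ℤ + y * pow y t) z (1ℤ - pow y t)))))
    (cong (branch y t) (ySeries-paths ts βs))
    where
    k = (1ℤ + y) ^ length ts
    x = proj₁ (poly a y (map path ts ++ βs))
    z = proj₂ (poly a y (map path ts ++ βs))
    e₁ : ∀ c k X → c * k * X ≡ k * (c * X)
    e₁ = solve-∀
    e₂ : ∀ k p x q z → k * (p * x + q * z) ≡ p * (k * x) + q * (k * z)
    e₂ = solve-∀
    e₃ : ∀ c k s X → c * k * (s * X) ≡ k * s * (c * X)
    e₃ = solve-∀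
    e₄ : ∀ k s p z q → k * s * (p * z + q * (s * 0ℤ)) ≡ p * (k * (s * z))
    e₄ = solve-∀

-- The bare centre gives (1 - y)² ≈ 1 - 2y. A triangle multiplies by (a + b)(a + 3b) = 1 + y² + y⁴,
-- which is 1 to this order, and its second term adds 2y; hence 2s - 2.
triBase : ∀ s → Base (+ 2 * + s - + 2)
triBase s = record
  { α = λ y → proj₁ (ySeries y (replicate s tri)) ; β = λ y → proj₂ (ySeries y (replicate s tri))
  ; α-eq = λ y → proj₁ (go y s)
  ; β-eq = λ y → let modulo q eq = proj₂ (go y s) in modulo (q * (1ℤ - y)) (trans (cong (y * (1ℤ - y) *_) eq) (eβ y q)) }
  where
  eβ : ∀ y q → y * (1ℤ - y) * (1ℤ + y * y * q) ≡ y - y * y + y * (y * y) * (q * (1ℤ - y))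
  eβ = solve-∀
  go : ∀ y s → let x , z = poly ((1ℤ - y) * (1ℤ - y)) y (replicate s tri) in
       x ≈ 1ℤ + (+ 2 * + s - + 2) * y [ y * y ] × z ≈ 1ℤ [ y * y ]
  go y zero = modulo 1ℤ (e y) , ≈-reflexive refl
    where
    e : ∀ y → (1ℤ - y) * (1ℤ - y) ≡ 1ℤ + (+ 2 * 0ℤ - + 2) * y + y * y * 1ℤ
    e = solve-∀
  go y (suc s) with poly ((1ℤ - y) * (1ℤ - y)) y (replicate s tri) | go y s
  ... | x , z | modulo q refl , modulo r refl =
      modulo _ (e₁ y (+ s) q r) , modulo _ (e₂ y r)
    where
    e₁ : ∀ y s q r → ((1ℤ - y) * (1ℤ - y) + y) * ((1ℤ - y) * (1ℤ - y) + + 3 * y) * (1ℤ + (+ 2 * s - + 2) * y + y * y * q)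
           + + 2 * ((1ℤ - y) * (1ℤ - y)) * ((1ℤ - y) * (1ℤ - y) + + 3 * y) * (y * (1ℤ + y * y * r))
       ≡ 1ℤ + (+ 2 * (1ℤ + s) - + 2) * y + y * y * (q + (1ℤ + y * y) * (1ℤ + (+ 2 * s - + 2) * y + y * y * q)
           + + 2 * (- 1ℤ - y * y + y * y * y) + + 2 * ((1ℤ - y) * (1ℤ - y) * (1ℤ + y + y * y)) * (y * r))
    e₁ = solve-∀
    e₂ : ∀ y r → ((1ℤ - y) * (1ℤ - y) + y) * ((1ℤ - y) * (1ℤ - y) + + 3 * y) * (1ℤ + y * y * r)
       ≡ 1ℤ + y * y * (r + (1ℤ + y * y) * (1ℤ + y * y * r))
    e₂ = solve-∀

normalForm : List Branch → List Branch
normalForm βs = map path (paths βs) ++ replicate (tris βs) tri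

↭-normalForm : ∀ βs → βs ↭ normalForm βs
↭-normalForm []            = ↭-refl
↭-normalForm (path t ∷ βs) = prep (path t) (↭-normalForm βs)
↭-normalForm (tri ∷ βs)    = ↭-trans (prep tri (↭-normalForm βs)) (↭-sym (shift tri (map path (paths βs)) (replicate (tris βs) tri)))

-- The number of spanning trees of a branched graph

pow3 : ℕ → ℤ
pow3 s = (+ 3) ^ s

-- To lowest order z counts spanning trees and x counts them together with a choice of root, whence
-- the number N of vertices. Paths keep the number of trees and triangles triple it.
poly-linear : ∀ y βs → let x , z = poly y 1ℤ βs ; N = 1ℤ + + (2 ℕ.* tris βs ℕ.+ ListAction.sum (paths βs)) in
  x ≈ y * (N * pow3 (tris βs)) [ y * y ] × z ≈ pow3 (tris βs) [ y ]
poly-linear y [] = ≈-reflexive (e y) , ≈-reflexive refl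
  where
  e : ∀ y → y ≡ y * ((1ℤ + 0ℤ) * 1ℤ)
  e = solve-∀
poly-linear y (path t ∷ βs) with poly y 1ℤ βs | poly-linear y βs
... | x , z | hx , hz = ≈-trans (proj₁ (go t)) (≈-reflexive (cong (y *_) (trans (e₁ (1ℤ + + S) (pow3 (tris βs)) (+ t)) (cong (_* pow3 (tris βs)) shuffle)))) , go′ t
  where
  S = 2 ℕ.* tris βs ℕ.+ ListAction.sum (paths βs)
  e₁ : ∀ n p t → n * p + t * p ≡ (n + t) * p
  e₁ = solve-∀
  shuffle : 1ℤ + + S + + t ≡ 1ℤ + + (2 ℕ.* tris βs ℕ.+ (t ℕ.+ ListAction.sum (paths βs)))
  shuffle = cong (λ z → + suc z) (trans (ℕP.+-assoc (2 ℕ.* tris βs) (ListAction.sum (paths βs)) t) (cong (2 ℕ.* tris βs ℕ.+_) (ℕP.+-comm (ListAction.sum (paths βs)) t)))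
  N = (1ℤ + + S) * pow3 (tris βs)
  go : ∀ t → let X , Z = chain y 1ℤ t (x , z) in X ≈ y * (N + + t * pow3 (tris βs)) [ y * y ] × Z ≈ pow3 (tris βs) [ y ]
  go zero = ≈-trans hx (≈-reflexive (cong (y *_) (e (N) (pow3 (tris βs))))) , hz
    where
    e : ∀ n p → n ≡ n + 0ℤ * p
    e = solve-∀
  go (suc t) with chain y 1ℤ t (x , z) | go t
  ... | X , Z | modulo q refl , modulo r refl = modulo _ (e₂ y N (+ t) (pow3 (tris βs)) q r) , modulo _ (e₃ y N (+ t) (pow3 (tris βs)) q r)
    where
    e₂ : ∀ y N t p q r → (y + 1ℤ) * (y * (N + t * p) + y * y * q) + y * (1ℤ * (p + y * r)) ≡ y * (N + (1ℤ + t) * p) + y * y * ((N + t * p) + y * q + q + r)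
    e₂ = solve-∀
    e₃ : ∀ y N t p q r → (y * (N + t * p) + y * y * q) + 1ℤ * (p + y * r) ≡ p + y * ((N + t * p) + y * q + r)
    e₃ = solve-∀
  go′ : ∀ t → proj₁ (chain y 1ℤ t (z , 0ℤ)) ≈ pow3 (tris βs) [ y ]
  go′ zero = hz
  go′ (suc t) with chain y 1ℤ t (z , 0ℤ) | go′ t
  ... | X , Z | modulo q refl = modulo _ (e₂ y (pow3 (tris βs)) q Z)
    where
    e₂ : ∀ y p q Z → (y + 1ℤ) * (p + y * q) + y * (1ℤ * Z) ≡ p + y * (p + y * q + q + Z)
    e₂ = solve-∀
poly-linear y (tri ∷ βs) with poly y 1ℤ βs | poly-linear y βs
... | x , z | modulo q refl , modulo r refl = modulo _ (trans (e₁ y n p q r) (cong (λ m → y * (m * (+ 3 * p)) + y * y * (+ 3 * q + (y + + 4) * (n * p + y * q) + + 2 * (p + + 3 * r + y * r))) (cong +_ vertices)))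
    , modulo _ (e₂ y p r)
  where
  S = 2 ℕ.* tris βs ℕ.+ ListAction.sum (paths βs)
  n = 1ℤ + + S
  p = pow3 (tris βs)
  vertices : suc (S ℕ.+ 2) ≡ suc (2 ℕ.* suc (tris βs) ℕ.+ ListAction.sum (paths βs))
  vertices = cong suc (trans (ℕP.+-comm S 2) (cong (ℕ._+ ListAction.sum (paths βs)) (sym (ℕP.*-suc 2 (tris βs)))))
  e₁ : ∀ y n p q r → (y + 1ℤ) * (y + + 3 * 1ℤ) * (y * (n * p) + y * y * q) + + 2 * y * (y + + 3 * 1ℤ) * (1ℤ * (p + y * r))
     ≡ y * ((n + + 2) * (+ 3 * p)) + y * y * (+ 3 * q + (y + + 4) * (n * p + y * q) + + 2 * (p + + 3 * r + y * r))
  e₁ = solve-∀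
  e₂ : ∀ y p r → (y + 1ℤ) * (y + + 3 * 1ℤ) * (p + y * r) ≡ + 3 * p + y * (+ 3 * r + (y + + 4) * (p + y * r))
  e₂ = solve-∀

-- Path-friendship graphs as branched graphs

Edges : Set
Edges = List (ℕ × ℕ)

Bounded : ℕ → Edges → Set
Bounded N es = All (λ (i , j) → i ℕ.< N × j ℕ.< N) es

module _ {n} (es : Edges) {i j : Fin n} where
  Joined : Set
  Joined = (toℕ i , toℕ j) ∈ es ⊎ (toℕ j , toℕ i) ∈ es

  fromEdges-true : adj (fromEdges n es) i j ≡ true → i ≢ j × Joined
  fromEdges-true h with i ≟ j | (toℕ i , toℕ j) ∈? es | (toℕ j , toℕ i) ∈? es
  ... | no p | yes q | _     = p , inj₁ q
  ... | no p | no _  | yes q = p , inj₂ q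

  fromEdges-intro : i ≢ j → Joined → adj (fromEdges n es) i j ≡ true
  fromEdges-intro i≢j h with i ≟ j | (toℕ i , toℕ j) ∈? es | (toℕ j , toℕ i) ∈? es
  ... | yes p | _ | _ = contradiction p i≢j
  ... | no _ | yes _ | _ = refl
  ... | no _ | no _ | yes _ = refl
  fromEdges-intro i≢j (inj₁ h) | no _ | no q | no _ = contradiction h q
  fromEdges-intro i≢j (inj₂ h) | no _ | no _ | no q = contradiction h q

-- Labels of edge lists grow at the end, so it is the last element that plays the new vertex
-- `nothing` of `ext`.
toMaybe : ∀ {N} → Fin (suc N) → Maybe (Fin N)
toMaybe {zero}  zero    = nothing
toMaybe {suc N} zero    = just zero
toMaybe {suc N} (suc i) = Maybe.map suc (toMaybe i)

fromMaybe : ∀ {N} → Maybe (Fin N) → Fin (suc N)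
fromMaybe {N} nothing  = fromℕ N
fromMaybe     (just i) = inject₁ i

from-to : ∀ {N} (i : Fin (suc N)) → fromMaybe (toMaybe i) ≡ i
from-to {zero}  zero    = refl
from-to {suc N} zero    = refl
from-to {suc N} (suc i) with toMaybe i | from-to i
... | nothing | e = cong suc e
... | just j  | e = cong suc e

toMaybe-last : ∀ N → toMaybe (fromℕ N) ≡ nothing
toMaybe-last zero    = refl
toMaybe-last (suc N) = cong (Maybe.map suc) (toMaybe-last N)

toMaybe-inject : ∀ {N} (i : Fin N) → toMaybe (inject₁ i) ≡ just i
toMaybe-inject zero    = refl
toMaybe-inject (suc i) = cong (Maybe.map suc) (toMaybe-inject i)

inject≢last : ∀ {N} (i : Fin N) → inject₁ i ≢ fromℕ N
inject≢last {N} i e = ℕP.<-irrefl (trans (sym (toℕ-inject₁ i)) (trans (cong toℕ e) (toℕ-fromℕ N))) (toℕ<n i)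

-- New edges are listed with the smaller end first, so the neighbourhood is read off the pairs with
-- N in second place, and none has N in first place.
fromEdges-ext : ∀ {N} es es′ (Nb : Fin N → Bool) c →
  (∀ (i j : Fin N) → (toℕ i , toℕ j) ∈ es′ → (toℕ i , toℕ j) ∈ es) → (∀ {p} → p ∈ es → p ∈ es′) →
  (∀ (i : Fin N) → (toℕ i , N) ∈ es′ → Nb i ≡ true) → (∀ i → Nb i ≡ true → (toℕ i , N) ∈ es′) →
  (∀ (i : Fin N) → (N , toℕ i) ∉ es′) →
  toPG (fromEdges (suc N) es′) (inject₁ c) ≃ ext (toPG (fromEdges N es) c) Nb
fromEdges-ext {N} es es′ Nb c old old′ new new′ none = ≃-sym (record
  { to = fromMaybe ; from = toMaybe ; to∘from = from-to
  ; from∘to = λ { nothing → toMaybe-last N ; (just i) → toMaybe-inject i }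
  ; edge-eq = edges
  ; isC-eq = λ { nothing → sym (dec-false (fromℕ N ≟ inject₁ c) (inject≢last c ∘ sym)) ; (just i) → ≟-injective inject₁ inject₁-injective i c } })
  where
  G  = fromEdges N es
  G′ = fromEdges (suc N) es′
  pair : ∀ {a b c d : ℕ} → a ≡ c → b ≡ d → (a , b) ∈ es′ → (c , d) ∈ es′
  pair refl refl h = h
  newEdge : ∀ i → Nb i ≡ adj G′ (inject₁ i) (fromℕ N)
  newEdge i = bool-eq
    (λ h → fromEdges-intro es′ (inject≢last i) (inj₁ (pair (sym (toℕ-inject₁ i)) (sym (toℕ-fromℕ N)) (new′ i h))))
    (λ h → case proj₂ (fromEdges-true es′ h) of λ
      { (inj₁ m) → new i (pair (toℕ-inject₁ i) (toℕ-fromℕ N) m)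
      ; (inj₂ m) → contradiction (pair (toℕ-fromℕ N) (toℕ-inject₁ i) m) (none i) })
  edges : ∀ u v → edge (ext (toPG G c) Nb) u v ≡ adj G′ (fromMaybe u) (fromMaybe v)
  edges nothing nothing = sym (irrefl G′ (fromℕ N))
  edges nothing (just i) = trans (newEdge i) (Graph.sym G′ (inject₁ i) (fromℕ N))
  edges (just i) nothing = newEdge i
  edges (just i) (just j) = bool-eq
    (λ h → let i≢j , m = fromEdges-true es h in fromEdges-intro es′ (i≢j ∘ inject₁-injective) (case m of λ
      { (inj₁ x) → inj₁ (pair (sym (toℕ-inject₁ i)) (sym (toℕ-inject₁ j)) (old′ x))
      ; (inj₂ x) → inj₂ (pair (sym (toℕ-inject₁ j)) (sym (toℕ-inject₁ i)) (old′ x)) }))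
    (λ h → let i≢j , m = fromEdges-true es′ h in fromEdges-intro es (i≢j ∘ cong inject₁) (case m of λ
      { (inj₁ x) → inj₁ (old i j (pair (toℕ-inject₁ i) (toℕ-inject₁ j) x))
      ; (inj₂ x) → inj₂ (old j i (pair (toℕ-inject₁ j) (toℕ-inject₁ i) x)) }))

-- The bound keeps the label N out of the edge list, so the next vertex is fresh; label 0 is where
-- all further branches get attached.
record Rep (N : ℕ) (es : Edges) (G : PGraph) : Set where
  constructor rep
  field
    c     : Fin N
    c₀    : toℕ c ≡ 0
    iso   : toPG (fromEdges N es) c ≃ G
    bound : Bounded N es

bounded-mono : ∀ {M N es} → M ℕ.≤ N → Bounded M es → Bounded N es
bounded-mono h = All.map λ (a , b) → ℕP.≤-trans a h , ℕP.≤-trans b h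

at⇒≡ : ∀ {n} (p i : Fin n) → at p i ≡ true → i ≡ p
at⇒≡ p i h with i ≟ p
... | yes e = e

at-refl : ∀ {n} (p : Fin n) → at p p ≡ true
at-refl p = dec-true (p ≟ p) refl

snoc-ext : ∀ {N} es (p c : Fin N) → Bounded N es →
  toPG (fromEdges (suc N) (es ++ (toℕ p , N) ∷ [])) (inject₁ c) ≃ ext (toPG (fromEdges N es) c) (at p)
snoc-ext {N} es p c b = fromEdges-ext es (es ++ (toℕ p , N) ∷ []) (at p) c
  (λ i j h → case ∈-++⁻ es h of λ
    { (inj₁ m) → m
    ; (inj₂ (here e)) → contradiction (cong proj₂ e) (ℕP.<⇒≢ (toℕ<n j)) })
  ∈-++⁺ˡ
  (λ i h → case ∈-++⁻ es h of λ
    { (inj₁ m) → contradiction (proj₂ (All.lookup b m)) (ℕP.<-irrefl refl)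
    ; (inj₂ (here e)) → trans (cong (at p) (toℕ-injective (cong proj₁ e))) (at-refl p) })
  (λ i h → ∈-++⁺ʳ es (here (cong (λ z → toℕ z , N) (at⇒≡ p i h))))
  (λ i h → case ∈-++⁻ es h of λ
    { (inj₁ m) → contradiction (proj₁ (All.lookup b m)) (ℕP.<-irrefl refl)
    ; (inj₂ (here e)) → contradiction (sym (cong proj₁ e)) (ℕP.<⇒≢ (toℕ<n p)) })

-- The path is built outwards from the centre, with p its last vertex and j vertices already placed.
-- Size, edge list and length are tied by equations instead of indices, which spares transports
-- along associativity.
grow-path : ∀ {G} t j o es (p c : Fin o) → toℕ c ≡ 0 → Bounded o es →
  (f : toPG (fromEdges o es) c ≃ attach (path j) G) → (∀ v → at p v ≡ tip j {G} (to f v)) →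
  ∀ {N es′ k} → N ≡ o ℕ.+ t → es′ ≡ es ++ pathEdges (toℕ p) o t → k ≡ j ℕ.+ t → Rep N es′ (attach (path k) G)
grow-path zero j o es p c c₀ b f tip-eq eN eE eK with trans eN (ℕP.+-identityʳ o) | trans eE (++-identityʳ es) | trans eK (ℕP.+-identityʳ j)
... | refl | refl | refl = rep c c₀ f b
grow-path {G} (suc t) j o es p c c₀ b f tip-eq eN eE eK =
  grow-path t (suc j) (suc o) (es ++ (toℕ p , o) ∷ []) (fromℕ o) (inject₁ c) (trans (toℕ-inject₁ c) c₀)
    (AllP.++⁺ (bounded-mono (ℕP.n≤1+n o) b) ((ℕP.m≤n⇒m≤1+n (toℕ<n p) , ℕP.≤-refl) ∷ []))
    f′ tip′
    (trans eN (ℕP.+-suc o t))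
    (trans eE (trans (sym (++-assoc es ((toℕ p , o) ∷ []) (pathEdges o (suc o) t))) (cong (λ z → (es ++ (toℕ p , o) ∷ []) ++ pathEdges z (suc o) t) (sym (toℕ-fromℕ o)))))
    (trans eK (ℕP.+-suc j t))
  where
  s = snoc-ext es p c b
  e = ext-cong {N′ = tip j {G}} f tip-eq
  f′ = ≃-trans s (≃-trans e (ext-path j))
  tip′ : ∀ v → at (fromℕ o) v ≡ tip (suc j) {G} (to f′ v)
  tip′ v with toMaybe v | from-to v
  ... | nothing | refl = at-refl (fromℕ o)
  ... | just i  | refl with to f i
  ...   | inj₁ _ = dec-false (inject₁ i ≟ fromℕ o) (inject≢last i)
  ...   | inj₂ _ = dec-false (inject₁ i ≟ fromℕ o) (inject≢last i)

add-path : ∀ {G o es} t → Rep o es G → Rep (o ℕ.+ t) (es ++ pathEdges 0 o t) (attach (path t) G)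
add-path {G} {o} {es} t (rep c c₀ f b) = grow-path t 0 o es c c c₀ b (≃-trans f (≃-sym attach-empty)) (λ v → isC-eq f v)
  refl (cong (λ z → es ++ pathEdges z o t) (sym c₀)) refl

PFBranches : ℕ → Edges → ℕ → ℕ → Set
PFBranches N es s k = ∃ λ βs → Rep N es (PG βs) × tris βs ≡ s × length (paths βs) ≡ k × Positive βs

add-paths : ∀ {o es s k} ts → All (1 ℕ.≤_) ts → PFBranches o es s k →
  ∀ {N es′} → N ≡ o ℕ.+ ListAction.sum ts → es′ ≡ es ++ pathsEdges o ts → PFBranches N es′ s (length ts ℕ.+ k)
add-paths {o} {es} [] [] h eN eE with trans eN (ℕP.+-identityʳ o) | trans eE (++-identityʳ es)
... | refl | refl = h
add-paths {o} {es} {s} {k} (t ∷ ts) (p ∷ ps) (βs , r , t′ , k′ , pos) {N} {es′} eN eE = subst (PFBranches N es′ s) (ℕP.+-suc (length ts) k)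
  (add-paths ts ps (path t ∷ βs , add-path t r , t′ , cong suc k′ , p ∷ pos)
    (trans eN (sym (ℕP.+-assoc o t (ListAction.sum ts)))) (trans eE (sym (++-assoc es (pathEdges 0 o t) (pathsEdges (o ℕ.+ t) ts)))))

-- The vertices N and N + 1 come one at a time: without the pairs mentioning N + 1 the list yields a
-- path of length 1, which the second vertex closes.
add-tri : ∀ {G N es} → Rep N es G → Rep (2 ℕ.+ N) ((0 , N) ∷ (0 , suc N) ∷ (N , suc N) ∷ es) (attach tri G)
add-tri {G} {N} {es} (rep c c₀ f b) = rep (inject₁ (inject₁ c)) (trans (toℕ-inject₁ (inject₁ c)) (trans (toℕ-inject₁ c) c₀))
  (≃-trans second (≃-trans (ext-cong {N′ = closing {G}} f₁ closing-eq) ext-tri))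
  ((pos , s≤s (ℕP.n≤1+n N)) ∷ (pos , ℕP.≤-refl) ∷ (s≤s (ℕP.n≤1+n N) , ℕP.≤-refl) ∷ bounded-mono (ℕP.m≤n⇒m≤1+n (ℕP.n≤1+n N)) b)
  where
  pos : 0 ℕ.< 2 ℕ.+ N
  pos = s≤s z≤n
  0<N : 0 ℕ.< N
  0<N = subst (ℕ._< N) c₀ (toℕ<n c)
  es₁ = (0 , N) ∷ es
  es₂ = (0 , N) ∷ (0 , suc N) ∷ (N , suc N) ∷ es
  first : toPG (fromEdges (suc N) es₁) (inject₁ c) ≃ ext (toPG (fromEdges N es) c) (at c)
  first = fromEdges-ext es es₁ (at c) c
    (λ { i j (here e) → contradiction (cong proj₂ e) (ℕP.<⇒≢ (toℕ<n j)) ; i j (there m) → m })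
    there
    (λ { i (here e) → trans (cong (at c) (toℕ-injective (trans (cong proj₁ e) (sym c₀)))) (at-refl c)
       ; i (there m) → contradiction (proj₂ (All.lookup b m)) (ℕP.<-irrefl refl) })
    (λ i h → here (cong (_, N) (trans (cong toℕ (at⇒≡ c i h)) c₀)))
    (λ { i (here e) → contradiction (sym (cong proj₁ e)) (ℕP.<⇒≢ 0<N)
       ; i (there m) → contradiction (proj₁ (All.lookup b m)) (ℕP.<-irrefl refl) })
  e₁ = ext-cong {N′ = isC G} f (isC-eq f)
  f₁ = ≃-trans first (≃-trans e₁ (ext-centre {G}))
  Nb : Fin (suc N) → Bool
  Nb i = at (inject₁ c) i ∨ at (fromℕ N) i
  Nb⇒ : ∀ i → Nb i ≡ true → toℕ i ≡ 0 ⊎ toℕ i ≡ N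
  Nb⇒ i h with i ≟ inject₁ c | i ≟ fromℕ N
  ... | yes refl | _ = inj₁ (trans (toℕ-inject₁ c) c₀)
  ... | no _ | yes refl = inj₂ (toℕ-fromℕ N)
  ⇒Nb : ∀ i → toℕ i ≡ 0 ⊎ toℕ i ≡ N → Nb i ≡ true
  ⇒Nb i (inj₁ e) = cong (_∨ at (fromℕ N) i) (dec-true (i ≟ inject₁ c) (toℕ-injective (trans e (sym (trans (toℕ-inject₁ c) c₀)))))
  ⇒Nb i (inj₂ e) = trans (cong (at (inject₁ c) i ∨_) (dec-true (i ≟ fromℕ N) (toℕ-injective (trans e (sym (toℕ-fromℕ N)))))) (BoolP.∨-zeroʳ (at (inject₁ c) i))
  second : toPG (fromEdges (2 ℕ.+ N) es₂) (inject₁ (inject₁ c)) ≃ ext (toPG (fromEdges (suc N) es₁) (inject₁ c)) Nb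
  second = fromEdges-ext es₁ es₂ Nb (inject₁ c)
    (λ { i j (here e) → here e
       ; i j (there (here e)) → contradiction (cong proj₂ e) (ℕP.<⇒≢ (toℕ<n j))
       ; i j (there (there (here e))) → contradiction (cong proj₂ e) (ℕP.<⇒≢ (toℕ<n j))
       ; i j (there (there (there m))) → there m })
    (λ { (here e) → here e ; (there m) → there (there (there m)) })
    (λ { i (here e) → contradiction (cong proj₂ e) ℕP.1+n≢n
       ; i (there (here e)) → ⇒Nb i (inj₁ (cong proj₁ e))
       ; i (there (there (here e))) → ⇒Nb i (inj₂ (cong proj₁ e))
       ; i (there (there (there m))) → contradiction (proj₂ (All.lookup b m)) (ℕP.≤⇒≯ (ℕP.n≤1+n N)) })
    (λ i h → case Nb⇒ i h of λ { (inj₁ e) → there (here (cong (_, suc N) e)) ; (inj₂ e) → there (there (here (cong (_, suc N) e))) })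
    (λ { i (here ()) ; i (there (here ()))
       ; i (there (there (here e))) → contradiction (cong proj₁ e) ℕP.1+n≢n
       ; i (there (there (there m))) → contradiction (proj₁ (All.lookup b m)) (ℕP.≤⇒≯ (ℕP.n≤1+n N)) })
  closing-eq : ∀ v → Nb v ≡ closing {G} (to f₁ v)
  closing-eq v with toMaybe v | from-to v
  ... | nothing | refl = trans (cong (at (inject₁ c) (fromℕ N) ∨_) (at-refl (fromℕ N))) (BoolP.∨-zeroʳ (at (inject₁ c) (fromℕ N)))
  ... | just i  | refl = trans (cong (at (inject₁ c) (inject₁ i) ∨_) (dec-false (inject₁ i ≟ fromℕ N) (inject≢last i)))
    (trans (BoolP.∨-identityʳ (at (inject₁ c) (inject₁ i))) (trans (sym (≟-injective inject₁ inject₁-injective i c)) (isC-eq f i)))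

triangles : ∀ s {N} → N ≡ 1 ℕ.+ 2 ℕ.* s → PFBranches N (triangleEdges s) s 0
triangles zero refl = [] , rep zero refl single [] , refl , refl , []
  where
  single : toPG (fromEdges 1 []) zero ≃ PG []
  single = record { to = λ _ → tt ; from = λ _ → zero ; to∘from = λ _ → refl ; from∘to = λ { zero → refl }
                  ; edge-eq = λ { zero zero → refl } ; isC-eq = λ { zero → refl } }
triangles (suc s) eN with triangles s refl | trans eN (cong suc (ℕP.*-suc 2 s))
... | βs , r , t , k , pos | refl = tri ∷ βs , add-tri r , cong suc t , k , pos

pathFriendship-branches : ∀ s ts → All (1 ℕ.≤_) ts → ∃ λ c → ∃ λ βs →
  toPG (pathFriendship s ts) c ≃ PG βs × tris βs ≡ s × length (paths βs) ≡ length ts × Positive βs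
pathFriendship-branches s ts pos with add-paths ts pos (triangles s refl) refl refl
... | βs , rep c _ f _ , t , k , pos′ = c , βs , f , t , trans k (ℕP.+-identityʳ (length ts)) , pos′

≃⇒lapD : ∀ {n m} (G : Graph n) (H : Graph m) {c d} → toPG G c ≃ toPG H d → ∀ a b → lapD G a b ≡ lapD H a b
≃⇒lapD {n} {m} G H f a b = trans (D-cong n {w = λ i j → b * arc G i j} {w′ = λ i j → b * arc H (to f i) (to f j)} (λ _ → refl) λ i j _ → cong (λ e → b * ⟦ e ⟧) (edge-eq f i j))
  (D-perm n m (permutation (to f) (from f) (to∘from f) (from∘to f)) (λ _ → a) (λ i j → b * arc H i j))

≅⇒≃ : ∀ {n m} (G : Graph n) (H : Graph m) → G ≅ H → ∀ d → ∃ λ c → toPG G c ≃ toPG H d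
≅⇒≃ G H (f , h) d = Inverse.from g d , record
  { to = Inverse.to g ; from = Inverse.from g
  ; to∘from = λ v → Inverse.inverseˡ g refl ; from∘to = λ v → Inverse.inverseʳ g refl
  ; edge-eq = h
  ; isC-eq = λ v → trans (≟-injective (Inverse.to g) inj v (Inverse.from g d)) (cong (λ z → does (Inverse.to g v ≟ z)) (Inverse.inverseˡ g refl)) }
  where
  g = ⤖⇒↔ f
  inj : ∀ {i j} → Inverse.to g i ≡ Inverse.to g j → i ≡ j
  inj e = trans (sym (Inverse.inverseʳ g refl)) (Inverse.inverseʳ g e)

≃⇒≅ : ∀ {n m} (G : Graph n) (H : Graph m) {c d} → toPG G c ≃ toPG H d → G ≅ H
≃⇒≅ G H f = ↔⇒⤖ (mk↔ₛ′ (to f) (from f) (to∘from f) (from∘to f)) , edge-eq f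

-- The degree sequence of a cospectral graph

f₂ f₃ : ℤ → ℤ
f₂ d = (d - + 1) * (d - + 2)
f₃ d = f₂ d * (d - + 3)

-- Both `f₂` and `f₃` vanish at degrees 1 and 2, so in the model only the centre counts; expanded,
-- their sums become spectral data.
∑f₂ : ∀ {n} (G : Graph n) → ∑ (λ i → f₂ (deg G i)) ≡ degSum₂ G + (- + 3 * degSum G + + n * + 2)
∑f₂ {n} G = trans (∑-cong λ i → e (deg G i)) (trans (∑-distrib-+ (λ i → deg G i * deg G i) (λ i → - + 3 * deg G i + + 2))
  (cong (_+_ (degSum₂ G)) (trans (∑-distrib-+ (λ i → - + 3 * deg G i) (λ _ → + 2)) (cong₂ _+_ (∑-* (- + 3) (deg G)) (∑-const n (+ 2))))))
  where
  e : ∀ d → (d - + 1) * (d - + 2) ≡ d * d + (- + 3 * d + + 2)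
  e = solve-∀

∑f₃ : ∀ {n} (G : Graph n) → ∑ (λ i → f₃ (deg G i)) ≡ degSum₃ G + (- + 6 * degSum₂ G + (+ 11 * degSum G + + n * - + 6))
∑f₃ {n} G = trans (∑-cong λ i → e (deg G i)) (trans (∑-distrib-+ (λ i → deg G i * deg G i * deg G i) (λ i → - + 6 * (deg G i * deg G i) + (+ 11 * deg G i + - + 6)))
  (cong (_+_ (degSum₃ G)) (trans (∑-distrib-+ (λ i → - + 6 * (deg G i * deg G i)) (λ i → + 11 * deg G i + - + 6))
    (cong₂ _+_ (∑-* (- + 6) (λ i → deg G i * deg G i)) (trans (∑-distrib-+ (λ i → + 11 * deg G i) (λ _ → - + 6)) (cong₂ _+_ (∑-* (+ 11) (deg G)) (∑-const n (- + 6))))))))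
  where
  e : ∀ d → (d - + 1) * (d - + 2) * (d - + 3) ≡ d * d * d + (- + 6 * (d * d) + (+ 11 * d + - + 6))
  e = solve-∀

f₂-value : ∀ p → f₂ (+ suc (suc p)) ≡ + (suc p ℕ.* p)
f₂-value p = trans (e (+ p)) (sym (ℤP.pos-* (suc p) p))
  where
  e : ∀ p → (+ 2 + p - + 1) * (+ 2 + p - + 2) ≡ (1ℤ + p) * p
  e = solve-∀

0≤f₂ : ∀ {d} → 1ℤ ≤ d → 0ℤ ≤ f₂ d
0≤f₂ {+ suc zero} _ = ℤP.≤-refl
0≤f₂ {+ suc (suc p)} _ = subst (0ℤ ≤_) (sym (f₂-value p)) (+≤+ z≤n)
0≤f₂ {+ zero} (+≤+ ())

f₂≡0⇒≤2 : ∀ {d} → f₂ d ≡ 0ℤ → d ≤ + 2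
f₂≡0⇒≤2 {+ zero} h = +≤+ z≤n
f₂≡0⇒≤2 {+ suc zero} h = +≤+ (s≤s z≤n)
f₂≡0⇒≤2 {+ suc (suc zero)} h = ℤP.≤-refl
f₂≡0⇒≤2 {+ suc (suc (suc p))} h = case trans (sym (f₂-value (suc p))) h of λ ()
f₂≡0⇒≤2 { -[1+ p ]} h = -≤+

≤2⇒f₂≡0 : ∀ {d} → 1ℤ ≤ d → d ≤ + 2 → f₂ d ≡ 0ℤ
≤2⇒f₂≡0 {+ suc zero} _ _ = refl
≤2⇒f₂≡0 {+ suc (suc zero)} _ _ = refl
≤2⇒f₂≡0 {+ suc (suc (suc p))} _ (+≤+ (s≤s (s≤s ())))
≤2⇒f₂≡0 {+ zero} (+≤+ ())

-- The product (d - 1)(d - 2) is strictly increasing from d = 2 on, and smaller d satisfy the bound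
-- anyway.
f₂-reflects-≤ : ∀ {d} P → f₂ d ≤ f₂ (+ suc (suc P)) → d ≤ + suc (suc P)
f₂-reflects-≤ {+ zero} P h = +≤+ z≤n
f₂-reflects-≤ {+ suc zero} P h = +≤+ (s≤s z≤n)
f₂-reflects-≤ { -[1+ _ ]} P h = -≤+
f₂-reflects-≤ {+ suc (suc p)} P h with p ℕ.≤? P
... | yes p≤P = +≤+ (s≤s (s≤s p≤P))
... | no p≰P = case subst₂ _≤_ (f₂-value p) (f₂-value P) h of λ { (+≤+ le) →
  contradiction le (ℕP.<⇒≱ (ℕP.<-≤-trans (ℕP.*-monoʳ-< (suc P) (ℕP.≰⇒> p≰P)) (ℕP.*-monoˡ-≤ p (s≤s (ℕP.<⇒≤ (ℕP.≰⇒> p≰P)))))) }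

argmax : ∀ {n} (f : Fin (suc n) → ℤ) → ∃ λ c → ∀ v → f v ≤ f c
argmax {zero} f = zero , λ { zero → ℤP.≤-refl }
argmax {suc n} f with argmax (f ∘ suc)
... | c , h with f zero ℤP.≤? f (suc c)
...   | yes p = suc c , λ { zero → p ; (suc v) → h v }
...   | no p  = zero , λ { zero → ℤP.≤-refl ; (suc v) → ℤP.≤-trans (h v) (ℤP.<⇒≤ (ℤP.≰⇒> p)) }

0≤closed₃ : ∀ {n} (G : Graph n) → 0ℤ ≤ closed₃ G
0≤closed₃ G = 0≤∑ λ i → 0≤∑ λ j → 0≤∑ (0≤closed₃-term G i j)

module _ {n} (H : Graph (2 ℕ.+ n)) (conn : Conn H) (s k : ℕ)
         (ds : degSum H ≡ + 2 * (+ suc n + + suc s))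
         (S₂ : ∑ (λ i → f₂ (deg H i)) ≡ f₂ (+ (2 ℕ.* suc s ℕ.+ suc k)))
         (S₃ : ∑ (λ i → f₃ (deg H i)) - closed₃ H ≡ f₃ (+ (2 ℕ.* suc s ℕ.+ suc k)) - + 6 * + suc s)
         (τ : ∑ (trees H) ≡ (1ℤ + + suc n) * pow3 (suc s)) where

  private
    -- The numbers of triangles and paths are s + 1 and k + 1, so the centre degree is q + 3.
    q = 2 ℕ.* s ℕ.+ k
    Δ = + suc (suc (suc q))

    Δ-eq : + (2 ℕ.* suc s ℕ.+ suc k) ≡ Δ
    Δ-eq = cong +_ (trans (ℕP.+-suc (2 ℕ.* suc s) k) (cong (λ z → suc (z ℕ.+ k)) (ℕP.*-suc 2 s)))

    S₂′ : ∑ (λ i → f₂ (deg H i)) ≡ f₂ Δ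
    S₂′ = trans S₂ (cong f₂ Δ-eq)

    S₃′ : ∑ (λ i → f₃ (deg H i)) - closed₃ H ≡ f₃ Δ - + 6 * + suc s
    S₃′ = trans S₃ (cong (λ d → f₃ d - + 6 * + suc s) Δ-eq)

    c = proj₁ (argmax (deg H))
    deg≤ = proj₂ (argmax (deg H))

    1≤deg : ∀ v → 1ℤ ≤ deg H v
    1≤deg v = let j , e = neighbour H conn v in ℤP.≤-trans (ℤP.≤-reflexive (sym (arc-true H e))) (term≤∑ (0≤arc H v) j)

    deg-c≤Δ : deg H c ≤ Δ
    deg-c≤Δ = f₂-reflects-≤ (suc q) (subst (f₂ (deg H c) ≤_) S₂′ (term≤∑ (λ i → 0≤f₂ (1≤deg i)) c))

    -- Over all roots the tree counts average to the power of 3 in τ, so they cannot all exceed it.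
    too-many : ∀ x → (∀ r → x ≤ trees H r) → ¬ (pow3 (suc s) < x)
    too-many x h lt = ℤP.<-irrefl refl (ℤP.<-≤-trans (ℤP.*-monoˡ-<-pos (+ suc (suc n)) lt)
      (subst₂ _≤_ (∑-const (2 ℕ.+ n) x) τ (∑-mono h)))

    -- The vertex c alone exhausts the sum of `f₂`; the other summands are nonnegative and therefore
    -- all zero, which also makes their `f₃` vanish.
    degree-case : deg H c ≡ Δ → (∀ v → v ≢ c → deg H v ≤ + 2) × closed₃ H ≡ + 6 * + suc s
    degree-case e = small , closed
      where
      R = ∑ λ i → f₂ (deg H (punchIn c i))
      rest₂ : ∑ (λ i → f₂ (deg H (punchIn c i))) ≡ 0ℤ
      rest₂ = +-cancelʳ (f₂ Δ) R 0ℤ (trans (ℤP.+-comm R (f₂ Δ)) (trans (cong (λ d → f₂ d + R) (sym e))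
        (trans (sym (sum-remove {i = c} (λ i → f₂ (deg H i)))) (trans S₂′ (sym (ℤP.+-identityˡ (f₂ Δ)))))))
      zeros : ∀ i → f₂ (deg H (punchIn c i)) ≡ 0ℤ
      zeros = ∑≡0 (λ i → 0≤f₂ (1≤deg (punchIn c i))) rest₂
      small : ∀ v → v ≢ c → deg H v ≤ + 2
      small v v≢c = subst (λ v → deg H v ≤ + 2) (punchIn-punchOut (v≢c ∘ sym)) (f₂≡0⇒≤2 (zeros (punchOut (v≢c ∘ sym))))
      sum₃ : ∑ (λ i → f₃ (deg H i)) ≡ f₃ Δ
      sum₃ = trans (sum-remove {i = c} (λ i → f₃ (deg H i))) (trans (cong₂ _+_ (cong f₃ e)
        (∑-zero λ i → cong (_* (deg H (punchIn c i) - + 3)) (zeros i))) (ℤP.+-identityʳ (f₃ Δ)))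
      closed : closed₃ H ≡ + 6 * + suc s
      closed = trans (e₁ (f₃ Δ) (closed₃ H)) (trans (cong (λ z → f₃ Δ - z) (trans (cong (_- closed₃ H) (sym sum₃)) S₃′)) (sym (e₁ (f₃ Δ) (+ 6 * + suc s))))
        where
        e₁ : ∀ x y → y ≡ x - (x - y)
        e₁ = solve-∀

    module _ (h : deg H c ≤ + suc (suc q)) where
      private
        F = f₂ Δ
        S = ∑ λ i → f₃ (deg H i)
        C = ∣ closed₃ H ∣

        -- All degrees are at most Δ - 1 here, so the factor d - 3 of `f₃` is at most Δ - 4.
        term : ∀ i → f₃ (deg H i) ≤ (Δ - + 4) * f₂ (deg H i)
        term i = subst (_≤ (Δ - + 4) * f₂ (deg H i)) (ℤP.*-comm (deg H i - + 3) (f₂ (deg H i)))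
          (ℤP.*-monoʳ-≤-nonNeg (f₂ (deg H i)) {{nonNegative (0≤f₂ (1≤deg i))}} (ℤP.≤-trans (ℤP.+-monoˡ-≤ (- + 3) (ℤP.≤-trans (deg≤ i) h)) (ℤP.≤-reflexive (e (+ q)))))
          where
          e : ∀ q → + 2 + q - + 3 ≡ + 3 + q - + 4
          e = solve-∀

        sums : S ≤ (Δ - + 4) * F
        sums = subst (S ≤_) (trans (∑-* (Δ - + 4) (λ i → f₂ (deg H i))) (cong ((Δ - + 4) *_) S₂′)) (∑-mono term)

        -- Compare S ≤ (Δ - 4)F with S - `closed₃ H` = (Δ - 3)F - 6(s + 1).
        bound : F + closed₃ H ≤ + 6 * + suc s
        bound = subst₂ _≤_
          (sym (trans (cong (_+_ F) (trans (e₁ S (closed₃ H)) (cong (λ z → S - z) S₃′))) (e₂ F S Δ (+ 6 * + suc s))))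
          (e₃ F Δ (+ 6 * + suc s))
          (ℤP.+-monoˡ-≤ (+ 6 * + suc s - (Δ - + 4) * F) sums)
          where
          e₁ : ∀ S C → C ≡ S - (S - C)
          e₁ = solve-∀
          e₂ : ∀ F S d t → F + (S - (F * (d - + 3) - t)) ≡ S + (t - (d - + 4) * F)
          e₂ = solve-∀
          e₃ : ∀ F d t → (d - + 4) * F + (t - (d - + 4) * F) ≡ t
          e₃ = solve-∀

        closed₃≡C : closed₃ H ≡ + C
        closed₃≡C = sym (ℤP.0≤i⇒+∣i∣≡i (0≤closed₃ H))

        boundℕ : suc (suc q) ℕ.* suc q ℕ.+ C ℕ.≤ 6 ℕ.* suc s
        boundℕ = ℤP.drop‿+≤+ (subst₂ _≤_ (cong₂ _+_ (f₂-value (suc q)) closed₃≡C) (sym (ℤP.pos-* 6 (suc s))) bound)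

        product≤ : suc (suc q) ℕ.* suc q ℕ.≤ 6 ℕ.* suc s
        product≤ = ℕP.≤-trans (ℕP.m≤m+n (suc (suc q) ℕ.* suc q) C) boundℕ

        triFree : ∀ {m} → suc (suc q) ℕ.* suc q ≡ m → 6 ℕ.* suc s ≡ m → TriFree H
        triFree {m} e e′ = closed₃≡0⇒TriFree H (trans closed₃≡C (cong +_ (ℕP.n≤0⇒n≡0 (ℕP.+-cancelˡ-≤ m C 0
          (subst₂ (λ x y → x ℕ.+ C ℕ.≤ y) e (trans e′ (sym (ℕP.+-identityʳ m))) boundℕ)))))

        cases : ∀ s′ k′ → s ≡ s′ → k ≡ k′ → ⊥
        -- Δ = 3 and all degrees are at most 2, so the sum of `f₂` would be 0 instead of 2.
        cases 0 0 refl refl = case trans (sym S₂′) (∑-zero λ i → ≤2⇒f₂≡0 (1≤deg i) (ℤP.≤-trans (deg≤ i) h)) of λ ()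
        -- Δ = 4: the value F = 6 uses up the whole bound, so H has no triangle, and 4 trees exceed
        -- 3.
        cases 0 1 refl refl = too-many (+ 4) (trees-unicyclic H (triFree refl refl) conn ds) (+<+ (s≤s (s≤s (s≤s (s≤s z≤n)))))
        -- Δ is at least 5, and F ≥ 12 exceeds 6.
        cases 0 (suc (suc k′)) refl refl = contradiction (ℕP.≤-trans (ℕP.*-mono-≤ {4} {4 ℕ.+ k′} {3} {3 ℕ.+ k′} (ℕP.m≤m+n 4 k′) (ℕP.m≤m+n 3 k′)) product≤) λ { (s≤s (s≤s (s≤s (s≤s (s≤s (s≤s ())))))) }
        -- Δ = 5: again F = 12 equals the bound, and 10 trees exceed 9.
        cases 1 0 refl refl = too-many (+ 10) (trees-bicyclic H (triFree refl refl) conn ds) (+<+ (ℕP.≤-refl))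
        -- Δ is at least 6, and F ≥ 20 exceeds 12.
        cases 1 (suc k′) refl refl = contradiction (ℕP.≤-trans (ℕP.*-mono-≤ {5} {5 ℕ.+ k′} {4} {4 ℕ.+ k′} (ℕP.m≤m+n 5 k′) (ℕP.m≤m+n 4 k′)) product≤)
          (ℕP.<⇒≱ (ℕP.m≤m+n 13 7))
        -- With s′ + 3 triangles F is at least 10(s′ + 3), above the bound 6(s′ + 3).
        cases (suc (suc s′)) k′ refl refl = contradiction (ℕP.≤-trans (ℕP.*-mono-≤ {2 ℕ.* (3 ℕ.+ s′)} {suc (suc q)} {5} {suc q} two five) product≤)
          (ℕP.<⇒≱ (subst (6 ℕ.* (3 ℕ.+ s′) ℕ.<_) (e s′) (ℕP.*-monoˡ-< (3 ℕ.+ s′) {6} {10} (ℕP.m≤m+n 7 3))))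
          where
          e : ∀ s → 10 ℕ.* (3 ℕ.+ s) ≡ 2 ℕ.* (3 ℕ.+ s) ℕ.* 5
          e = ℕ-solve-∀
          two : 2 ℕ.* (3 ℕ.+ s′) ℕ.≤ 2 ℕ.+ (2 ℕ.* (2 ℕ.+ s′) ℕ.+ k)
          two = ℕP.≤-trans (ℕP.≤-reflexive (e′ s′)) (ℕP.+-monoʳ-≤ 2 (ℕP.m≤m+n (2 ℕ.* (2 ℕ.+ s′)) k))
            where
            e′ : ∀ s → 2 ℕ.* (3 ℕ.+ s) ≡ 2 ℕ.+ 2 ℕ.* (2 ℕ.+ s)
            e′ = ℕ-solve-∀
          five : 5 ℕ.≤ 1 ℕ.+ (2 ℕ.* (2 ℕ.+ s′) ℕ.+ k)
          five = s≤s (ℕP.≤-trans (ℕP.*-monoʳ-≤ 2 (ℕP.m≤m+n 2 s′)) (ℕP.m≤m+n (2 ℕ.* (2 ℕ.+ s′)) k))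

      no-small-degree : ⊥
      no-small-degree = cases s k refl refl

  degree-sequence : ∃ λ c → deg H c ≡ + (2 ℕ.* suc s ℕ.+ suc k) × (∀ v → v ≢ c → deg H v ≤ + 2) × closed₃ H ≡ + 6 * + suc s
  degree-sequence with deg H c ℤP.≤? + suc (suc q)
  ... | yes h = contradiction h no-small-degree
  ... | no h  = let e = ℤP.≤-antisym deg-c≤Δ (ℤP.i<j⇒suc[i]≤j (ℤP.≰⇒> h)) in c , trans e (sym Δ-eq) , degree-case e

-- From equal spectra to equal branches

module _ {n} (H : Graph (suc n)) {βs} (M : Model βs) (sizes : n ≡ Model.n M)
         (same : ∀ a b → lapD (Model.K M) a b ≡ lapD H a b) where
  open Model M hiding (n)

  -- Both sides are the coefficient of y in det (yI + L), by `D-constant` for H and by `poly-linear`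
  -- for the model.
  trees-total : ∑ (trees H) ≡ (1ℤ + + n) * pow3 (tris βs)
  trees-total = ≈-all λ j → let y = + suc j in ≈-cancel y (+≤+ (s≤s z≤n)) (≈-trans (≈-sym (D-constant n y (arc H)))
    (≈-trans (≈-reflexive (trans (D-cong (suc n) {λ _ → y} {λ _ → y} {arc H} {λ i j → 1ℤ * arc H i j} (λ _ → refl) (λ i j _ → sym (ℤP.*-identityˡ (arc H i j)))) (trans (sym (same y 1ℤ)) (value y 1ℤ))))
      (≈-trans (proj₁ (poly-linear y βs)) (≈-reflexive (cong (λ z → y * ((1ℤ + + z) * pow3 (tris βs))) (sym (trans sizes n-eq)))))))

  -- The total being positive, some root admits a spanning tree.
  connected : Conn H
  connected = let r , h = positiveTerm (0≤trees H) (subst (1ℤ ≤_) (sym trees-total) (1≤* {1ℤ + + n} (+≤+ (s≤s z≤n)) (1≤pow3 (tris βs)))) in trees≢0⇒Conn H r (1≤⇒≢0 h)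
    where
    1≤pow3 : ∀ s → 1ℤ ≤ pow3 s
    1≤pow3 zero    = ℤP.≤-refl
    1≤pow3 (suc s) = 1≤* {+ 3} {pow3 s} (+≤+ (s≤s z≤n)) (1≤pow3 s)

  private
    sameDegrees : ∀ y → lapD K 1ℤ y ≡ lapD H 1ℤ y
    sameDegrees = same 1ℤ

  degSum-H : degSum H ≡ + 2 * (+ n + + tris βs)
  degSum-H = trans (sym (degSum≡ K H sameDegrees)) (trans degSum-eq (cong (λ z → + 2 * (+ z + + tris βs)) (sym sizes)))

  sum₂-H : ∑ (λ i → f₂ (deg H i)) ≡ f₂ (deg K c)
  sum₂-H = trans (∑f₂ H) (trans (sym (cong₂ _+_ (degSum₂≡ K H sameDegrees) (cong₂ (λ x z → - + 3 * x + + suc z * + 2) (degSum≡ K H sameDegrees) (sym sizes)))) (trans (sym (∑f₂ K)) (degs f₂ refl refl)))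

  sum₃-H : ∑ (λ i → f₃ (deg H i)) - closed₃ H ≡ f₃ (deg K c) - + 6 * + tris βs
  sum₃-H = trans (cong (_- closed₃ H) (∑f₃ H)) (trans (e (degSum₃ H) (closed₃ H) _) (trans (sym (cong₂ _+_ (degSum₃≡ K H sameDegrees)
      (cong₂ (λ x (y , z) → - + 6 * x + (+ 11 * y + + suc z * - + 6)) (degSum₂≡ K H sameDegrees) (cong₂ _,_ (degSum≡ K H sameDegrees) (sym sizes)))))
    (trans (sym (e (degSum₃ K) (closed₃ K) _)) (trans (cong (_- closed₃ K) (sym (∑f₃ K))) (cong₂ _-_ (degs f₃ refl refl) closed-eq)))))
    where
    e : ∀ x c y → x + y - c ≡ x - c + y
    e = solve-∀

SameShape : List Branch → List Branch → Set
SameShape βs γs = tris γs ≡ tris βs × length (paths γs) ≡ length (paths βs)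

cospectral-structure : ∀ {n} (H : Graph (suc n)) {βs} (M : Model βs) → n ≡ Model.n M → 1 ℕ.≤ tris βs → 1 ℕ.≤ length (paths βs) →
  (∀ a b → lapD (Model.K M) a b ≡ lapD H a b) → ∃ λ c → ∃ λ γs → toPG H c ≃ PG γs × SameShape βs γs × Positive γs
cospectral-structure {zero} H {βs} M sizes 1≤s 1≤k same = case ℕP.≤-trans (ℕP.≤-trans (ℕP.*-monoʳ-≤ 2 1≤s) (ℕP.m≤m+n (2 ℕ.* tris βs) _)) (ℕP.≤-reflexive (sym (trans sizes (Model.n-eq M)))) of λ ()
cospectral-structure {suc n} H {βs} M sizes 1≤s 1≤k same = go (tris βs) (length (paths βs)) refl refl 1≤s 1≤k
  where
  open Model M using (K; c; deg-c)
  go : ∀ s k → s ≡ tris βs → k ≡ length (paths βs) → 1 ℕ.≤ s → 1 ℕ.≤ k → ∃ λ c → ∃ λ γs → toPG H c ≃ PG γs × SameShape βs γs × Positive γs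
  go (suc s) (suc k) es ek _ _ = let c′ , d , small , closed = degree-sequence H conn s k ds
                                        (trans (sum₂-H H M sizes same) (cong f₂ Δ)) (trans (sum₃-H H M sizes same) (cong₂ (λ d t → f₃ d - + 6 * + t) Δ (sym es)))
                                        (trans (trees-total H M sizes same) (cong (λ t → (1ℤ + + suc n) * pow3 t) (sym es)))
                                     γs , f , t , pos , d′ = structure (suc n) H c′ (suc s) conn small closed ds
                                 -- Two expressions for the degree of c′ yield the number of paths
                                 -- once the triangles agree.
                                 in c′ , γs , f , (trans t es , trans (ℕP.+-cancelˡ-≡ (2 ℕ.* suc s) _ _ (ℤP.+-injective (trans (sym d′) d))) ek) , pos
    where
    conn = connected H M sizes same
    ds : degSum H ≡ + 2 * (+ suc n + + suc s)
    ds = trans (degSum-H H M sizes same) (cong (λ t → + 2 * (+ suc n + + t)) (sym es))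
    Δ : deg K c ≡ + (2 ℕ.* suc s ℕ.+ suc k)
    Δ = trans deg-c (cong₂ (λ x y → + (2 ℕ.* x ℕ.+ y)) (sym es) (sym ek))

model-lapD : ∀ {n} (G : Graph n) {c βs} → toPG G c ≃ PG βs → (M : Model βs) → ∀ a b → lapD G a b ≡ proj₁ (poly a b βs)
model-lapD G f M a b = trans (≃⇒lapD G (Model.K M) (≃-trans f (≃-sym (Model.iso M))) a b) (Model.value M a b)

normalForm-positive : ∀ {βs} → Positive βs → Positive (normalForm βs)
normalForm-positive {βs} pos = subst (All (1 ℕ.≤_)) (sym (paths-normal (paths βs) (tris βs))) pos
  where
  paths-tri : ∀ s → paths (replicate s tri) ≡ []
  paths-tri zero    = refl
  paths-tri (suc s) = paths-tri s
  paths-normal : ∀ ts s → paths (map path ts ++ replicate s tri) ≡ ts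
  paths-normal []       s = paths-tri s
  paths-normal (t ∷ ts) s = cong (t ∷_) (paths-normal ts s)

-- Both lists are sorted into paths before equally many triangles, so `triBase` is a common base.
-- The powers of 1 + y from cleared denominators agree because the numbers of paths do.
same-branches : ∀ {n} (G H : Graph n) {c d βs γs} → toPG G c ≃ PG βs → toPG H d ≃ PG γs → Positive βs → Positive γs → SameShape βs γs →
  1 ℕ.≤ tris βs → 1 ℕ.≤ length (paths βs) → (∀ a b → lapD G a b ≡ lapD H a b) → βs ↭ γs
same-branches G H {βs = βs} {γs} f g pos pos′ (t , k) 1≤s 1≤k same = ↭-trans (↭-normalForm βs) (↭-trans
    (subst (λ s → normalForm βs ↭ map path (paths γs) ++ replicate s tri) (sym t) (++⁺ʳ (replicate (tris βs) tri) (map⁺ path perm))) (↭-sym (↭-normalForm γs)))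
  where
  normal : ∀ {n} (G : Graph n) {c βs} → toPG G c ≃ PG βs → Positive βs → ∀ a b → lapD G a b ≡ proj₁ (poly a b (normalForm βs))
  normal G {βs = βs} f pos = model-lapD G (≃-trans f (PG-perm (↭-normalForm βs))) (model (normalForm βs) (normalForm-positive {βs} pos))
  values : ∀ a b → proj₁ (poly a b (normalForm βs)) ≡ proj₁ (poly a b (map path (paths γs) ++ replicate (tris βs) tri))
  values a b = trans (sym (normal G f pos a b)) (trans (same a b) (trans (normal H g pos′ a b) (cong (λ s → proj₁ (poly a b (map path (paths γs) ++ replicate s tri))) t)))
  agree : SameBranches (triBase (tris βs)) (paths βs) (paths γs)
  agree j = let y = + suc j in trans (sym (cong proj₁ (ySeries-paths y (paths βs) (replicate (tris βs) tri))))
    (trans (cong₂ (λ l x → (1ℤ + y) ^ l * x) (sym k) (values ((1ℤ - y) * (1ℤ - y)) y)) (cong proj₁ (ySeries-paths y (paths γs) (replicate (tris βs) tri))))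
  perm : paths βs ↭ paths γs
  perm = branches-injective (length (paths βs)) (triBase (tris βs)) (paths βs) (paths γs) refl k pos pos′ (nonzero 1≤s 1≤k) agree
    where
    nonzero : ∀ {s k} → 1 ℕ.≤ s → 1 ℕ.≤ k → + 2 * + s - + 2 + + k ≢ 0ℤ
    nonzero {suc s} {suc k} _ _ e = case trans (sym (trans (r (+ s) (+ k)) (cong (λ z → 1ℤ + (z + + k)) (sym (ℤP.pos-* 2 s))))) e of λ ()
      where
      r : ∀ s k → + 2 * (1ℤ + s) - + 2 + (1ℤ + k) ≡ 1ℤ + (+ 2 * s + k)
      r = solve-∀

branched-DLS : ∀ {n} (G H : Graph n) {c βs} → toPG G c ≃ PG βs → Positive βs → 1 ℕ.≤ tris βs → 1 ℕ.≤ length (paths βs) →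
  (∀ a b → lapD G a b ≡ lapD H a b) → H ≅ G
branched-DLS {suc n} G H {c} {βs} g pos 1≤s 1≤k same = conclude (cospectral-structure H M
    (ℕP.suc-injective (Perm.↔⇒≡ (permutation (to G≃K) (from G≃K) (to∘from G≃K) (from∘to G≃K)))) 1≤s 1≤k
    (λ a b → trans (sym (≃⇒lapD G (Model.K M) G≃K a b)) (same a b)))
  where
  M = model βs pos
  G≃K : toPG G c ≃ toPG (Model.K M) (Model.c M)
  G≃K = ≃-trans g (≃-sym (Model.iso M))
  conclude : (∃ λ d → ∃ λ γs → toPG H d ≃ PG γs × SameShape βs γs × Positive γs) → H ≅ G
  conclude (d , γs , h , shape , pos′) = ≃⇒≅ H G (≃-trans h (≃-trans (≃-sym (PG-perm
    (same-branches G H g h pos pos′ shape 1≤s 1≤k same))) (≃-sym g)))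

theorem3p10 : ∀ {n m} (G : Graph n) (H : Graph m) →
    IsPathFriendship G → LCospectral G H → H ≅ G
theorem3p10 G H (s , ts , 1≤s , 1≤k , pos , iso) cosp = go H cosp (cospectral-size G H cosp)
  where
  branched = pathFriendship-branches s ts pos
  go : ∀ {m} (H : Graph m) → LCospectral G H → _ ≡ m → H ≅ G
  -- The orders must be identified before the evaluations of `lapD` can be compared at a common
  -- homogenisation degree.
  go H cosp refl =
    let d , βs , f , t , k , pos′ = branched
        c , g = ≅⇒≃ G (pathFriendship s ts) iso d
    in branched-DLS G H {c} {βs} (≃-trans g f) pos′ (subst (1 ℕ.≤_) (sym t) 1≤s) (subst (1 ℕ.≤_) (sym k) 1≤k) (cospectral-lapD G H cosp)
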